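{- Let $p$ be an odd prime, $F$ a field containing a primitive $p$th root of unity, $a\in\dot F\setminus\dot F^p$ and $E=F(\sqrt[p]{a})$. If $F$ is $p$-rigid, then $E$ is $p$-rigid.
   Context: For a field $L$, $\dot L=L\setminus\{0\}$ and $\dot L^p$ is the group of nonzero $p$th powers. An element $b\in\dot L\setminus\dot L^p$ is $p$-rigid if every element of $N_{L(\sqrt[p]{b})/L}(L(\sqrt[p]{b})^\times)$ lies in $\bigcup_{k=0}^{p-1}b^k\dot L^p$; $L$ is $p$-rigid if every element of $\dot L\setminus\dot L^p$ is $p$-rigid. -}

module Defs where

open import Algebra.Bundles using (CommutativeRing)
open import Algebra.Definitions using (Invertible)
open import Algebra.Morphism.Structures using (module RingMorphisms)
import Algebra.Properties.Semiring.Exp as Exp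
import Algebra.Properties.Semiring.Sum as Sum
open import Data.Fin.Base using (Fin; zero; suc; toℕ; punchIn)
open import Data.Nat.Base as ℕ using (ℕ; zero; suc)
open import Data.Product.Base using (∃; ∃-syntax; _×_)
open import Level using (Level; _⊔_) renaming (suc to lsuc)
open import Relation.Nullary.Negation.Core using (¬_)

private
  variable
    c ℓ : Level

-- The library's HeytingField carries an apartness relation; this is the
-- ordinary notion, with "nonzero" meaning the negation of equality to 0.
record Field c ℓ : Set (lsuc (c ⊔ ℓ)) where
  field
    commutativeRing : CommutativeRing c ℓ
  open CommutativeRing commutativeRing public
  field
    1≉0        : ¬ (1# ≈ 0#)
    invertible : ∀ x → ¬ (x ≈ 0#) → Invertible _≈_ 1# _*_ x

  open Exp semiring public using (_^_)
  open Sum semiring public using (sum)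

module _ (L : Field c ℓ) where
  open Field L hiding (zero)

  IsNonzeroPower : ℕ → Carrier → Set (c ⊔ ℓ)
  IsNonzeroPower p x = ∃[ y ] ¬ (y ≈ 0#) × x ≈ y ^ p

  IsPrimitiveRoot : ℕ → Carrier → Set ℓ
  IsPrimitiveRoot n ζ =
    ζ ^ n ≈ 1# × (∀ k → 0 ℕ.< k → k ℕ.< n → ¬ (ζ ^ k ≈ 1#))

  -- Laplace expansion along the first row.
  det : ∀ {n} → (Fin n → Fin n → Carrier) → Carrier
  det {zero}  M = 1#
  det {suc n} M = sum λ j →
    (- 1#) ^ toℕ j * (M zero j * det (λ i k → M (suc i) (punchIn j k)))

-- The subfield of K generated by the image of ι and the element β.
module _ (L K : Field c ℓ) where
  private
    module L = Field L
  open Field K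

  data InGenerated (ι : L.Carrier → Carrier) (β : Carrier) :
                   Carrier → Set (c ⊔ ℓ) where
    base : ∀ x → InGenerated ι β (ι x)
    gen  : InGenerated ι β β
    add  : ∀ {x y} → InGenerated ι β x → InGenerated ι β y →
           InGenerated ι β (x + y)
    neg  : ∀ {x} → InGenerated ι β x → InGenerated ι β (- x)
    mul  : ∀ {x y} → InGenerated ι β x → InGenerated ι β y →
           InGenerated ι β (x * y)
    inv  : ∀ {x y} → InGenerated ι β x → x * y ≈ 1# → InGenerated ι β y
    resp : ∀ {x y} → x ≈ y → InGenerated ι β x → InGenerated ι β y

-- A field extension K = L(β) of L with βᵖ = b, i.e. a choice of L(ᵖ√b).
record RootExtension (p : ℕ) (L : Field c ℓ) (b : Field.Carrier L) :
                     Set (lsuc (c ⊔ ℓ)) where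
  private
    module L = Field L
  field
    K : Field c ℓ
  open Field K
  open RingMorphisms L.rawRing rawRing using (IsRingHomomorphism)
  field
    ι                  : L.Carrier → Carrier
    isRingHomomorphism : IsRingHomomorphism ι
    β                  : Carrier
    β^p≈b              : β ^ p ≈ ι b
    generates          : ∀ x → InGenerated L K ι β x

  -- n is the norm N_{K/L}(z): the determinant of multiplication by z, where
  -- column j of M holds the coordinates of z βʲ in 1, β, …, βᵖ⁻¹.  For p prime
  -- and b not a pth power, Xᵖ − b is irreducible, so these powers do form an
  -- L-basis of K and n is determined by z; only that case is used below.
  IsNorm : Carrier → L.Carrier → Set (c ⊔ ℓ)
  IsNorm z n = ∃ λ (M : Fin p → Fin p → L.Carrier) →
    (∀ j → z * β ^ toℕ j ≈ sum λ i → ι (M i j) * β ^ toℕ i) ×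
    n L.≈ det L M

module _ (p : ℕ) (L : Field c ℓ) where
  open Field L

  -- L(ᵖ√b) is unique up to isomorphism over L when Xᵖ − b is irreducible, so
  -- quantifying over all choices of it is the same as fixing one.
  IsRigidElement : Carrier → Set (lsuc (c ⊔ ℓ))
  IsRigidElement b =
    (R : RootExtension p L b) → let open RootExtension R in
    ∀ z n → ¬ (Field._≈_ K z (Field.0# K)) → IsNorm z n →
    ∃ λ (k : Fin p) → ∃[ y ] IsNonzeroPower L p y × n ≈ b ^ toℕ k * y

  IsRigid : Set (lsuc (c ⊔ ℓ))
  IsRigid = ∀ b → ¬ (b ≈ 0#) → ¬ IsNonzeroPower L p b → IsRigidElement b

{-# OPTIONS --safe #-}
-- Let N denote the norm of a cyclic extension of degree p.  If k is p-rigid at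
-- b and K = k(ᵖ√b) has the conjugation τ, then every x in K has the norm of some
-- (ᵖ√b)ⁱ y with y in k, so by Hilbert 90 x = (ᵖ√b)ⁱ y τ(w)/w.  Iterating this p
-- times, and since (τ − 1)ᵖ = τᵖ − 1 = 0 modulo p, one gets K̇ = ⟨ᵖ√b⟩ k̇ K̇ᵖ.
--
-- For E = F(α), αᵖ = a, write b = αⁱ f up to p-th powers, and let n = N(z) be a
-- norm from E(ᵖ√b).  If i = 0, then L = E(ᵖ√f) is bicyclic over F.  By
-- transitivity N_{E/F}(n) is a norm from F(ᵖ√f), which forces n into F Ėᵖ.  The
-- structure result applies to the norms of z to all p + 1 intermediate fields of
-- L/F, and the product of these norms is zᵖ N_{L/F}(z).  So z is, up to a factor
-- whose p-th power lies in F, a product of elements of the intermediate fields,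
-- whose norms to E are known by rigidity of F.  If i ≠ 0, then multiplying n by a
-- power of b one may assume n = g in F.  Were g not a p-th power in E, then b
-- would be a norm from E(ᵖ√g) by the symmetry of cyclic algebras, and
-- transitivity would give a contradiction.
module Submission where

open import Defs
open import Axiom.ExcludedMiddle using (ExcludedMiddle)
open import Data.Nat.Base using (ℕ)
open import Data.Nat.Divisibility using (_∣_)
open import Data.Nat.Primality using (Prime)
open import Data.Product.Base using (∃)
open import Level using (_⊔_)
open import Relation.Nullary.Negation.Core using (¬_)

open import Algebra.Bundles using (CommutativeMonoid; CommutativeRing; Semiring)
open import Algebra.Module.Bundles using (LeftSemimodule)
open import Algebra.Morphism.Structures using (module RingMorphisms)
import Algebra.Construct.Pointwise as Pointwise
import Algebra.Properties.CommutativeMonoid.Mult as MonoidMult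
import Algebra.Properties.CommutativeMonoid.Sum as MonoidSum
import Algebra.Properties.CommutativeSemigroup as CommutativeSemigroupProperties
import Algebra.Properties.CommutativeSemiring.Exp as CommutativeExp
import Algebra.Properties.Ring as RingProperties
import Algebra.Properties.Semiring.Exp as SemiringExp
import Algebra.Properties.Semiring.Sum as SemiringSum
import Algebra.Solver.CommutativeMonoid as CommutativeMonoidSolver
open import Data.Empty using (⊥; ⊥-elim)
open import Data.Fin.Permutation using (Permutation; permutation; _⟨$⟩ʳ_)
open import Data.Fin.Properties using (toℕ-inject₁; toℕ-fromℕ; toℕ-fromℕ<; toℕ<n; toℕ-injective; punchInᵢ≢i)
import Data.Fin.Properties as Fin
open import Data.Fin.Base using (Fin; zero; suc; toℕ; fromℕ; fromℕ<; inject₁; punchIn)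
open import Data.Nat.Base as ℕ using (zero; suc)
open import Data.Product.Base using (_×_; _,_; proj₁; proj₂)
open import Data.Nat.Combinatorics using (nCn≡1; nCk≡n!/k![n-k]!; k![n∸k]!∣n!; nCk+nC[k+1]≡[n+1]C[k+1]; k>n⇒nCk≡0) renaming (_C_ to _choose_)
open import Data.Nat.DivMod using (_/_; _%_; _mod_; m%n<n; m%n%n≡m%n; m/n*n≡m; m≡m%n+[m/n]*n; [m+kn]%n≡m%n; m<n⇒m%n≡m; %-distribˡ-*)
open import Data.Nat.Divisibility using (m∣m*n; ∣⇒≤; divides; m%n≡0⇒n∣m)
open import Data.Nat.Coprimality using (prime⇒coprime; coprime-Bézout)
open import Data.Nat.GCD using (module Bézout)
open import Data.Nat.Induction using (<-rec)
open import Data.Nat.Primality using (prime⇒nonZero; prime⇒nonTrivial; euclidsLemma; ¬prime[0])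
import Data.Nat.Properties as ℕ
open import Data.Nat.Tactic.RingSolver using (solve-∀)
open import Data.Sum.Base using (_⊎_; inj₁; inj₂)
open import Data.Unit.Polymorphic.Base using (⊤; tt)
open import Data.Vec.Functional using (insertAt)
open import Data.Vec.Functional.Properties using (insertAt-lookup; insertAt-punchIn)
open import Data.Vec.Base using (Vec; _∷_; lookup; tabulate)
open import Data.Vec.Properties using (lookup∘tabulate)
open import Function.Base using (_∘_; id)
open import Level using (Level; Lift; lift)
open import Relation.Binary.PropositionalEquality.Core as ≡ using (_≡_; _≢_)
import Relation.Binary.Reasoning.Setoid as SetoidReasoning
open import Relation.Nullary using (Dec; yes; no)

-- The norm is given as a determinant over an arbitrary choice of k(ᵖ√b), while the argument needs
-- conjugates and embeddings. Hence a `RootExtension` is first equipped with coordinates (`Kummer`),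
-- and its determinant norm is identified with the product of conjugates. No factorisation of
-- polynomials is used. Irreducibility of Xᵖ - g is replaced by a fact about operators: if Yᵖ = g on
-- a k-space and g is not a p-th power, then x, Yx, ..., Yᵖ⁻¹x are independent for every x ≠ 0. With
-- Y multiplication by X it makes k[X]/(Xᵖ - g) a field; with Y = zτ it gives the symmetry of norms.
-- In the bicyclic case the norm of z to an intermediate field is a monomial times a p-th power, and
-- the exponent in the monomial must vanish modulo p. This is why n is first forced into F Ėᵖ: then
-- N_{L/F}(z) is a p-th power in F, and an exponent prime to p would make the radicand of the
-- intermediate field a p-th power. Oddness of p gives N(ᵖ√b) = b without a sign, so ᵖ√b itself is
-- an element of norm b.

private
  variable
    c ℓ : Level

-- Elementary identities in a field.

module FieldProperties (L : Field c ℓ) where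
  open Field L using
    ( Carrier; _≈_; _≉_; _+_; _*_; -_; _-_; 0#; 1#; _^_; sum; 1≉0; invertible
    ; refl; sym; trans; reflexive; setoid; semiring; commutativeSemiring; ring
    ; +-commutativeMonoid; *-commutativeMonoid; +-isCommutativeMonoid; +-isAbelianGroup
    ; +-cong; +-congˡ; +-congʳ; +-assoc; +-comm; +-identityˡ; +-identityʳ
    ; -‿cong; -‿inverseˡ; -‿inverseʳ; zeroˡ; zeroʳ; distribˡ; distribʳ
    ; *-cong; *-congˡ; *-congʳ; *-assoc; *-comm; *-identityˡ; *-identityʳ ) public
  open SemiringExp semiring using (^-congˡ; ^-congʳ; ^-homo-*; ^-assocʳ) public
  open CommutativeExp commutativeSemiring using (^-distrib-*) public
  open CommutativeSemigroupProperties (CommutativeMonoid.commutativeSemigroup *-commutativeMonoid)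
    using (interchange; x∙yz≈y∙xz) public
  open RingProperties ring using
    ( -1*x≈-x; -‿involutive; -0#≈0#; -‿distribˡ-*; -‿distribʳ-*; x+x≈x⇒x≈0
    ; +-cancelˡ; +-cancelʳ; +-inverseˡ-unique; +-inverseʳ-unique ) public
  open SetoidReasoning setoid using (begin_; _∎; step-≈-⟩; step-≈-⟨; step-≡-⟩; step-≡-⟨) public
  open SemiringSum semiring using (sum-cong-≋; sum-replicate-zero; *-distribˡ-sum; *-distribʳ-sum)
  module *-Solver = CommutativeMonoidSolver *-commutativeMonoid using (solve; _⊕_; _⊜_)

  sum-cong : ∀ {n} {f g : Fin n → Carrier} → (∀ i → f i ≈ g i) → sum f ≈ sum g
  sum-cong = sum-cong-≋

  sum-zero : ∀ {n} {f : Fin n → Carrier} → (∀ i → f i ≈ 0#) → sum f ≈ 0#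
  sum-zero {n} f≈0 = trans (sum-cong f≈0) (sum-replicate-zero n)

  *-pullˡ : ∀ {n} x (f : Fin n → Carrier) → x * sum f ≈ sum λ i → x * f i
  *-pullˡ = *-distribˡ-sum

  *-pullʳ : ∀ {n} x (f : Fin n → Carrier) → sum f * x ≈ sum λ i → f i * x
  *-pullʳ = *-distribʳ-sum

  private
    linear-step : ∀ s c x y d → s * ((c * x + y) * d) ≈ c * (s * (x * d)) + s * (y * d)
    linear-step s c x y d = begin
      s * ((c * x + y) * d)  ≈⟨ *-congˡ (distribʳ d _ _) ⟩
      s * (c * x * d + y * d)  ≈⟨ distribˡ s _ _ ⟩
      s * (c * x * d) + s * (y * d)
        ≈⟨ +-congʳ (solve 4 (λ s c x d → s ⊕ ((c ⊕ x) ⊕ d) ⊜ c ⊕ (s ⊕ (x ⊕ d))) refl s c x d) ⟩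
      c * (s * (x * d)) + s * (y * d)   ∎
      where open *-Solver

  sum-+ : ∀ {n} (f g : Fin n → Carrier) → sum (λ i → f i + g i) ≈ sum f + sum g
  sum-+ = SemiringSum.∑-distrib-+ semiring

  sum-linear : ∀ {n} (s : Fin n → Carrier) c (x y r d : Fin n → Carrier) →
    (∀ j → r j ≈ c * x j + y j) →
    sum (λ j → s j * (r j * d j)) ≈
    c * sum (λ j → s j * (x j * d j)) + sum (λ j → s j * (y j * d j))
  sum-linear s c x y r d e = begin
    sum (λ j → s j * (r j * d j))
      ≈⟨ sum-cong (λ j → trans (*-congˡ (*-congʳ (e j))) (linear-step (s j) c (x j) (y j) (d j))) ⟩
    sum (λ j → c * (s j * (x j * d j)) + s j * (y j * d j))
      ≈⟨ sum-+ (λ j → c * (s j * (x j * d j))) (λ j → s j * (y j * d j)) ⟩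
    sum (λ j → c * (s j * (x j * d j))) + sum (λ j → s j * (y j * d j))
      ≈⟨ +-congʳ (sym (*-pullˡ c (λ j → s j * (x j * d j)))) ⟩
    c * sum (λ j → s j * (x j * d j)) + sum (λ j → s j * (y j * d j)) ∎

-- Alternating forms and the product formula for determinants.

module Determinant (L : Field c ℓ) where
  open FieldProperties L
  open SemiringSum semiring using (sum-remove)

  private
    variable
      n m N : ℕ

    Row : ℕ → Set c
    Row N = Fin N → Carrier

    Form : ℕ → ℕ → Set c
    Form N n = Vec (Row N) n → Carrier

  sgn : Fin n → Carrier
  sgn j = (- 1#) ^ toℕ j

  -- Rows are functions, compared only pointwise. Admitting every `r` that agrees pointwise with the
  -- combination also makes the form respect pointwise equality of each row.
  Multilinear : ∀ n → Form N n → Set (c ⊔ ℓ)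
  Multilinear zero  Φ = ⊤
  Multilinear (suc n) Φ =
    (∀ a x y r A → (∀ k → r k ≈ a * x k + y k) →
      Φ (r ∷ A) ≈ a * Φ (x ∷ A) + Φ (y ∷ A)) ×
    (∀ x → Multilinear n (Φ ∘ (x ∷_)))

  -- Only adjacent equal rows are required to give zero; `swap` and `repeated` extend this to equal
  -- rows at any distance.
  Alternating : ∀ n → Form N n → Set (c ⊔ ℓ)
  Alternating zero  Φ = ⊤
  Alternating (suc zero)  Φ = ⊤
  Alternating (suc (suc n)) Φ =
    (∀ x y A → (∀ k → x k ≈ y k) → Φ (x ∷ y ∷ A) ≈ 0#) ×
    (∀ x → Alternating (suc n) (Φ ∘ (x ∷_)))

  multilinear-sum : ∀ n (s w : Fin m → Carrier) {Ψ : Fin m → Form N n} →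
    (∀ j → Multilinear n (Ψ j)) →
    Multilinear n (λ A → sum λ j → s j * (w j * Ψ j A))
  multilinear-sum zero  s w ml = tt
  multilinear-sum (suc n) s w {Ψ} ml =
    (λ a x y r A e → trans
      (flip-factors (r ∷ A))
      (trans (sum-linear s a (λ j → Ψ j (x ∷ A)) (λ j → Ψ j (y ∷ A)) (λ j → Ψ j (r ∷ A)) w (λ j → proj₁ (ml j) a x y r A e))
      (+-cong (*-congˡ (sym (flip-factors (x ∷ A)))) (sym (flip-factors (y ∷ A)))))) ,
    (λ x → multilinear-sum n s w (λ j → proj₂ (ml j) x))
    where
    flip-factors : ∀ A → sum (λ j → s j * (w j * Ψ j A)) ≈ sum (λ j → s j * (Ψ j A * w j))
    flip-factors A = sum-cong λ j → *-congˡ (*-comm (w j) (Ψ j A))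

  alternating-sum : ∀ n (s w : Fin m → Carrier) {Ψ : Fin m → Form N n} →
    (∀ j → Alternating n (Ψ j)) →
    Alternating n (λ A → sum λ j → s j * (w j * Ψ j A))
  alternating-sum zero  s w al = tt
  alternating-sum (suc zero)  s w al = tt
  alternating-sum (suc (suc n)) s w al =
    (λ x y A e → sum-zero λ j → trans
      (*-congˡ (trans (*-congˡ (proj₁ (al j) x y A e)) (zeroʳ _))) (zeroʳ _)) ,
    λ x → alternating-sum (suc n) s w (λ j → proj₂ (al j) x)

  det-cong : ∀ {n} {A B : Fin n → Fin n → Carrier} →
    (∀ i j → A i j ≈ B i j) → det L A ≈ det L B
  det-cong {zero}  e = refl
  det-cong {suc n} {A} {B} e = sum-cong
    {f = λ j → sgn j * (A zero j * det L λ i k → A (suc i) (punchIn j k))}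
    {g = λ j → sgn j * (B zero j * det L λ i k → B (suc i) (punchIn j k))} λ j →
    *-congˡ (*-cong (e zero j) (det-cong λ i k → e (suc i) (punchIn j k)))

  -- The minors of a matrix select columns, so the induction needs the
  -- determinant of an arbitrary selection of the columns.
  minor : (Fin n → Fin N) → Form N n
  minor κ A = det L λ i k → lookup A i (κ k)

  minor-multilinear : ∀ n (κ : Fin n → Fin N) → Multilinear n (minor κ)
  minor-multilinear zero  κ = tt
  minor-multilinear (suc n) κ =
    (λ a x y r A e → sum-linear sgn a (x ∘ κ) (y ∘ κ) (r ∘ κ) (λ j → minor (κ ∘ punchIn j) A) (e ∘ κ)) ,
    λ x → multilinear-sum n sgn (x ∘ κ) λ j → minor-multilinear n (κ ∘ punchIn j)

  private
    pair : ∀ {n} (κ : Fin (2 ℕ.+ n) → Fin N) (x y : Row N)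
           (F : (Fin n → Fin N) → Carrier) → Fin (2 ℕ.+ n) → Fin (1 ℕ.+ n) → Carrier
    pair κ x y F j k = sgn j * (x (κ j) *
      (sgn k * (y (κ (punchIn j k)) * F (κ ∘ punchIn j ∘ punchIn k))))

    neg-mul : ∀ a b → (- 1# * a) * b ≈ - (a * b)
    neg-mul a b = trans (*-assoc _ _ _) (-1*x≈-x _)

    suc-suc : ∀ s t a b d → (- 1# * s) * (a * ((- 1# * t) * (b * d))) ≈ s * (a * (t * (b * d)))
    suc-suc s t a b d = begin
      (- 1# * s) * (a * ((- 1# * t) * (b * d)))
        ≈⟨ solve 6 (λ m s t a b d → (m ⊕ s) ⊕ (a ⊕ ((m ⊕ t) ⊕ (b ⊕ d))) ⊜ (m ⊕ m) ⊕ (s ⊕ (a ⊕ (t ⊕ (b ⊕ d))))) refl (- 1#) s t a b d ⟩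
      (- 1# * - 1#) * (s * (a * (t * (b * d)))) ≈⟨ *-congʳ (trans (-1*x≈-x _) (-‿involutive _)) ⟩
      1# * (s * (a * (t * (b * d))))  ≈⟨ *-identityˡ _ ⟩
      s * (a * (t * (b * d)))  ∎
      where open *-Solver

    -- Expanding along two equal rows, the terms for the columns j and l
    -- cancel against those for l and j.
    pair-cancel : ∀ {N} n (κ : Fin (2 ℕ.+ n) → Fin N) x y → (∀ k → x k ≈ y k) → ∀ F →
      (∀ {κ κ′} → (∀ i → κ i ≡ κ′ i) → F κ ≈ F κ′) →
      (sum λ j → sum λ k → pair κ x y F j k) ≈ 0#
    pair-cancel {N} n κ x y x≈y F F-cong = begin
      sum (pair κ x y F zero) + sum (λ j → pair κ x y F (suc j) zero + sum (λ k → pair κ x y F (suc j) (suc k)))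
        ≈⟨ +-congˡ (sum-+ (λ j → pair κ x y F (suc j) zero) (λ j → sum (λ k → pair κ x y F (suc j) (suc k)))) ⟩
      sum (pair κ x y F zero) +
        (sum (λ j → pair κ x y F (suc j) zero) + sum (λ j → sum (λ k → pair κ x y F (suc j) (suc k))))
        ≈⟨ sym (+-assoc _ _ _) ⟩
      sum (pair κ x y F zero) + sum (λ j → pair κ x y F (suc j) zero) +
        sum (λ j → sum (λ k → pair κ x y F (suc j) (suc k)))
        ≈⟨ +-cong (trans (sym (sum-+ (pair κ x y F zero) (λ j → pair κ x y F (suc j) zero))) (sum-zero edge)) (rest n κ F F-cong) ⟩
      0# + 0# ≈⟨ +-identityˡ _ ⟩
      0#  ∎
      where
      edge : ∀ k → pair κ x y F zero k + pair κ x y F (suc k) zero ≈ 0#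
      edge k = begin
        1# * (x (κ zero) * (sgn k * (y (κ (suc k)) * F₁))) + (- 1# * sgn k) * (x (κ (suc k)) * (1# * (y (κ zero) * F₂)))
          ≈⟨ +-congˡ (trans (neg-mul _ _) (-‿cong inner)) ⟩
        1# * (x (κ zero) * (sgn k * (y (κ (suc k)) * F₁))) + - (1# * (x (κ zero) * (sgn k * (y (κ (suc k)) * F₁))))
          ≈⟨ -‿inverseʳ _ ⟩
        0# ∎
        where
        F₁ = F (κ ∘ suc ∘ punchIn k)
        F₂ = F (κ ∘ punchIn (suc k) ∘ suc)
        inner : sgn k * (x (κ (suc k)) * (1# * (y (κ zero) * F₂))) ≈
                1# * (x (κ zero) * (sgn k * (y (κ (suc k)) * F₁)))
        inner = trans
          (*-congˡ (*-cong (x≈y _) (*-congˡ (*-congʳ (sym (x≈y _))))))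
          (solve 5 (λ e s a b d → s ⊕ (b ⊕ (e ⊕ (a ⊕ d))) ⊜ e ⊕ (a ⊕ (s ⊕ (b ⊕ d)))) refl
            1# (sgn k) (x (κ zero)) (y (κ (suc k))) F₁)
          where open *-Solver
      rest : ∀ n (κ : Fin (2 ℕ.+ n) → Fin N) F →
        (∀ {κ κ′} → (∀ i → κ i ≡ κ′ i) → F κ ≈ F κ′) →
        sum (λ j → sum (λ k → pair κ x y F (suc j) (suc k))) ≈ 0#
      rest zero  κ F F-cong = sum-zero {1} {λ _ → 0#} λ _ → refl
      rest (suc n) κ F F-cong = trans
        (sum-cong λ j → sum-cong λ k → trans
          (suc-suc (sgn j) (sgn k) (x (κ (suc j))) (y (κ (suc (punchIn j k)))) _)
          (*-congˡ (*-congˡ (*-congˡ (*-congˡ (F-cong (split j k)))))))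
        -- Both chosen columns are now positive, so column 0 remains in every minor. It is absorbed
        -- into `F`, which is why `F` is an arbitrary function of the selection.
        (pair-cancel n (κ ∘ suc) x y x≈y (λ κ′ → F (cons κ′))
          (λ e → F-cong λ { zero → ≡.refl ; (suc i) → e i }))
        where
        cons : (Fin n → Fin N) → Fin (suc n) → Fin N
        cons κ′ zero  = κ zero
        cons κ′ (suc i) = κ′ i
        split : ∀ j k i → κ (punchIn (suc j) (punchIn (suc k) i)) ≡
                          cons (κ ∘ suc ∘ punchIn j ∘ punchIn k) i
        split j k zero  = ≡.refl
        split j k (suc i) = ≡.refl

  minor-alternating : ∀ n (κ : Fin n → Fin N) → Alternating n (minor κ)
  minor-alternating zero  κ = tt
  minor-alternating (suc zero)  κ = tt
  minor-alternating (suc (suc n)) κ =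
    (λ x y A x≈y → trans
      (sum-cong λ j → trans (*-congˡ (*-pullˡ (x (κ j)) (λ k → sgn k * (y (κ (punchIn j k)) * minor (κ ∘ punchIn j ∘ punchIn k) A))))
        (*-pullˡ (sgn j) (λ k → x (κ j) * (sgn k * (y (κ (punchIn j k)) * minor (κ ∘ punchIn j ∘ punchIn k) A)))))
      (pair-cancel n κ x y x≈y (λ κ → minor κ A)
        (λ e → det-cong λ i j → reflexive (≡.cong (lookup A i) (e j))))) ,
    λ x → alternating-sum (suc n) sgn (x ∘ κ) λ j → minor-alternating (suc n) (κ ∘ punchIn j)

  alternating-tail : ∀ n (Φ : Form N (suc n)) → Alternating (suc n) Φ →
    ∀ x → Alternating n (Φ ∘ (x ∷_))
  alternating-tail zero  Φ al x = tt
  alternating-tail (suc n) Φ al x = proj₂ al x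

  swap : ∀ {n} (Φ : Form N (2 ℕ.+ n)) → Multilinear _ Φ → Alternating _ Φ →
    ∀ x y A → Φ (x ∷ y ∷ A) ≈ - Φ (y ∷ x ∷ A)
  swap Φ (ml , mls) (al , _) x y A = +-inverseˡ-unique _ _ (begin
    Φ (x ∷ y ∷ A) + Φ (y ∷ x ∷ A)  ≈⟨ +-cong (sym (part x)) (sym (part′ y)) ⟩
    Φ (x ∷ z ∷ A) + Φ (y ∷ z ∷ A)  ≈⟨ +-congʳ (sym (*-identityˡ _)) ⟩
    1# * Φ (x ∷ z ∷ A) + Φ (y ∷ z ∷ A) ≈⟨ sym (ml 1# x y z (z ∷ A) (λ k → refl)) ⟩
    Φ (z ∷ z ∷ A)  ≈⟨ al z z A (λ k → refl) ⟩
    0#  ∎)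
    where
    z = λ k → 1# * x k + y k
    sum₂ : ∀ w → Φ (w ∷ z ∷ A) ≈ Φ (w ∷ x ∷ A) + Φ (w ∷ y ∷ A)
    sum₂ w = trans (proj₁ (mls w) 1# x y z A (λ k → refl)) (+-congʳ (*-identityˡ _))
    part : ∀ w → Φ (x ∷ z ∷ A) ≈ Φ (x ∷ y ∷ A)
    part w = trans (sum₂ x) (trans (+-congʳ (al x x A λ k → refl)) (+-identityˡ _))
    part′ : ∀ w → Φ (y ∷ z ∷ A) ≈ Φ (y ∷ x ∷ A)
    part′ w = trans (sum₂ y) (trans (+-congˡ (al y y A λ k → refl)) (+-identityʳ _))

  repeated : ∀ {n} (Φ : Form N (suc n)) → Multilinear _ Φ → Alternating _ Φ →
    ∀ x A i → (∀ k → lookup A i k ≈ x k) → Φ (x ∷ A) ≈ 0#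
  repeated Φ ml al x (y ∷ A) zero e = proj₁ al x y A (λ k → sym (e k))
  repeated {n = suc (suc _)} Φ ml al x (y ∷ A) (suc i) e = trans (swap Φ ml al x y A)
    (trans (-‿cong (repeated (Φ ∘ (y ∷_)) (proj₂ ml y) (proj₂ al y) x A i e)) -0#≈0#)

  -- Since `Φ` vanishes as soon as some row equals `x`, the multiples of `x` can be removed from the
  -- rows one at a time. In `expand` the row `x` is the one already placed in front.
  shear : ∀ {N} n (Φ : Form N n) → Multilinear n Φ →
    ∀ (x : Row N) → (∀ A i → (∀ k → lookup A i k ≈ x k) → Φ A ≈ 0#) →
    ∀ (a : Fin n → Carrier) (y r : Fin n → Row N) → (∀ i (k : Fin N) → r i k ≈ a i * x k + y i k) →
    Φ (tabulate r) ≈ Φ (tabulate y)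
  shear zero  Φ ml x v a y r e = refl
  shear (suc n) Φ ml x v a y r e = trans (proj₁ ml (a zero) x (y zero) (r zero) _ (e zero))
    (trans (+-congʳ (trans (*-congˡ (v _ zero (λ k → refl))) (zeroʳ _)))
    (trans (+-identityˡ _)
    (shear n (Φ ∘ (y zero ∷_)) (proj₂ ml (y zero)) x (λ A i → v (y zero ∷ A) (suc i)) (a ∘ suc) (y ∘ suc) (r ∘ suc) (e ∘ suc))))

  zero-row : ∀ {n} (Φ : Form N (suc n)) → Multilinear _ Φ →
    ∀ r A → (∀ k → r k ≈ 0#) → Φ (r ∷ A) ≈ 0#
  zero-row Φ ml r A e = trans
    (proj₁ ml (- 1#) r r r A λ k → trans (e k) (sym (trans (+-congˡ (e k)) (trans (+-identityʳ _) (trans (*-congˡ (e k)) (zeroʳ _))))))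
    (trans (+-congʳ (-1*x≈-x _)) (-‿inverseˡ _))

  row-sum : ∀ {n} m (Φ : Form N (suc n)) → Multilinear _ Φ →
    ∀ (a : Fin m → Carrier) (b : Fin m → Row N) r A → (∀ k → r k ≈ sum λ j → a j * b j k) →
    Φ (r ∷ A) ≈ sum λ j → a j * Φ (b j ∷ A)
  row-sum zero  Φ ml a b r A e = zero-row Φ ml r A e
  row-sum (suc m) Φ ml a b r A e = trans
    (proj₁ ml (a zero) (b zero) (λ k → sum λ j → a (suc j) * b (suc j) k) r A e)
    (+-congˡ (row-sum m Φ ml (a ∘ suc) (b ∘ suc) _ A λ k → refl))

  move-row : ∀ n (Φ : Form N (suc n)) → Multilinear _ Φ → Alternating _ Φ →
    ∀ (b : Fin (suc n) → Row N) j →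
    Φ (b j ∷ tabulate (b ∘ punchIn j)) ≈ sgn j * Φ (tabulate b)
  move-row n  Φ ml al b zero  = sym (*-identityˡ _)
  move-row (suc n) Φ ml al b (suc j) = trans (swap Φ ml al _ _ _)
    (trans (-‿cong (move-row n (Φ ∘ (b zero ∷_)) (proj₂ ml (b zero)) (proj₂ al (b zero)) (b ∘ suc) j))
    (sym (neg-mul _ _)))

  -- The first row is expanded over the `b j`; `shear` then removes `b j` from the other rows,
  -- induction treats what is left, and `move-row` supplies the sign of the Laplace expansion.
  -- Taking the determinant itself for `Φ` gives `det-*`.
  expand : ∀ n (Φ : Form N n) → Multilinear n Φ → Alternating n Φ →
    ∀ (b : Fin n → Row N) (M : Fin n → Fin n → Carrier) (r : Fin n → Row N) → (∀ i k → r i k ≈ sum λ j → M i j * b j k) →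
    Φ (tabulate r) ≈ det L M * Φ (tabulate b)
  expand zero  Φ ml al b M r e = sym (*-identityˡ _)
  expand (suc n) Φ ml al b M r e = begin
    Φ (r zero ∷ tabulate (r ∘ suc))
      ≈⟨ row-sum (suc n) Φ ml (M zero) b (r zero) (tabulate (r ∘ suc)) (e zero) ⟩
    sum (λ j → M zero j * Φ (b j ∷ tabulate (r ∘ suc)))
      ≈⟨ sum-cong {f = λ j → M zero j * Φ (b j ∷ tabulate (r ∘ suc))} {g = λ j → M zero j * (minorₘ j * (sgn j * Φ (tabulate b)))} (λ j → *-congˡ (step j)) ⟩
    sum (λ j → M zero j * (minorₘ j * (sgn j * Φ (tabulate b))))
      ≈⟨ sum-cong {f = λ j → M zero j * (minorₘ j * (sgn j * Φ (tabulate b)))} {g = λ j → (sgn j * (M zero j * minorₘ j)) * Φ (tabulate b)} (λ j → solve 4 (λ a d s f → a ⊕ (d ⊕ (s ⊕ f)) ⊜ (s ⊕ (a ⊕ d)) ⊕ f) refl (M zero j) (minorₘ j) (sgn j) (Φ (tabulate b))) ⟩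
    sum (λ j → (sgn j * (M zero j * minorₘ j)) * Φ (tabulate b))
      ≈⟨ sym (*-pullʳ (Φ (tabulate b)) (λ j → sgn j * (M zero j * minorₘ j))) ⟩
    det L M * Φ (tabulate b) ∎
    where
    open *-Solver
    minorₘ : Fin (suc n) → Carrier
    minorₘ j = det L λ i k → M (suc i) (punchIn j k)
    step : ∀ j → Φ (b j ∷ tabulate (r ∘ suc)) ≈
      minorₘ j * (sgn j * Φ (tabulate b))
    step j = trans
      (shear n (Φ ∘ (b j ∷_)) (proj₂ ml (b j)) (b j) (λ A i → repeated Φ ml al (b j) A i)
        (λ i → M (suc i) j) (λ i k → sum λ l → M (suc i) (punchIn j l) * b (punchIn j l) k) (r ∘ suc)
        (λ i k → trans (e (suc i) k) (sum-remove {i = j} λ l → M (suc i) l * b l k)))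
      (trans (expand n (Φ ∘ (b j ∷_)) (proj₂ ml (b j)) (alternating-tail n Φ al (b j)) (b ∘ punchIn j) (λ i k → M (suc i) (punchIn j k)) _ (λ i k → refl))
      (*-congˡ (move-row n Φ ml al b j)))

  det-* : ∀ {n} (A B : Fin n → Fin n → Carrier) →
    det L (λ i k → sum λ j → A i j * B j k) ≈ det L A * det L B
  det-* {n} A B = trans (sym (det-tabulate _))
    (trans (expand n (minor id) (minor-multilinear n id) (minor-alternating n id) B A (λ i k → sum λ j → A i j * B j k) (λ i k → refl))
    (*-congˡ (det-tabulate B)))
    where
    det-tabulate : ∀ M → minor id (tabulate M) ≈ det L M
    det-tabulate M = det-cong λ i j → reflexive (≡.cong (λ r → r j) (lookup∘tabulate M i))

-- An opaque copy of the library's sum: Agda can then infer the summands.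
module BigOp {c ℓ} (M : CommutativeMonoid c ℓ) where
  open CommutativeMonoid M
  private module S = MonoidSum M

  opaque
    ⨁ : ∀ {n} → (Fin n → Carrier) → Carrier
    ⨁ = S.sum

    ⨁≡sum : ∀ {n} (f : Fin n → Carrier) → ⨁ f ≡ S.sum f
    ⨁≡sum f = ≡.refl

    ⨁-cong : ∀ {n} {f g : Fin n → Carrier} → (∀ i → f i ≈ g i) → ⨁ f ≈ ⨁ g
    ⨁-cong = S.sum-cong-≋

    ⨁-empty : (f : Fin 0 → Carrier) → ⨁ f ≈ ε
    ⨁-empty f = refl

    ⨁-suc : ∀ {n} (f : Fin (suc n) → Carrier) → ⨁ f ≈ f zero ∙ ⨁ (f ∘ suc)
    ⨁-suc f = refl

    ⨁-last : ∀ {n} (f : Fin (suc n) → Carrier) → ⨁ f ≈ ⨁ (f ∘ inject₁) ∙ f (fromℕ n)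
    ⨁-last = S.sum-init-last

    ⨁-ε : ∀ {n} → ⨁ {n} (λ _ → ε) ≈ ε
    ⨁-ε {n} = S.sum-replicate-zero n

    ⨁-∙ : ∀ {n} (f g : Fin n → Carrier) → ⨁ (λ i → f i ∙ g i) ≈ ⨁ f ∙ ⨁ g
    ⨁-∙ = S.∑-distrib-+

    ⨁-comm : ∀ {m n} (f : Fin m → Fin n → Carrier) →
      ⨁ (λ i → ⨁ (f i)) ≈ ⨁ (λ j → ⨁ λ i → f i j)
    ⨁-comm = S.∑-comm

    ⨁-permute : ∀ {n} (f : Fin n → Carrier) (π : Permutation n n) → ⨁ f ≈ ⨁ (f ∘ (π ⟨$⟩ʳ_))
    ⨁-permute = S.∑-permute

    ⨁-remove : ∀ {n} (f : Fin (suc n) → Carrier) j → ⨁ f ≈ f j ∙ ⨁ (f ∘ punchIn j)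
    ⨁-remove f j = S.sum-remove {i = j} f

  ⨁-all-ε : ∀ {n} {f : Fin n → Carrier} → (∀ i → f i ≈ ε) → ⨁ f ≈ ε
  ⨁-all-ε e = trans (⨁-cong e) ⨁-ε

  ⨁-single : ∀ {n} (f : Fin n → Carrier) j → (∀ i → i ≢ j → f i ≈ ε) → ⨁ f ≈ f j
  ⨁-single {suc n} f j e = trans (⨁-remove f j)
    (trans (∙-congˡ (⨁-all-ε λ i → e (punchIn j i) punchInᵢ≢i-)) (identityʳ _))
    where punchInᵢ≢i- = λ {i} → punchInᵢ≢i j i

  ⨁-shift : ∀ n (h : ℕ → Carrier) →
    ⨁ {n} (h ∘ toℕ) ∙ h n ≈ h 0 ∙ ⨁ {n} (h ∘ suc ∘ toℕ)
  ⨁-shift n h = trans (sym (trans (⨁-last {n} (h ∘ toℕ)) (∙-cong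
    (⨁-cong λ i → reflexive (≡.cong h (toℕ-inject₁ i))) (reflexive (≡.cong h (toℕ-fromℕ n))))))
    (⨁-suc {n} (h ∘ toℕ))

module BigOpHom {c ℓ c′ ℓ′} (M : CommutativeMonoid c ℓ) (N : CommutativeMonoid c′ ℓ′) where
  private
    module M = CommutativeMonoid M
    module N = CommutativeMonoid N
  open BigOp
  ⨁-hom : (h : M.Carrier → N.Carrier) →
    (∀ {x y} → x M.≈ y → h x N.≈ h y) →
    h M.ε N.≈ N.ε → (∀ x y → h (x M.∙ y) N.≈ h x N.∙ h y) →
    ∀ {n} (f : Fin n → M.Carrier) → h (⨁ M f) N.≈ ⨁ N (h ∘ f)
  ⨁-hom h h-cong h-ε h-∙ {zero}  f = N.trans (h-cong (⨁-empty M f)) (N.trans h-ε (N.sym (⨁-empty N _)))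
  ⨁-hom h h-cong h-ε h-∙ {suc n} f = N.trans (h-cong (⨁-suc M f)) (N.trans (h-∙ _ _)
    (N.trans (N.∙-congˡ (⨁-hom h h-cong h-ε h-∙ (f ∘ suc))) (N.sym (⨁-suc N _))))

-- Fields under excluded middle, and their homomorphisms.

module FieldKit {c ℓ} (em : ExcludedMiddle (c ⊔ ℓ)) (L : Field c ℓ) where
  open FieldProperties L public
  open BigOp +-commutativeMonoid public using () renaming
    ( ⨁ to ∑; ⨁≡sum to ∑≡sum; ⨁-cong to ∑-cong; ⨁-empty to ∑-empty; ⨁-suc to ∑-suc; ⨁-∙ to ∑-+
    ; ⨁-comm to ∑-comm; ⨁-remove to ∑-remove; ⨁-all-ε to ∑-all-0; ⨁-single to ∑-single; ⨁-shift to ∑-shift )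
  open BigOp *-commutativeMonoid public using () renaming
    ( ⨁ to ∏; ⨁-cong to ∏-cong; ⨁-empty to ∏-empty; ⨁-suc to ∏-suc; ⨁-ε to ∏-ε; ⨁-∙ to ∏-*
    ; ⨁-comm to ∏-comm; ⨁-all-ε to ∏-all-1; ⨁-shift to ∏-shift )

  infix 4 _≟_
  _≟_ : ∀ x y → Dec (x ≈ y)
  x ≟ y with em {Lift c (x ≈ y)}
  ... | yes (lift e) = yes e
  ... | no ¬e  = no (¬e ∘ lift)

  stable : ∀ {x y} → ¬ ¬ (x ≈ y) → x ≈ y
  stable {x} {y} ¬¬e with x ≟ y
  ... | yes e = e
  ... | no ¬e = ⊥-elim (¬¬e ¬e)

  infix 9 _⁻¹
  -- Totalised by 0⁻¹ = 0, so that quotients can be written without a proof argument; the laws below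
  -- assume a nonzero argument.
  _⁻¹ : Carrier → Carrier
  x ⁻¹ with x ≟ 0#
  ... | yes _  = 0#
  ... | no x≉0 = proj₁ (invertible x x≉0)

  ⁻¹-inverseˡ : ∀ {x} → x ≉ 0# → x ⁻¹ * x ≈ 1#
  ⁻¹-inverseˡ {x} x≉0 with x ≟ 0#
  ... | yes x≈0 = ⊥-elim (x≉0 x≈0)
  ... | no x≉0′ = proj₁ (proj₂ (invertible x x≉0′))

  ⁻¹-inverseʳ : ∀ {x} → x ≉ 0# → x * x ⁻¹ ≈ 1#
  ⁻¹-inverseʳ x≉0 = trans (*-comm _ _) (⁻¹-inverseˡ x≉0)

  *-cancel : ∀ {x y z} → x ≉ 0# → x * y ≈ x * z → y ≈ z
  *-cancel {x} {y} {z} x≉0 e = begin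
    y  ≈⟨ *-identityˡ _ ⟨
    1# * y  ≈⟨ *-congʳ (⁻¹-inverseˡ x≉0) ⟨
    (x ⁻¹ * x) * y   ≈⟨ *-assoc _ _ _ ⟩
    x ⁻¹ * (x * y)   ≈⟨ *-congˡ e ⟩
    x ⁻¹ * (x * z)   ≈⟨ *-assoc _ _ _ ⟨
    (x ⁻¹ * x) * z   ≈⟨ *-congʳ (⁻¹-inverseˡ x≉0) ⟩
    1# * z  ≈⟨ *-identityˡ _ ⟩
    z  ∎

  *-nonzero : ∀ {x y} → x ≉ 0# → y ≉ 0# → x * y ≉ 0#
  *-nonzero x≉0 y≉0 e = y≉0 (*-cancel x≉0 (trans e (sym (zeroʳ _))))

  nonzero-resp : ∀ {x y} → x ≈ y → x ≉ 0# → y ≉ 0#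
  nonzero-resp e x≉0 y≈0 = x≉0 (trans e y≈0)

  factor-nonzeroˡ : ∀ {x y} → x * y ≉ 0# → x ≉ 0#
  factor-nonzeroˡ xy≉0 x≈0 = xy≉0 (trans (*-congʳ x≈0) (zeroˡ _))

  ⁻¹-nonzero : ∀ {x} → x ≉ 0# → x ⁻¹ ≉ 0#
  ⁻¹-nonzero x≉0 = factor-nonzeroˡ (nonzero-resp (sym (⁻¹-inverseˡ x≉0)) 1≉0)

  ^-nonzero : ∀ {x} n → x ≉ 0# → x ^ n ≉ 0#
  ^-nonzero zero  x≉0 = 1≉0
  ^-nonzero (suc n) x≉0 = *-nonzero x≉0 (^-nonzero n x≉0)

  ∏-nonzero : ∀ {n} {f : Fin n → Carrier} → (∀ i → f i ≉ 0#) → ∏ f ≉ 0#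
  ∏-nonzero {zero}  f≉0 = nonzero-resp (sym (∏-empty _)) 1≉0
  ∏-nonzero {suc n} f≉0 = nonzero-resp (sym (∏-suc _)) (*-nonzero (f≉0 zero) (∏-nonzero (f≉0 ∘ suc)))

  1^n : ∀ n → 1# ^ n ≈ 1#
  1^n zero  = refl
  1^n (suc n) = trans (*-identityˡ _) (1^n n)

  ^-∏ : ∀ {n} (f : Fin n → Carrier) m → ∏ f ^ m ≈ ∏ (λ i → f i ^ m)
  ^-∏ f m = ⨁-hom (_^ m) (^-congˡ m) (1^n m) (λ x y → ^-distrib-* x y m) f
    where open BigOpHom *-commutativeMonoid *-commutativeMonoid

  ∏-const : ∀ n x → ∏ {n} (λ _ → x) ≈ x ^ n
  ∏-const zero  x = ∏-empty _
  ∏-const (suc n) x = trans (∏-suc _) (*-congˡ (∏-const n x))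

  ∑-*ˡ : ∀ {n} x (f : Fin n → Carrier) → x * ∑ f ≈ ∑ λ i → x * f i
  ∑-*ˡ x = ⨁-hom (x *_) *-congˡ (zeroʳ x) (distribˡ x)
    where open BigOpHom +-commutativeMonoid +-commutativeMonoid

  ∑-*ʳ : ∀ {n} x (f : Fin n → Carrier) → ∑ f * x ≈ ∑ λ i → f i * x
  ∑-*ʳ x = ⨁-hom (_* x) *-congʳ (zeroˡ x) (distribʳ x)
    where open BigOpHom +-commutativeMonoid +-commutativeMonoid

  ⁻¹-^ : ∀ {x} n → x ≉ 0# → (x ⁻¹) ^ n * x ^ n ≈ 1#
  ⁻¹-^ n x≉0 = trans (sym (^-distrib-* _ _ n)) (trans (^-congˡ n (⁻¹-inverseˡ x≉0)) (1^n n))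

record FieldHom {c ℓ} (K L : Field c ℓ) : Set (c ⊔ ℓ) where
  private
    module K = Field K
    module L = Field L
  field
    ⟦_⟧  : K.Carrier → L.Carrier
    ⟦⟧-cong : ∀ {x y} → x K.≈ y → ⟦ x ⟧ L.≈ ⟦ y ⟧
    +-homo : ∀ x y → ⟦ x K.+ y ⟧ L.≈ ⟦ x ⟧ L.+ ⟦ y ⟧
    *-homo : ∀ x y → ⟦ x K.* y ⟧ L.≈ ⟦ x ⟧ L.* ⟦ y ⟧
    1-homo : ⟦ K.1# ⟧ L.≈ L.1#

module HomKit {c ℓ} (em : ExcludedMiddle (c ⊔ ℓ)) {K L : Field c ℓ} (h : FieldHom K L) where
  open FieldHom h public
  private
    module K = FieldKit em K
    module L = FieldKit em L

  0-homo : ⟦ K.0# ⟧ L.≈ L.0#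
  0-homo = L.x+x≈x⇒x≈0 _ (L.trans (L.sym (+-homo _ _)) (⟦⟧-cong (K.+-identityˡ _)))

  -‿homo : ∀ x → ⟦ K.- x ⟧ L.≈ L.- ⟦ x ⟧
  -‿homo x = L.+-inverseˡ-unique _ _
    (L.trans (L.sym (+-homo _ _)) (L.trans (⟦⟧-cong (K.-‿inverseˡ x)) 0-homo))

  ^-homo : ∀ x n → ⟦ x K.^ n ⟧ L.≈ ⟦ x ⟧ L.^ n
  ^-homo x zero  = 1-homo
  ^-homo x (suc n) = L.trans (*-homo _ _) (L.*-congˡ (^-homo x n))

  ∑-homo : ∀ {n} (f : Fin n → K.Carrier) → ⟦ K.∑ f ⟧ L.≈ L.∑ (⟦_⟧ ∘ f)
  ∑-homo = ⨁-hom ⟦_⟧ ⟦⟧-cong 0-homo +-homo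
    where open BigOpHom K.+-commutativeMonoid L.+-commutativeMonoid

  ∏-homo : ∀ {n} (f : Fin n → K.Carrier) → ⟦ K.∏ f ⟧ L.≈ L.∏ (⟦_⟧ ∘ f)
  ∏-homo = ⨁-hom ⟦_⟧ ⟦⟧-cong 1-homo *-homo
    where open BigOpHom K.*-commutativeMonoid L.*-commutativeMonoid

  nonzero : ∀ {x} → x K.≉ K.0# → ⟦ x ⟧ L.≉ L.0#
  nonzero {x} x≉0 e = L.1≉0 (begin
    L.1#  ≈⟨ 1-homo ⟨
    ⟦ K.1# ⟧  ≈⟨ ⟦⟧-cong (K.⁻¹-inverseˡ x≉0) ⟨
    ⟦ x K.⁻¹ K.* x ⟧  ≈⟨ *-homo _ _ ⟩
    ⟦ x K.⁻¹ ⟧ L.* ⟦ x ⟧  ≈⟨ L.*-congˡ e ⟩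
    ⟦ x K.⁻¹ ⟧ L.* L.0#  ≈⟨ L.zeroʳ _ ⟩
    L.0#  ∎)
    where open L using (begin_; _∎; step-≈-⟩; step-≈-⟨)

  reflect-nonzero : ∀ {x} → ⟦ x ⟧ L.≉ L.0# → x K.≉ K.0#
  reflect-nonzero hx≉0 e = hx≉0 (L.trans (⟦⟧-cong e) 0-homo)

  injective : ∀ {x y} → ⟦ x ⟧ L.≈ ⟦ y ⟧ → x K.≈ y
  injective {x} {y} e = K.stable λ x≉y →
    nonzero (λ d → x≉y (K.+-cancelʳ (K.- y) x y (K.trans d (K.sym (K.-‿inverseʳ y)))))
      (L.trans (+-homo x (K.- y)) (L.trans (L.+-cong e (-‿homo y)) (L.-‿inverseʳ _)))

idHom : ∀ {c ℓ} (K : Field c ℓ) → FieldHom K K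
idHom K = record { ⟦_⟧ = id ; ⟦⟧-cong = id ; +-homo = λ _ _ → refl ; *-homo = λ _ _ → refl ; 1-homo = refl }
  where open Field K

infixr 9 _∘ₕ_
_∘ₕ_ : ∀ {c ℓ} {K L M : Field c ℓ} → FieldHom L M → FieldHom K L → FieldHom K M
_∘ₕ_ {M = M} g f = record
  { ⟦_⟧  = g.⟦_⟧ ∘ f.⟦_⟧
  ; ⟦⟧-cong = g.⟦⟧-cong ∘ f.⟦⟧-cong
  ; +-homo  = λ x y → trans (g.⟦⟧-cong (f.+-homo x y)) (g.+-homo _ _)
  ; *-homo  = λ x y → trans (g.⟦⟧-cong (f.*-homo x y)) (g.*-homo _ _)
  ; 1-homo  = trans (g.⟦⟧-cong f.1-homo) g.1-homo
  }
  where
  open Field M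
  module g = FieldHom g
  module f = FieldHom f

module Kronecker {c ℓ} (em : ExcludedMiddle (c ⊔ ℓ)) (L : Field c ℓ) where
  open FieldKit em L

  δ : ∀ {n} → Fin n → Fin n → Carrier
  δ zero  zero  = 1#
  δ zero  (suc j) = 0#
  δ (suc i) zero  = 0#
  δ (suc i) (suc j) = δ i j

  δ-diag : ∀ {n} (i : Fin n) → δ i i ≈ 1#
  δ-diag zero  = refl
  δ-diag (suc i) = δ-diag i

  δ-off : ∀ {n} {i j : Fin n} → i ≢ j → δ i j ≈ 0#
  δ-off {i = zero}  {zero}  i≢j = ⊥-elim (i≢j ≡.refl)
  δ-off {i = zero}  {suc j} i≢j = refl
  δ-off {i = suc i} {zero}  i≢j = refl
  δ-off {i = suc i} {suc j} i≢j = δ-off (i≢j ∘ ≡.cong suc)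

  δ-inject₁ : ∀ {n} (i j : Fin n) → δ (inject₁ i) (inject₁ j) ≈ δ i j
  δ-inject₁ zero  zero  = refl
  δ-inject₁ zero  (suc j) = refl
  δ-inject₁ (suc i) zero  = refl
  δ-inject₁ (suc i) (suc j) = δ-inject₁ i j

  δ-inject₁-last : ∀ {n} (i : Fin n) → δ (inject₁ i) (fromℕ n) ≈ 0#
  δ-inject₁-last zero  = refl
  δ-inject₁-last (suc i) = δ-inject₁-last i

  δ-last-inject₁ : ∀ {n} (i : Fin n) → δ (fromℕ n) (inject₁ i) ≈ 0#
  δ-last-inject₁ zero  = refl
  δ-last-inject₁ (suc i) = δ-last-inject₁ i

  δ-sym : ∀ {n} (i j : Fin n) → δ i j ≈ δ j i
  δ-sym zero  zero  = refl
  δ-sym zero  (suc j) = refl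
  δ-sym (suc i) zero  = refl
  δ-sym (suc i) (suc j) = δ-sym i j

  ∑-δ : ∀ {n} (f : Fin n → Carrier) j → ∑ (λ i → f i * δ i j) ≈ f j
  ∑-δ f j = trans (∑-single _ j λ i i≢j → trans (*-congˡ (δ-off i≢j)) (zeroʳ _))
    (trans (*-congˡ (δ-diag j)) (*-identityʳ _))

  det-diag : ∀ {n} (d : Fin n → Carrier) → det L (λ i j → d i * δ i j) ≈ ∏ d
  det-diag {zero}  d = sym (∏-empty d)
  det-diag {suc n} d = begin
    det L (λ i j → d i * δ i j) ≡⟨ ∑≡sum term ⟨
    ∑ term  ≈⟨ ∑-single term zero off ⟩
    1# * ((d zero * 1#) * det L (λ i j → d (suc i) * δ i j))
      ≈⟨ trans (*-identityˡ _) (*-congʳ (*-identityʳ _)) ⟩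
    d zero * det L (λ i j → d (suc i) * δ i j) ≈⟨ *-congˡ (det-diag (d ∘ suc)) ⟩
    d zero * ∏ (d ∘ suc)  ≈⟨ ∏-suc d ⟨
    ∏ d  ∎
    where
    term : Fin (suc n) → Carrier
    term j = (- 1#) ^ toℕ j *
      (d zero * δ zero j * det L λ i k → d (suc i) * δ (suc i) (punchIn j k))
    off : ∀ j → j ≢ zero → term j ≈ 0#
    off zero  j≢0 = ⊥-elim (j≢0 ≡.refl)
    off (suc j) _   = trans (*-congˡ (trans (*-congʳ (zeroʳ _)) (zeroˡ _))) (zeroʳ _)

  det-*ᴹ : ∀ {n} (A B : Fin n → Fin n → Carrier) →
    det L (λ i k → ∑ λ j → A i j * B j k) ≈ det L A * det L B
  det-*ᴹ A B = trans (det-cong λ i k → reflexive (∑≡sum (λ j → A i j * B j k))) (det-* A B)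
    where open Determinant L

infixr 9 _↑_
_↑_ : ∀ {a} {A : Set a} → (A → A) → ℕ → A → A
(f ↑ zero)  x = x
(f ↑ suc n) x = f ((f ↑ n) x)

↑-suc : ∀ {a} {A : Set a} (f : A → A) n x → (f ↑ n) (f x) ≡ f ((f ↑ n) x)
↑-suc f zero  x = ≡.refl
↑-suc f (suc n) x = ≡.cong f (↑-suc f n x)

↑-+ : ∀ {a} {A : Set a} (f : A → A) m n x → (f ↑ (m ℕ.+ n)) x ≡ (f ↑ m) ((f ↑ n) x)
↑-+ f zero  n x = ≡.refl
↑-+ f (suc m) n x = ≡.cong f (↑-+ f m n x)

init-last : ∀ {a} n {P : Fin (suc n) → Set a} → (∀ i → P (inject₁ i)) → P (fromℕ n) → ∀ i → P i
init-last zero  h l zero  = l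
init-last (suc n) h l zero  = h zero
init-last (suc n) h l (suc i) = init-last n (h ∘ suc) l i

-- Linear operators and the ring k[X]/(Xᵖ - g).

module _ {c ℓ} {S : Semiring c ℓ} where
  record LinearMap (M N : LeftSemimodule S c ℓ) : Set (c ⊔ ℓ) where
    private
      module M = LeftSemimodule M
      module N = LeftSemimodule N
    field
      fun  : M.Carrierᴹ → N.Carrierᴹ
      cong  : ∀ {x y} → x M.≈ᴹ y → fun x N.≈ᴹ fun y
      +-homo  : ∀ x y → fun (x M.+ᴹ y) N.≈ᴹ fun x N.+ᴹ fun y
      *ₗ-homo : ∀ a x → fun (a M.*ₗ x) N.≈ᴹ a N.*ₗ fun x

    0-homo : fun M.0ᴹ N.≈ᴹ N.0ᴹ
    0-homo = N.≈ᴹ-trans (cong (M.≈ᴹ-sym (M.*ₗ-zeroˡ _)))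
      (N.≈ᴹ-trans (*ₗ-homo _ M.0ᴹ) (N.*ₗ-zeroˡ _))

    ⨁-homo : ∀ {n} (f : Fin n → M.Carrierᴹ) →
      fun (BigOp.⨁ M.+ᴹ-commutativeMonoid f) N.≈ᴹ BigOp.⨁ N.+ᴹ-commutativeMonoid (fun ∘ f)
    ⨁-homo = ⨁-hom fun cong 0-homo +-homo
      where open BigOpHom M.+ᴹ-commutativeMonoid N.+ᴹ-commutativeMonoid

  scale : (M : LeftSemimodule S c ℓ) → (∀ a b → Semiring._≈_ S (Semiring._*_ S a b) (Semiring._*_ S b a)) →
    Semiring.Carrier S → LinearMap M M
  scale M comm a = record
    { fun  = a *ₗ_
    ; cong  = *ₗ-congˡ
    ; +-homo  = *ₗ-distribˡ a
    ; *ₗ-homo = λ b x → ≈ᴹ-trans (≈ᴹ-sym (*ₗ-assoc a b x)) (≈ᴹ-trans (*ₗ-congʳ (comm a b)) (*ₗ-assoc b a x))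
    }
    where open LeftSemimodule M

  module Power {M : LeftSemimodule S c ℓ} (Y : LinearMap M M) where
    open LeftSemimodule M
    open LinearMap Y

    ↑-cong : ∀ n {x y} → x ≈ᴹ y → (fun ↑ n) x ≈ᴹ (fun ↑ n) y
    ↑-cong zero  e = e
    ↑-cong (suc n) e = cong (↑-cong n e)

    ↑-linear : ℕ → LinearMap M M
    ↑-linear n = record
      { fun = fun ↑ n ; cong = ↑-cong n ; +-homo = ↑-+-homo n ; *ₗ-homo = ↑-*ₗ-homo n }
      where
      ↑-+-homo : ∀ n x y → (fun ↑ n) (x +ᴹ y) ≈ᴹ (fun ↑ n) x +ᴹ (fun ↑ n) y
      ↑-+-homo zero  x y = ≈ᴹ-refl
      ↑-+-homo (suc n) x y = ≈ᴹ-trans (cong (↑-+-homo n x y)) (+-homo _ _)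
      ↑-*ₗ-homo : ∀ n a x → (fun ↑ n) (a *ₗ x) ≈ᴹ a *ₗ (fun ↑ n) x
      ↑-*ₗ-homo zero  a x = ≈ᴹ-refl
      ↑-*ₗ-homo (suc n) a x = ≈ᴹ-trans (cong (↑-*ₗ-homo n a x)) (*ₗ-homo a _)

module Action {c ℓ} (em : ExcludedMiddle (c ⊔ ℓ)) (k : Field c ℓ)
  (M : LeftSemimodule (Field.semiring k) c ℓ) (Y : LinearMap M M) where
  private module k = FieldKit em k
  open LeftSemimodule M public
  open LinearMap Y renaming (fun to y; cong to y-cong; +-homo to y-+; *ₗ-homo to y-*; ⨁-homo to y-⨁)
  open Power Y
  open BigOp +ᴹ-commutativeMonoid public
  open SetoidReasoning ≈ᴹ-setoid
  open Kronecker em k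

  private module Pow n = LinearMap (↑-linear n)

  -- This is v(Y) x for the polynomial v = Σ vᵢ Xⁱ.
  comb : ∀ {n} → (Fin n → k.Carrier) → Carrierᴹ → Carrierᴹ
  comb v x = ⨁ λ i → v i *ₗ (y ↑ toℕ i) x

  comb-cong : ∀ {n} {v w : Fin n → k.Carrier} {x x′} → (∀ i → v i k.≈ w i) → x ≈ᴹ x′ →
    comb v x ≈ᴹ comb w x′
  comb-cong v≈w x≈x′ = ⨁-cong λ i → *ₗ-cong (v≈w i) (↑-cong (toℕ i) x≈x′)

  comb-+ : ∀ {n} (v w : Fin n → k.Carrier) x → comb (λ i → v i k.+ w i) x ≈ᴹ comb v x +ᴹ comb w x
  comb-+ v w x = ≈ᴹ-trans (⨁-cong λ i → *ₗ-distribʳ _ (v i) (w i)) (⨁-∙ _ _)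

  *ₗ-⨁ : ∀ {n} a (f : Fin n → Carrierᴹ) → a *ₗ ⨁ f ≈ᴹ ⨁ λ i → a *ₗ f i
  *ₗ-⨁ a = LinearMap.⨁-homo (scale M k.*-comm a)

  comb-scale : ∀ {n} a (v : Fin n → k.Carrier) x → comb (λ i → a k.* v i) x ≈ᴹ a *ₗ comb v x
  comb-scale a v x = ≈ᴹ-trans (⨁-cong λ i → *ₗ-assoc a (v i) _) (≈ᴹ-sym (*ₗ-⨁ a _))

  comb-δ : ∀ {n} (j : Fin n) x → comb (λ i → δ j i) x ≈ᴹ (y ↑ toℕ j) x
  comb-δ j x = ≈ᴹ-trans
    (⨁-single _ j λ i i≢j → ≈ᴹ-trans (*ₗ-congʳ (δ-off (i≢j ∘ ≡.sym))) (*ₗ-zeroˡ _))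
    (≈ᴹ-trans (*ₗ-congʳ (δ-diag j)) (*ₗ-identityˡ _))

  comb-linear : ∀ {n} (v : Fin n → k.Carrier) → LinearMap M M
  comb-linear v = record
    { fun  = comb v
    ; cong  = comb-cong λ _ → k.refl
    ; +-homo  = λ x x′ → ≈ᴹ-trans
        (⨁-cong λ i → ≈ᴹ-trans (*ₗ-congˡ (Pow.+-homo (toℕ i) x x′)) (*ₗ-distribˡ (v i) _ _)) (⨁-∙ _ _)
    ; *ₗ-homo = λ a x → ≈ᴹ-trans
        (⨁-cong λ i → ≈ᴹ-trans (*ₗ-congˡ (Pow.*ₗ-homo (toℕ i) a x)) (LinearMap.*ₗ-homo (scale M k.*-comm (v i)) a _))
        (≈ᴹ-sym (*ₗ-⨁ a _))
    }

  y-comb : ∀ {n} (v : Fin n → k.Carrier) x → y (comb v x) ≈ᴹ ⨁ λ i → v i *ₗ (y ↑ suc (toℕ i)) x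
  y-comb v x = ≈ᴹ-trans (y-⨁ _) (⨁-cong λ i → y-* (v i) _)

  comb-y : ∀ {n} (v : Fin n → k.Carrier) x → comb v (y x) ≈ᴹ y (comb v x)
  comb-y v x = ≈ᴹ-trans (⨁-cong λ i → *ₗ-congˡ (≈ᴹ-reflexive (↑-suc y (toℕ i) x))) (≈ᴹ-sym (y-comb v x))

  comb-↑ : ∀ {n} (v : Fin n → k.Carrier) m x → comb v ((y ↑ m) x) ≈ᴹ (y ↑ m) (comb v x)
  comb-↑ v zero  x = ≈ᴹ-refl
  comb-↑ v (suc m) x = ≈ᴹ-trans (comb-y v _) (y-cong (comb-↑ v m x))

  -- Gives the commutativity of the product in `Truncated`, where both factors are polynomials in
  -- the shift applied to 1.
  comb-comm : ∀ {n m} (v : Fin n → k.Carrier) (w : Fin m → k.Carrier) x →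
    comb v (comb w x) ≈ᴹ comb w (comb v x)
  comb-comm v w x = ≈ᴹ-trans (⨁-cong λ i → *ₗ-congˡ (≈ᴹ-sym (comb-↑ w (toℕ i) x)))
    (≈ᴹ-sym (≈ᴹ-trans (LinearMap.⨁-homo (comb-linear w) _)
      (⨁-cong λ i → LinearMap.*ₗ-homo (comb-linear w) (v i) _)))

-- k[X]/(Xᵖ − g) for p = suc q, on coordinates with respect to 1, X, …, Xᵖ⁻¹.
module Truncated {c ℓ} (em : ExcludedMiddle (c ⊔ ℓ)) (k : Field c ℓ) (g : Field.Carrier k) (q : ℕ) where
  private module k = FieldKit em k
  open Kronecker em k

  V : Set c
  V = Fin (suc q) → k.Carrier

  V-semimodule : LeftSemimodule k.semiring c ℓ
  V-semimodule = record
    { Carrierᴹ = V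
    ; _≈ᴹ_  = λ v w → ∀ i → v i k.≈ w i
    ; _+ᴹ_  = λ v w i → v i k.+ w i
    ; _*ₗ_  = λ a v i → a k.* v i
    ; 0ᴹ  = λ _ → k.0#
    ; isLeftSemimodule = record
      { +ᴹ-isCommutativeMonoid = Pointwise.isCommutativeMonoid (Fin (suc q)) k.+-isCommutativeMonoid
      ; isPreleftSemimodule = record
        { *ₗ-cong  = λ a≈b v≈w i → k.*-cong a≈b (v≈w i)
        ; *ₗ-zeroˡ  = λ v i → k.zeroˡ (v i)
        ; *ₗ-distribʳ  = λ v a b i → k.distribʳ (v i) a b
        ; *ₗ-identityˡ = λ v i → k.*-identityˡ (v i)
        ; *ₗ-assoc  = λ a b v i → k.*-assoc a b (v i)
        ; *ₗ-zeroʳ  = λ a i → k.zeroʳ a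
        ; *ₗ-distribˡ  = λ a v w i → k.distribˡ a (v i) (w i)
        }
      }
    }

  -- Multiplication by X, with Xᵖ replaced by g.
  shift : V → V
  shift v zero  = g k.* v (fromℕ q)
  shift v (suc i) = v (inject₁ i)

  S : LinearMap V-semimodule V-semimodule
  S = record
    { fun  = shift
    ; cong  = λ { e zero → k.*-congˡ (e (fromℕ q)) ; e (suc i) → e (inject₁ i) }
    ; +-homo  = λ { v w zero → k.distribˡ g _ _ ; v w (suc i) → k.refl }
    ; *ₗ-homo = λ { a v zero → k.x∙yz≈y∙xz g a _ ; a v (suc i) → k.refl }
    }

  open Action em k V-semimodule S public

  e₀ : V
  e₀ = δ zero

  shift-δ : ∀ (j : Fin q) → shift (δ (inject₁ j)) ≈ᴹ δ (suc j)
  shift-δ j zero  = k.trans (k.*-congˡ (δ-inject₁-last j)) (k.zeroʳ g)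
  shift-δ j (suc i) = δ-inject₁ j i

  shift-δ-last : shift (δ (fromℕ q)) ≈ᴹ (g *ₗ e₀)
  shift-δ-last zero  = k.*-congˡ (δ-diag (fromℕ q))
  shift-δ-last (suc i) = k.trans (δ-last-inject₁ i) (k.sym (k.zeroʳ g))

  shift-↑ : ∀ j → (shift ↑ toℕ j) e₀ ≈ᴹ δ j
  shift-↑ j = go (toℕ j) j ≡.refl
    where
    go : ∀ n j → toℕ j ≡ n → (shift ↑ n) e₀ ≈ᴹ δ j
    go zero  zero  e = ≈ᴹ-refl {e₀}
    go (suc n) (suc j) e = ≈ᴹ-trans {_} {shift (δ (inject₁ j))} {δ (suc j)}
      (LinearMap.cong S (go n (inject₁ j) (≡.trans (toℕ-inject₁ j) (ℕ.suc-injective e)))) (shift-δ j)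

  ⨁-at : ∀ {n} (f : Fin n → V) i → ⨁ f i k.≈ k.∑ (λ j → f j i)
  ⨁-at f i = ⨁-hom (λ v → v i) (λ e → e i) k.refl (λ _ _ → k.refl) f
    where open BigOpHom +ᴹ-commutativeMonoid k.+-commutativeMonoid

  comb-e₀ : ∀ v → comb v e₀ ≈ᴹ v
  comb-e₀ v i = k.trans (⨁-at _ i) (k.trans
    (k.∑-cong λ j → k.*-congˡ (shift-↑ j i)) (∑-δ v i))

  shift-p : ∀ v → (shift ↑ suc q) v ≈ᴹ g *ₗ v
  shift-p v = begin
    (shift ↑ suc q) v  ≈⟨ Power.↑-cong S (suc q) (comb-e₀ v) ⟨
    (shift ↑ suc q) (comb v e₀)  ≈⟨ comb-↑ v (suc q) e₀ ⟨
    comb v ((shift ↑ suc q) e₀)  ≈⟨ LinearMap.cong (comb-linear v) top ⟩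
    comb v (g *ₗ e₀)  ≈⟨ LinearMap.*ₗ-homo (comb-linear v) g e₀ ⟩
    g *ₗ comb v e₀  ≈⟨ *ₗ-congˡ {g} (comb-e₀ v) ⟩
    g *ₗ v  ∎
    where
    open SetoidReasoning ≈ᴹ-setoid
    top : (shift ↑ suc q) e₀ ≈ᴹ g *ₗ e₀
    top = ≈ᴹ-trans {_} {shift (δ (fromℕ q))} {g *ₗ e₀}
      (LinearMap.cong S (≈ᴹ-trans {_} {(shift ↑ toℕ (fromℕ q)) e₀} {δ (fromℕ q)}
        (≈ᴹ-reflexive (≡.cong (λ n → (shift ↑ n) e₀) (≡.sym (toℕ-fromℕ q)))) (shift-↑ (fromℕ q))))
      shift-δ-last

  module On (M : LeftSemimodule k.semiring c ℓ) (Y : LinearMap M M)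
    (Y-p : ∀ x → LeftSemimodule._≈ᴹ_ M ((LinearMap.fun Y ↑ suc q) x) (LeftSemimodule._*ₗ_ M g x)) where
    private
      module V = Action em k V-semimodule S
      module M = Action em k M Y
      y = LinearMap.fun Y
    open SetoidReasoning M.≈ᴹ-setoid

    comb-shift : ∀ v x → M.comb (shift v) x M.≈ᴹ y (M.comb v x)
    comb-shift v x = begin
      M.comb (shift v) x
        ≈⟨ M.⨁-suc _ ⟩
      (g k.* v (fromℕ q)) M.*ₗ x M.+ᴹ M.⨁ (λ i → v (inject₁ i) M.*ₗ (y ↑ suc (toℕ i)) x)
        ≈⟨ M.+ᴹ-comm _ _ ⟩
      M.⨁ (λ i → v (inject₁ i) M.*ₗ (y ↑ suc (toℕ i)) x) M.+ᴹ (g k.* v (fromℕ q)) M.*ₗ x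
        ≈⟨ M.+ᴹ-cong
             (M.⨁-cong λ i → M.*ₗ-congˡ (M.≈ᴹ-reflexive (≡.cong (λ n → (y ↑ suc n) x) (≡.sym (toℕ-inject₁ i)))))
             (M.≈ᴹ-trans (M.*ₗ-congʳ (k.*-comm _ _)) (M.≈ᴹ-trans (M.*ₗ-assoc _ _ _) (M.*ₗ-congˡ
               (M.≈ᴹ-trans (M.≈ᴹ-sym (Y-p x)) (M.≈ᴹ-reflexive (≡.cong (λ n → (y ↑ suc n) x) (≡.sym (toℕ-fromℕ q)))))))) ⟩
      M.⨁ (λ i → v (inject₁ i) M.*ₗ (y ↑ suc (toℕ (inject₁ i))) x) M.+ᴹ
        v (fromℕ q) M.*ₗ (y ↑ suc (toℕ (fromℕ q))) x
        ≈⟨ M.⨁-last _ ⟨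
      M.⨁ (λ i → v i M.*ₗ (y ↑ suc (toℕ i)) x)
        ≈⟨ M.y-comb v x ⟨
      y (M.comb v x) ∎

    comb-shift-↑ : ∀ n v x → M.comb ((shift ↑ n) v) x M.≈ᴹ (y ↑ n) (M.comb v x)
    comb-shift-↑ zero  v x = M.≈ᴹ-refl
    comb-shift-↑ (suc n) v x = M.≈ᴹ-trans (comb-shift _ x) (LinearMap.cong Y (comb-shift-↑ n v x))

    comb-at : M.Carrierᴹ → LinearMap V-semimodule M
    comb-at x = record
      { fun  = λ v → M.comb v x
      ; cong  = λ e → M.comb-cong e M.≈ᴹ-refl
      ; +-homo  = λ v w → M.comb-+ v w x
      ; *ₗ-homo = λ a v → M.comb-scale a v x
      }

    -- The inner product is a combination of shifts of `w`, and each shift turns into an application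
    -- of `Y` because Yᵖ = g. For the shift itself this is associativity of the product; for general
    -- `Y` it is the action law `act-*`.
    comb-assoc : ∀ (v w : V) x → M.comb (V.comb v w) x M.≈ᴹ M.comb v (M.comb w x)
    comb-assoc v w x = M.≈ᴹ-trans (LinearMap.⨁-homo (comb-at x) _)
      (M.⨁-cong λ i → M.≈ᴹ-trans (M.comb-scale (v i) ((shift ↑ toℕ i) w) x) (M.*ₗ-congˡ (comb-shift-↑ (toℕ i) w x)))

  commutativeRing : CommutativeRing c ℓ
  commutativeRing = record
    { Carrier = V
    ; _≈_ = _≈ᴹ_
    ; _+_ = _+ᴹ_
    ; _*_ = comb
    ; -_  = λ v i → k.- v i
    ; 0#  = 0ᴹ
    ; 1#  = e₀
    ; isCommutativeRing = record
      { isRing = record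
        { +-isAbelianGroup = Pointwise.isAbelianGroup (Fin (suc q)) k.+-isAbelianGroup
        ; *-cong  = comb-cong
        ; *-assoc  = On.comb-assoc V-semimodule S shift-p
        ; *-identity = (λ v → comb-δ zero v) , comb-e₀
        ; distrib  = (λ u v w → LinearMap.+-homo (comb-linear u) v w) , (λ u v w → comb-+ v w u)
        }
      ; *-comm = λ v w → ≈ᴹ-trans {comb v w} {comb v (comb w e₀)} {comb w v}
          (LinearMap.cong (comb-linear v) (λ i → k.sym (comb-e₀ w i)))
          (≈ᴹ-trans {_} {comb w (comb v e₀)} {comb w v} (comb-comm v w e₀) (LinearMap.cong (comb-linear w) (comb-e₀ v)))
      }
    }

-- p-th powers, and linear independence under an operator.

module Powers {c ℓ} (em : ExcludedMiddle (c ⊔ ℓ)) (p : ℕ) (pr : Prime p) (k : Field c ℓ) where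
  open FieldKit em k public

  IsPower : Carrier → Set (c ⊔ ℓ)
  IsPower = IsNonzeroPower k p

  0^n : ∀ {n} → 0 ℕ.< n → 0# ^ n ≈ 0#
  0^n {suc n} _ = zeroˡ _

  0<p : 0 ℕ.< p
  0<p = ℕ.>-nonZero⁻¹ p {{prime⇒nonZero pr}}

  base-nonzero : ∀ {x} → x ^ p ≉ 0# → x ≉ 0#
  base-nonzero xᵖ≉0 x≈0 = xᵖ≉0 (trans (^-congˡ p x≈0) (0^n 0<p))

  ^-^-comm : ∀ x m n → (x ^ m) ^ n ≈ (x ^ n) ^ m
  ^-^-comm x m n = trans (^-assocʳ x m n) (trans (^-congʳ x (ℕ.*-comm m n)) (sym (^-assocʳ x n m)))

  quotient-power : ∀ {g x y} → x ≉ 0# → y ≉ 0# → g * x ^ p ≈ y ^ p → IsPower g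
  quotient-power {g} {x} {y} x≉0 y≉0 e = y * x ⁻¹ , *-nonzero y≉0 (⁻¹-nonzero x≉0) ,
    *-cancel (^-nonzero p x≉0) (begin
      x ^ p * g  ≈⟨ *-comm _ _ ⟩
      g * x ^ p  ≈⟨ e ⟩
      y ^ p  ≈⟨ *-identityʳ _ ⟨
      y ^ p * 1#  ≈⟨ *-congˡ (⁻¹-^ p x≉0) ⟨
      y ^ p * (x ⁻¹ ^ p * x ^ p)  ≈⟨ *-assoc _ _ _ ⟨
      y ^ p * x ⁻¹ ^ p * x ^ p  ≈⟨ *-congʳ (^-distrib-* _ _ p) ⟨
      (y * x ⁻¹) ^ p * x ^ p  ≈⟨ *-comm _ _ ⟩
      x ^ p * (y * x ⁻¹) ^ p  ∎)

  -- Bézout writes 1 as a difference of multiples of d and p, in one order or the other; in both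
  -- cases g times one p-th power equals another.
  root-of-coprime-power : ∀ {g y} d → 0 ℕ.< d → d ℕ.< p → g ≉ 0# → g ^ d ≈ y ^ p → IsPower g
  root-of-coprime-power {g} {y} d 0<d d<p g≉0 e
    with coprime-Bézout (prime⇒coprime pr {{ℕ.>-nonZero 0<d}} d<p)
  ... | Bézout.+- s t eq = quotient-power (^-nonzero t y≉0) (^-nonzero s g≉0) (begin
    g * (y ^ t) ^ p  ≈⟨ *-congˡ (^-^-comm y t p) ⟩
    g * (y ^ p) ^ t  ≈⟨ *-congˡ (^-congˡ t e) ⟨
    g * (g ^ d) ^ t  ≈⟨ *-congˡ (trans (^-assocʳ g d t) (^-congʳ g (ℕ.*-comm d t))) ⟩
    g * g ^ (t ℕ.* d)   ≈⟨ ^-congʳ g eq ⟩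
    g ^ (s ℕ.* p)  ≈⟨ ^-assocʳ g s p ⟨
    (g ^ s) ^ p  ∎)
    where
    y≉0 : y ≉ 0#
    y≉0 = base-nonzero (nonzero-resp e (^-nonzero d g≉0))
  ... | Bézout.-+ s t eq = quotient-power (^-nonzero s g≉0) (^-nonzero t y≉0) (begin
    g * (g ^ s) ^ p  ≈⟨ *-congˡ (^-assocʳ g s p) ⟩
    g * g ^ (s ℕ.* p)   ≈⟨ ^-congʳ g eq ⟩
    g ^ (t ℕ.* d)  ≈⟨ trans (^-assocʳ g d t) (^-congʳ g (ℕ.*-comm d t)) ⟨
    (g ^ d) ^ t  ≈⟨ ^-congˡ t e ⟩
    (y ^ p) ^ t  ≈⟨ ^-^-comm y p t ⟩
    (y ^ t) ^ p  ∎)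
    where
    y≉0 : y ≉ 0#
    y≉0 = base-nonzero (nonzero-resp e (^-nonzero d g≉0))

-- Takes the place of the irreducibility of Xᵖ - g. It is stated for an operator on a space rather
-- than for polynomials so that it also covers the map y ↦ z τ(y) of `Symmetry`.
module Independence {c ℓ} (em : ExcludedMiddle (c ⊔ ℓ)) (p : ℕ) (pr : Prime p)
  (k : Field c ℓ) (g : Field.Carrier k)
  (g≉0 : ¬ Field._≈_ k g (Field.0# k)) (g∉kᵖ : ¬ IsNonzeroPower k p g)
  (M : LeftSemimodule (Field.semiring k) c ℓ) (Y : LinearMap M M)
  (Y-p : ∀ x → LeftSemimodule._≈ᴹ_ M ((LinearMap.fun Y ↑ p) x) (LeftSemimodule._*ₗ_ M g x))
  (x : LeftSemimodule.Carrierᴹ M) (x≉0 : ¬ LeftSemimodule._≈ᴹ_ M x (LeftSemimodule.0ᴹ M)) where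
  private module k = Powers em p pr k
  open Action em k M Y
  open Kronecker em k
  open SetoidReasoning ≈ᴹ-setoid
  private y = LinearMap.fun Y

  Dependent : ℕ → Set (c ⊔ ℓ)
  Dependent d = ∃ λ (v : Fin d → k.Carrier) → (y ↑ d) x ≈ᴹ comb v x

  neg-inverse : ∀ w → (k.- k.1#) *ₗ w +ᴹ w ≈ᴹ 0ᴹ
  neg-inverse w = ≈ᴹ-trans (+ᴹ-congˡ (≈ᴹ-sym (*ₗ-identityˡ w))) (≈ᴹ-trans (≈ᴹ-sym (*ₗ-distribʳ w _ _))
    (≈ᴹ-trans (*ₗ-congʳ (k.-‿inverseˡ k.1#)) (*ₗ-zeroˡ w)))

  +-cancel-neg : ∀ a z w → w +ᴹ a *ₗ z ≈ᴹ 0ᴹ → a *ₗ z ≈ᴹ (k.- k.1#) *ₗ w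
  +-cancel-neg a z w e = begin
    a *ₗ z  ≈⟨ +ᴹ-identityˡ _ ⟨
    0ᴹ +ᴹ a *ₗ z  ≈⟨ +ᴹ-congʳ (neg-inverse w) ⟨
    ((k.- k.1#) *ₗ w +ᴹ w) +ᴹ a *ₗ z  ≈⟨ +ᴹ-assoc _ _ _ ⟩
    (k.- k.1#) *ₗ w +ᴹ (w +ᴹ a *ₗ z)  ≈⟨ +ᴹ-congˡ e ⟩
    (k.- k.1#) *ₗ w +ᴹ 0ᴹ  ≈⟨ +ᴹ-identityʳ _ ⟩
    (k.- k.1#) *ₗ w  ∎

  independent-below : ∀ n → (∀ {m} → m ℕ.< n → ¬ Dependent m) →
    ∀ (v : Fin n → k.Carrier) → comb v x ≈ᴹ 0ᴹ → ∀ i → v i k.≈ k.0#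
  independent-below (suc n) indep v e = init-last n
    (independent-below n (λ m<n → indep (ℕ.m<n⇒m<1+n m<n)) (v ∘ inject₁) init≈0) last≈0
    where
    vₙ = v (fromℕ n)
    split : comb (v ∘ inject₁) x +ᴹ vₙ *ₗ (y ↑ n) x ≈ᴹ 0ᴹ
    split = ≈ᴹ-trans (≈ᴹ-sym (≈ᴹ-trans (⨁-last _) (+ᴹ-cong
      (⨁-cong λ i → *ₗ-congˡ (≈ᴹ-reflexive (≡.cong (λ m → (y ↑ m) x) (toℕ-inject₁ i))))
      (*ₗ-congˡ (≈ᴹ-reflexive (≡.cong (λ m → (y ↑ m) x) (toℕ-fromℕ n))))))) e
    last≈0 : vₙ k.≈ k.0#
    -- A nonzero leading coefficient would express Yⁿ x through lower powers.
    last≈0 = k.stable λ vₙ≉0 → indep ℕ.≤-refl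
      ((λ i → vₙ k.⁻¹ k.* ((k.- k.1#) k.* v (inject₁ i))) , (begin
        (y ↑ n) x  ≈⟨ *ₗ-identityˡ _ ⟨
        k.1# *ₗ (y ↑ n) x  ≈⟨ *ₗ-congʳ (k.⁻¹-inverseˡ vₙ≉0) ⟨
        (vₙ k.⁻¹ k.* vₙ) *ₗ (y ↑ n) x  ≈⟨ *ₗ-assoc _ _ _ ⟩
        vₙ k.⁻¹ *ₗ vₙ *ₗ (y ↑ n) x  ≈⟨ *ₗ-congˡ (+-cancel-neg _ _ _ split) ⟩
        vₙ k.⁻¹ *ₗ (k.- k.1#) *ₗ comb (v ∘ inject₁) x ≈⟨ *ₗ-congˡ (comb-scale _ _ _) ⟨
        vₙ k.⁻¹ *ₗ comb (λ i → (k.- k.1#) k.* v (inject₁ i)) x ≈⟨ comb-scale _ _ _ ⟨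
        comb (λ i → vₙ k.⁻¹ k.* ((k.- k.1#) k.* v (inject₁ i))) x ∎))
    init≈0 : comb (v ∘ inject₁) x ≈ᴹ 0ᴹ
    init≈0 = ≈ᴹ-trans (≈ᴹ-sym (+ᴹ-identityʳ _)) (≈ᴹ-trans
      (+ᴹ-congˡ (≈ᴹ-sym (≈ᴹ-trans (*ₗ-congʳ last≈0) (*ₗ-zeroˡ _)))) split)

  independent : ∀ n → (∀ {m} → m ℕ.< n → ¬ Dependent m) →
    ∀ (v w : Fin n → k.Carrier) → comb v x ≈ᴹ comb w x → ∀ i → v i k.≈ w i
  independent n indep v w e i = k.trans (k.+-inverseˡ-unique (v i) ((k.- k.1#) k.* w i)
    (independent-below n indep (λ i → v i k.+ (k.- k.1#) k.* w i) (begin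
      comb (λ i → v i k.+ (k.- k.1#) k.* w i) x  ≈⟨ comb-+ v _ x ⟩
      comb v x +ᴹ comb (λ i → (k.- k.1#) k.* w i) x  ≈⟨ +ᴹ-cong e (comb-scale _ w x) ⟩
      comb w x +ᴹ (k.- k.1#) *ₗ comb w x  ≈⟨ +ᴹ-comm _ _ ⟩
      (k.- k.1#) *ₗ comb w x +ᴹ comb w x  ≈⟨ neg-inverse (comb w x) ⟩
      0ᴹ  ∎) i))
    (k.trans (k.-‿cong (k.-1*x≈-x (w i))) (k.-‿involutive (w i)))

  -- If d is minimal with Yᵈ x dependent on its predecessors and d < p, the
  -- companion matrix C of Y satisfies Cᵖ = g, so (det C)ᵖ = gᵈ.
  module Minimal (d : ℕ) (dep : Dependent (suc d))
    (indep : ∀ {m} → m ℕ.< suc d → ¬ Dependent m) where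

    Matrix : Set c
    Matrix = Fin (suc d) → Fin (suc d) → k.Carrier

    column : ∀ j → ∃ λ (v : Fin (suc d) → k.Carrier) → y ((y ↑ toℕ j) x) ≈ᴹ comb v x
    column = init-last d
      (λ j → δ (suc j) , ≈ᴹ-trans (≈ᴹ-reflexive (≡.cong (λ m → (y ↑ suc m) x) (toℕ-inject₁ j))) (≈ᴹ-sym (comb-δ (suc j) x)))
      (proj₁ dep , ≈ᴹ-trans (≈ᴹ-reflexive (≡.cong (λ m → (y ↑ suc m) x) (toℕ-fromℕ d))) (proj₂ dep))

    C : Matrix
    C i j = proj₁ (column j) i

    C^ : ℕ → Matrix
    C^ zero  i j = δ j i
    C^ (suc n) i j = k.∑ λ l → C i l k.* C^ n l j

    y-C^ : ∀ n j → (y ↑ n) ((y ↑ toℕ j) x) ≈ᴹ comb (λ i → C^ n i j) x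
    y-C^ zero  j = ≈ᴹ-sym (comb-δ j x)
    y-C^ (suc n) j = begin
      y ((y ↑ n) ((y ↑ toℕ j) x))
        ≈⟨ LinearMap.cong Y (y-C^ n j) ⟩
      y (comb (λ i → C^ n i j) x)
        ≈⟨ y-comb _ x ⟩
      ⨁ (λ l → C^ n l j *ₗ y ((y ↑ toℕ l) x))
        ≈⟨ ⨁-cong (λ l → *ₗ-congˡ (proj₂ (column l))) ⟩
      ⨁ (λ l → C^ n l j *ₗ ⨁ λ i → C i l *ₗ (y ↑ toℕ i) x)
        ≈⟨ ⨁-cong (λ l → *ₗ-⨁ _ _) ⟩
      ⨁ (λ l → ⨁ λ i → C^ n l j *ₗ C i l *ₗ (y ↑ toℕ i) x)
        ≈⟨ ⨁-comm _ ⟩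
      ⨁ (λ i → ⨁ λ l → C^ n l j *ₗ C i l *ₗ (y ↑ toℕ i) x)
        ≈⟨ ⨁-cong (λ i → ⨁-cong λ l → ≈ᴹ-trans (≈ᴹ-sym (*ₗ-assoc _ _ _)) (*ₗ-congʳ (k.*-comm _ _))) ⟩
      ⨁ (λ i → ⨁ λ l → (C i l k.* C^ n l j) *ₗ (y ↑ toℕ i) x)
        ≈⟨ ⨁-cong (λ i → ≈ᴹ-sym (∑-*ₗ _ _)) ⟩
      comb (λ i → C^ (suc n) i j) x ∎
      where
      ∑-*ₗ : ∀ {n} (f : Fin n → k.Carrier) z → k.∑ f *ₗ z ≈ᴹ ⨁ λ l → f l *ₗ z
      ∑-*ₗ f z = ⨁-hom (_*ₗ z) *ₗ-congʳ (*ₗ-zeroˡ z) (λ a b → *ₗ-distribʳ z a b) f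
        where open BigOpHom k.+-commutativeMonoid +ᴹ-commutativeMonoid

    C^p : ∀ i j → C^ p i j k.≈ g k.* δ i j
    C^p i j = k.trans (independent (suc d) indep (λ i → C^ p i j) (λ i → g k.* δ j i) (begin
      comb (λ i → C^ p i j) x  ≈⟨ y-C^ p j ⟨
      (y ↑ p) ((y ↑ toℕ j) x)  ≈⟨ Y-p _ ⟩
      g *ₗ (y ↑ toℕ j) x  ≈⟨ *ₗ-congˡ (comb-δ j x) ⟨
      g *ₗ comb (δ j) x  ≈⟨ comb-scale g (δ j) x ⟨
      comb (λ i → g k.* δ j i) x  ∎) i) (k.*-congˡ (δ-sym j i))

    det-C^ : ∀ n → det k (C^ n) k.≈ det k C k.^ n
    det-C^ zero  = k.trans (Determinant.det-cong k {suc d} λ i j → k.trans (δ-sym j i) (k.sym (k.*-identityˡ _)))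
      (k.trans (det-diag {suc d} (λ _ → k.1#)) (k.∏-ε {suc d}))
    det-C^ (suc n) = k.trans (det-*ᴹ C (C^ n)) (k.*-congˡ (det-C^ n))

    g^d : g k.^ suc d k.≈ det k C k.^ p
    g^d = k.trans (k.sym (k.∏-const (suc d) g)) (k.trans (k.sym (det-diag {suc d} (λ _ → g)))
      (k.trans (Determinant.det-cong k {suc d} λ i j → k.sym (C^p i j)) (det-C^ p)))

  -- Strong induction supplies the minimality that `Minimal` asks for. As 0 < d < p is prime to p, a
  -- p-th power gᵈ would make g one; for d = 0, dependence says x = 0.
  not-dependent : ∀ d → d ℕ.< p → ¬ Dependent d
  not-dependent = <-rec (λ d → d ℕ.< p → ¬ Dependent d) λ
    { zero  below d<p dep → x≉0 (≈ᴹ-trans (proj₂ dep) (⨁-empty _))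
    ; (suc d) below d<p dep → g∉kᵖ (k.root-of-coprime-power (suc d) (ℕ.s≤s ℕ.z≤n) d<p g≉0
        (Minimal.g^d d dep (λ m<d → below m<d (ℕ.<-trans m<d d<p)))) }

  comb-injective : ∀ (v w : Fin p → k.Carrier) → comb v x ≈ᴹ comb w x → ∀ i → v i k.≈ w i
  comb-injective = independent p (λ m<p → not-dependent _ m<p)

-- Dimension count in kⁿ.

module Dimension {c ℓ} (em : ExcludedMiddle (c ⊔ ℓ)) (k : Field c ℓ) where
  open FieldKit em k

  -- Gaussian elimination on the first coordinate. A pivot row is subtracted from the others after
  -- scaling them by the pivot, which avoids division; its own coefficient `aᵣ` is then chosen to
  -- balance the relation.
  dependence : ∀ n (v : Fin (suc n) → Fin n → Carrier) →
    ∃ λ (a : Fin (suc n) → Carrier) → (∃ λ i → a i ≉ 0#) × ∀ j → ∑ (λ i → a i * v i j) ≈ 0#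
  dependence zero  v = (λ _ → 1#) , (zero , 1≉0) , λ ()
  dependence (suc n) v with em {∃ λ r → Lift c (v r zero ≉ 0#)}
  ... | no none = a , (suc (proj₁ (proj₁ (proj₂ ih))) , proj₂ (proj₁ (proj₂ ih))) , relation
    where
    ih = dependence n λ i j → v (suc i) (suc j)
    -- The first coordinate vanishes on every vector, so it can be ignored, and one vector is left
    -- out with coefficient 0.
    a : Fin (2 ℕ.+ n) → Carrier
    a zero  = 0#
    a (suc i) = proj₁ ih i
    relation : ∀ j → ∑ (λ i → a i * v i j) ≈ 0#
    relation zero  = ∑-all-0 λ i → trans (*-congˡ (stable λ e → none (i , lift e))) (zeroʳ _)
    relation (suc j) = trans (∑-suc _) (trans (+-cong (zeroˡ _) (proj₂ (proj₂ ih) j)) (+-identityˡ _))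
  ... | yes (r , lift pivot≉0) = a , (punchIn r i₀ , aᵢ₀≉0) , relation
    where
    u : Fin (suc n) → Fin (suc n) → Carrier
    u i = v (punchIn r i)
    ih = dependence n λ i j → v r zero * u i (suc j) + - u i zero * v r (suc j)
    b = proj₁ ih
    i₀ = proj₁ (proj₁ (proj₂ ih))
    aᵣ = - ∑ λ i → b i * u i zero
    a = insertAt (λ i → v r zero * b i) r aᵣ
    aᵢ₀≉0 : a (punchIn r i₀) ≉ 0#
    aᵢ₀≉0 = nonzero-resp (reflexive (≡.sym (insertAt-punchIn _ r aᵣ i₀)))
      (*-nonzero pivot≉0 (proj₂ (proj₁ (proj₂ ih))))
    split : ∀ j → ∑ (λ i → a i * v i j) ≈ aᵣ * v r j + ∑ λ i → (v r zero * b i) * u i j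
    split j = trans (∑-remove _ r) (+-cong
      (*-congʳ (reflexive (insertAt-lookup _ r aᵣ)))
      (∑-cong λ i → *-congʳ (reflexive (insertAt-punchIn _ r aᵣ i))))
    aᵣ-term : ∀ j → aᵣ * v r j ≈ ∑ λ i → b i * (- u i zero * v r j)
    aᵣ-term j = trans (sym (-‿distribˡ-* _ _)) (trans (-‿cong (∑-*ʳ _ _)) (trans (sym (-1*x≈-x _)) (trans (∑-*ˡ _ _)
      (∑-cong λ i → trans (-1*x≈-x _) (trans (-‿cong (*-assoc _ _ _)) (trans (-‿distribʳ-* _ _) (*-congˡ (-‿distribˡ-* _ _))))))))
    rotate : ∀ x y z → (x * y) * z ≈ y * (x * z)
    rotate = solve 3 (λ x y z → (x ⊕ y) ⊕ z ⊜ y ⊕ (x ⊕ z)) refl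
      where open *-Solver
    combined : ∀ j → ∑ (λ i → a i * v i j) ≈ ∑ λ i → b i * (v r zero * u i j + - u i zero * v r j)
    combined j = begin
      ∑ (λ i → a i * v i j)
        ≈⟨ split j ⟩
      aᵣ * v r j + ∑ (λ i → (v r zero * b i) * u i j)
        ≈⟨ +-comm _ _ ⟩
      ∑ (λ i → (v r zero * b i) * u i j) + aᵣ * v r j
        ≈⟨ +-cong (∑-cong λ i → rotate _ _ _) (aᵣ-term j) ⟩
      ∑ (λ i → b i * (v r zero * u i j)) + ∑ (λ i → b i * (- u i zero * v r j))
        ≈⟨ ∑-+ _ _ ⟨
      ∑ (λ i → b i * (v r zero * u i j) + b i * (- u i zero * v r j))
        ≈⟨ ∑-cong (λ i → sym (distribˡ _ _ _)) ⟩
      ∑ (λ i → b i * (v r zero * u i j + - u i zero * v r j)) ∎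
    relation : ∀ j → ∑ (λ i → a i * v i j) ≈ 0#
    relation zero  = trans (combined zero) (∑-all-0 λ i → trans (*-congˡ (trans (+-cong (*-comm _ _) (sym (-‿distribˡ-* _ _))) (-‿inverseʳ _))) (zeroʳ _))
    relation (suc j) = trans (combined (suc j)) (proj₂ (proj₂ ih) j)

  -- The target `u` and the n rows of `f` are n + 1 vectors in kⁿ, hence dependent; injectivity
  -- forces the coefficient of `u` to be nonzero, and the relation is solved for it.
  surjective : ∀ n (f : Fin n → Fin n → Carrier) →
    (∀ (a : Fin n → Carrier) → (∀ j → ∑ (λ i → a i * f i j) ≈ 0#) → ∀ i → a i ≈ 0#) →
    ∀ (u : Fin n → Carrier) → ∃ λ (a : Fin n → Carrier) → ∀ j → ∑ (λ i → a i * f i j) ≈ u j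
  surjective n f inj u = (λ i → - b zero ⁻¹ * b (suc i)) , λ j → begin
    ∑ (λ i → - b zero ⁻¹ * b (suc i) * f i j)  ≈⟨ ∑-cong (λ i → *-assoc _ _ _) ⟩
    ∑ (λ i → - b zero ⁻¹ * (b (suc i) * f i j))  ≈⟨ ∑-*ˡ _ _ ⟨
    - b zero ⁻¹ * ∑ (λ i → b (suc i) * f i j)  ≈⟨ *-congˡ (+-inverseʳ-unique _ _ (rel j)) ⟩
    - b zero ⁻¹ * - (b zero * u j)  ≈⟨ -‿distribˡ-* _ _ ⟨
    - (b zero ⁻¹ * - (b zero * u j))  ≈⟨ -‿cong (-‿distribʳ-* _ _) ⟨
    - - (b zero ⁻¹ * (b zero * u j))  ≈⟨ -‿involutive _ ⟩
    b zero ⁻¹ * (b zero * u j)  ≈⟨ *-assoc _ _ _ ⟨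
    b zero ⁻¹ * b zero * u j  ≈⟨ *-congʳ (⁻¹-inverseˡ b₀≉0) ⟩
    1# * u j  ≈⟨ *-identityˡ _ ⟩
    u j  ∎
    where
    g : Fin (suc n) → Fin n → Carrier
    g zero  = u
    g (suc i) = f i
    dep = dependence n g
    b = proj₁ dep
    rel : ∀ j → b zero * u j + ∑ (λ i → b (suc i) * f i j) ≈ 0#
    rel j = trans (sym (∑-suc _)) (proj₂ (proj₂ dep) j)
    b₀≉0 : b zero ≉ 0#
    b₀≉0 b₀≈0 with proj₁ (proj₂ dep)
    ... | zero  , b≉0 = b≉0 b₀≈0
    ... | suc i , b≉0 = b≉0 (inj (b ∘ suc) (λ j → trans (sym (+-identityˡ _))
      (trans (+-congʳ (sym (trans (*-congʳ b₀≈0) (zeroˡ _)))) (rel j))) i)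

-- Kummer extensions and homomorphisms out of them.

module Scalars {c ℓ} (em : ExcludedMiddle (c ⊔ ℓ)) {k L : Field c ℓ} (h : FieldHom k L) where
  open HomKit em h
  private module k = FieldKit em k
  open FieldKit em L

  semimodule : LeftSemimodule k.semiring c ℓ
  semimodule = record
    { Carrierᴹ = Carrier
    ; _≈ᴹ_  = _≈_
    ; _+ᴹ_  = _+_
    ; _*ₗ_  = λ a x → ⟦ a ⟧ * x
    ; 0ᴹ  = 0#
    ; isLeftSemimodule = record
      { +ᴹ-isCommutativeMonoid = +-isCommutativeMonoid
      ; isPreleftSemimodule = record
        { *ₗ-cong  = λ a≈b x≈y → *-cong (⟦⟧-cong a≈b) x≈y
        ; *ₗ-zeroˡ  = λ x → trans (*-congʳ 0-homo) (zeroˡ x)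
        ; *ₗ-distribʳ  = λ x a b → trans (*-congʳ (+-homo a b)) (distribʳ x _ _)
        ; *ₗ-identityˡ = λ x → trans (*-congʳ 1-homo) (*-identityˡ x)
        ; *ₗ-assoc  = λ a b x → trans (*-congʳ (*-homo a b)) (*-assoc _ _ x)
        ; *ₗ-zeroʳ  = λ a → zeroʳ _
        ; *ₗ-distribˡ  = λ a x y → distribˡ _ x y
        }
      }
    }

  multiply : Carrier → LinearMap semimodule semimodule
  multiply γ = record
    { fun  = γ *_
    ; cong  = *-congˡ
    ; +-homo  = distribˡ γ
    ; *ₗ-homo = λ a x → x∙yz≈y∙xz γ _ x
    }

  multiply-↑ : ∀ γ n x → ((γ *_) ↑ n) x ≈ γ ^ n * x
  multiply-↑ γ zero  x = sym (*-identityˡ x)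
  multiply-↑ γ (suc n) x = trans (*-congˡ (multiply-↑ γ n x)) (sym (*-assoc _ _ _))

  evaluate : ∀ {n} → Carrier → (Fin n → k.Carrier) → Carrier
  evaluate γ v = ∑ λ i → ⟦ v i ⟧ * γ ^ toℕ i

  evaluate-cong : ∀ {n} γ {v w : Fin n → k.Carrier} → (∀ i → v i k.≈ w i) → evaluate γ v ≈ evaluate γ w
  evaluate-cong γ e = ∑-cong λ i → *-congʳ (⟦⟧-cong (e i))

  evaluate-+ : ∀ {n} γ (v w : Fin n → k.Carrier) →
    evaluate γ (λ i → v i k.+ w i) ≈ evaluate γ v + evaluate γ w
  evaluate-+ γ v w = trans (∑-cong λ i → trans (*-congʳ (+-homo _ _)) (distribʳ _ _ _)) (∑-+ _ _)

  comb-evaluate : ∀ {n} γ (v : Fin n → k.Carrier) x →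
    Action.comb em k semimodule (multiply γ) v x ≈ evaluate γ v * x
  comb-evaluate γ v x = trans (∑-cong λ i → trans (*-congˡ (multiply-↑ γ (toℕ i) x)) (sym (*-assoc _ _ _)))
    (sym (∑-*ʳ x _))

-- k(ᵖ√g), with the coordinates of its elements in the basis 1, X, …, Xᵖ⁻¹.
-- By act-1 and act-* it acts on every k-space with an operator Y for which
-- Yᵖ = g.
record Kummer {c ℓ} (em : ExcludedMiddle (c ⊔ ℓ)) (q : ℕ) (k : Field c ℓ) (g : Field.Carrier k) : Set (Level.suc (c ⊔ ℓ)) where
  private
    module k = Field k
  field
    K : Field c ℓ
    ι : FieldHom k K
  open Field K
  open Scalars em ι using (evaluate)
  field
    X  : Carrier
    X^p≈g  : X ^ suc q ≈ FieldHom.⟦_⟧ ι g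
    coords : Carrier → Fin (suc q) → k.Carrier
    evaluate-coords : ∀ x → evaluate X (coords x) ≈ x
    coords-evaluate : ∀ v i → coords (evaluate X v) i k.≈ v i
    coords-cong  : ∀ {x y} → x ≈ y → ∀ i → coords x i k.≈ coords y i
    act-1 : ∀ M Y x → let open Action em k M Y in comb (coords 1#) x ≈ᴹ x
    act-* : ∀ M Y → let open Action em k M Y in
      (∀ x → (LinearMap.fun Y ↑ suc q) x ≈ᴹ g *ₗ x) →
      ∀ a b x → comb (coords (a * b)) x ≈ᴹ comb (coords a) (comb (coords b) x)

module Construction {c ℓ} (em : ExcludedMiddle (c ⊔ ℓ)) (q : ℕ) (pr : Prime (suc q))
  (k : Field c ℓ) (g : Field.Carrier k)
  (g≉0 : ¬ Field._≈_ k g (Field.0# k)) (g∉kᵖ : ¬ IsNonzeroPower k (suc q) g) where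
  private module k = FieldKit em k
  open Truncated em k g q
  open Kronecker em k
  open CommutativeRing commutativeRing using () renaming (trans to ≈-trans; sym to ≈-sym)

  field′ : Field c ℓ
  field′ = record
    { commutativeRing = commutativeRing
    ; 1≉0  = λ e → k.1≉0 (e zero)
    ; invertible  = λ x x≉0 → let y , e = surj x x≉0 e₀ in
        y , e , ≈-trans {comb x y} {comb y x} {e₀} (CommutativeRing.*-comm commutativeRing x y) e
    }
    where
    -- The vectors x, Xx, ..., Xᵖ⁻¹x are independent by `Independence`, hence they span; applied to
    -- 1 this yields the inverse of x.
    surj : ∀ x → ¬ (∀ i → x i k.≈ k.0#) → ∀ u → ∃ λ v → ∀ j → comb v x j k.≈ u j
    surj x x≉0 u = let v , e = Dimension.surjective em k (suc q) (λ i → (shift ↑ toℕ i) x)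
                                  (λ a e → comb-injective a (λ _ → k.0#) λ i → k.trans (⨁-at _ i) (k.trans (e i)
                                    (k.sym (k.trans (⨁-at _ i) (k.∑-all-0 λ j → k.zeroˡ _))))) u
                   in v , λ j → k.trans (⨁-at _ j) (e j)
      where open Independence em (suc q) pr k g g≉0 g∉kᵖ V-semimodule S shift-p x x≉0

  kummer : Kummer em q k g
  kummer = record
    { K  = field′
    ; ι  = ι
    ; X  = X
    ; X^p≈g  = ≈-trans {X K.^ suc q} {(shift ↑ suc q) e₀} {g *ₗ e₀} (X^n (suc q)) (shift-p e₀)
    ; coords = id
    ; evaluate-coords = evaluate-X
    ; coords-evaluate = evaluate-X
    ; coords-cong  = id
    ; act-1 = λ M Y x → Action.comb-δ em k M Y zero x
    ; act-* = λ M Y Y-p → On.comb-assoc M Y Y-p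
    }
    where
    module K = FieldKit em field′
    ι-* : ∀ a v → comb (a *ₗ e₀) v ≈ᴹ a *ₗ v
    ι-* a v = ≈-trans {comb (a *ₗ e₀) v} {a *ₗ comb e₀ v} {a *ₗ v} (comb-scale a e₀ v) (*ₗ-congˡ {a} (comb-δ zero v))
    ι : FieldHom k field′
    ι = record
      { ⟦_⟧  = λ a → a *ₗ e₀
      ; ⟦⟧-cong = λ e → *ₗ-congʳ {e₀} e
      ; +-homo  = λ a b → *ₗ-distribʳ e₀ a b
      ; *-homo  = λ a b → ≈-sym {comb (a *ₗ e₀) (b *ₗ e₀)} {(a k.* b) *ₗ e₀}
          (≈-trans {comb (a *ₗ e₀) (b *ₗ e₀)} {a *ₗ (b *ₗ e₀)} {(a k.* b) *ₗ e₀} (ι-* a (b *ₗ e₀))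
            (≈-sym {(a k.* b) *ₗ e₀} {a *ₗ (b *ₗ e₀)} (*ₗ-assoc a b e₀)))
      ; 1-homo  = *ₗ-identityˡ e₀
      }
    X : V
    X = shift e₀
    X-* : ∀ v → comb X v ≈ᴹ shift v
    X-* v = ≈-trans {comb X v} {shift (comb e₀ v)} {shift v} (On.comb-shift V-semimodule S shift-p e₀ v)
      (LinearMap.cong S (comb-δ zero v))
    X^n : ∀ n → (X K.^ n) K.≈ (shift ↑ n) e₀
    X^n zero  = λ i → k.refl
    X^n (suc n) = ≈-trans {comb X (X K.^ n)} {shift (X K.^ n)} {shift ((shift ↑ n) e₀)} (X-* (X K.^ n)) (LinearMap.cong S (X^n n))
    evaluate-X : ∀ v → Scalars.evaluate em ι X v K.≈ v
    evaluate-X v = ≈-trans {Scalars.evaluate em ι X v} {comb v e₀} {v}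
      (≈-sym {comb v e₀} {Scalars.evaluate em ι X v} (≈-trans {comb v e₀} {K.∑ λ i → v i *ₗ (shift ↑ toℕ i) e₀} {Scalars.evaluate em ι X v}
        (⨁-hom id id (λ _ → k.refl) (λ _ _ _ → k.refl) (λ i → v i *ₗ (shift ↑ toℕ i) e₀))
        (K.∑-cong λ i → ≈-sym {comb (v i *ₗ e₀) (X K.^ toℕ i)} {v i *ₗ (shift ↑ toℕ i) e₀}
          (≈-trans {comb (v i *ₗ e₀) (X K.^ toℕ i)} {v i *ₗ (X K.^ toℕ i)} {v i *ₗ (shift ↑ toℕ i) e₀} (ι-* (v i) (X K.^ toℕ i))
            (*ₗ-congˡ {v i} (X^n (toℕ i)))))))
      (comb-e₀ v)
      where open BigOpHom +ᴹ-commutativeMonoid K.+-commutativeMonoid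

-- From here on the constructed field is seen only through the interface `Kummer`.
opaque
  adjoin : ∀ {c ℓ} (em : ExcludedMiddle (c ⊔ ℓ)) (q : ℕ) → Prime (suc q) →
    (k : Field c ℓ) (g : Field.Carrier k) → ¬ Field._≈_ k g (Field.0# k) → ¬ IsNonzeroPower k (suc q) g →
    Kummer em q k g
  adjoin = Construction.kummer

module KummerKit {c ℓ} (em : ExcludedMiddle (c ⊔ ℓ)) (q : ℕ) (pr : Prime (suc q))
  {k : Field c ℓ} {g : Field.Carrier k} (E : Kummer em q k g) where
  open Kummer E public
  private
    module k = FieldKit em k
    module K = FieldKit em K
  module ι = HomKit em ι
  open Kronecker em k

  evaluate-monomial : ∀ {L : Field c ℓ} (h : FieldHom k L) γ a (j : Fin (suc q)) →
    let open Field L in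
    Scalars.evaluate em h γ (λ i → a k.* δ j i) ≈ FieldHom.⟦_⟧ h a * γ ^ toℕ j
  evaluate-monomial {L} h γ a j = trans
    (∑-single _ j λ i i≢j → trans (*-congʳ (trans (⟦⟧-cong (k.trans (k.*-congˡ (δ-off (i≢j ∘ ≡.sym))) (k.zeroʳ a))) 0-homo)) (zeroˡ _))
    (*-congʳ (⟦⟧-cong (k.trans (k.*-congˡ (δ-diag j)) (k.*-identityʳ a))))
    where
    open FieldKit em L
    open HomKit em h

  coords-+ : ∀ x y i → coords (x K.+ y) i k.≈ coords x i k.+ coords y i
  coords-+ x y i = k.trans
    (coords-cong (K.trans (K.+-cong (K.sym (evaluate-coords x)) (K.sym (evaluate-coords y)))
      (K.sym (Scalars.evaluate-+ em ι X (coords x) (coords y)))) i)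
    (coords-evaluate _ i)

  coords-monomial : ∀ a j i → coords (ι.⟦ a ⟧ K.* X K.^ toℕ j) i k.≈ a k.* δ j i
  coords-monomial a j i = k.trans (coords-cong (K.sym (evaluate-monomial ι X a j)) i) (coords-evaluate (λ i → a k.* δ j i) i)

  coords-injective : ∀ {x y} → (∀ i → coords x i k.≈ coords y i) → x K.≈ y
  coords-injective {x} {y} e = K.trans (K.sym (evaluate-coords x))
    (K.trans (Scalars.evaluate-cong em ι X e) (evaluate-coords y))

  one : Fin (suc q)
  one = fromℕ< (ℕ.nonTrivial⇒n>1 (suc q) {{prime⇒nonTrivial pr}})

  toℕ-one : toℕ one ≡ 1
  toℕ-one = toℕ-fromℕ< (ℕ.nonTrivial⇒n>1 (suc q) {{prime⇒nonTrivial pr}})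

  hom-unique : ∀ {L : Field c ℓ} (f h : FieldHom K L) → let open Field L in
    (∀ a → FieldHom.⟦_⟧ f ι.⟦ a ⟧ ≈ FieldHom.⟦_⟧ h ι.⟦ a ⟧) →
    FieldHom.⟦_⟧ f X ≈ FieldHom.⟦_⟧ h X → ∀ x → FieldHom.⟦_⟧ f x ≈ FieldHom.⟦_⟧ h x
  hom-unique {L} f h on-ι on-X x = trans (via f)
    (trans (∑-cong λ i → *-cong (on-ι (coords x i)) (^-congˡ (toℕ i) on-X)) (sym (via h)))
    where
    open FieldKit em L
    via : ∀ (f : FieldHom K L) → let module f = FieldHom f in
      f.⟦ x ⟧ ≈ ∑ λ i → f.⟦ ι.⟦ coords x i ⟧ ⟧ * f.⟦ X ⟧ ^ toℕ i
    via f = trans (f.⟦⟧-cong (K.sym (evaluate-coords x))) (trans (f.∑-homo _)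
      (∑-cong λ i → trans (f.*-homo _ _) (*-congˡ (f.^-homo X (toℕ i)))))
      where module f = HomKit em f

  -- The universal property of k(ᵖ√g): X may be sent to any γ whose p-th power is the image of g.
  -- Multiplicativity is `act-*` for the operator of multiplication by γ.
  module Extend {L : Field c ℓ} (h : FieldHom k L) (γ : Field.Carrier L)
    (γ^p≈g : Field._≈_ L (Field._^_ L γ (suc q)) (FieldHom.⟦_⟧ h g)) where
    open FieldKit em L
    private module h = HomKit em h
    open Scalars em h

    value : K.Carrier → Carrier
    value x = evaluate γ (coords x)

    private
      Y-p : ∀ x → ((γ *_) ↑ suc q) x ≈ h.⟦ g ⟧ * x
      Y-p x = trans (multiply-↑ γ (suc q) x) (*-congʳ γ^p≈g)

      comb-1 : ∀ x → Action.comb em k semimodule (multiply γ) (coords x) 1# ≈ value x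
      comb-1 x = trans (comb-evaluate γ (coords x) 1#) (*-identityʳ _)

      value-* : ∀ x y → value (x K.* y) ≈ value x * value y
      value-* x y = trans (sym (comb-1 (x K.* y))) (trans (act-* semimodule (multiply γ) Y-p x y 1#)
        (trans (comb-evaluate γ (coords x) _) (*-congˡ (comb-1 y))))

    extension : FieldHom K L
    extension = record
      { ⟦_⟧  = value
      ; ⟦⟧-cong = λ e → evaluate-cong γ (coords-cong e)
      ; +-homo  = λ x y → trans (evaluate-cong γ (coords-+ x y)) (evaluate-+ γ (coords x) (coords y))
      ; *-homo  = value-*
      ; 1-homo  = trans (sym (comb-1 K.1#)) (act-1 semimodule (multiply γ) 1#)
      }

    extension-monomial : ∀ a j → value (ι.⟦ a ⟧ K.* X K.^ toℕ j) ≈ h.⟦ a ⟧ * γ ^ toℕ j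
    extension-monomial a j = trans (evaluate-cong γ (coords-monomial a j)) (evaluate-monomial h γ a j)

    extension-ι : ∀ a → value ι.⟦ a ⟧ ≈ h.⟦ a ⟧
    extension-ι a = trans (FieldHom.⟦⟧-cong extension (K.sym (K.*-identityʳ _)))
      (trans (extension-monomial a zero) (*-identityʳ _))

    extension-X : value X ≈ γ
    extension-X = trans
      (FieldHom.⟦⟧-cong extension (K.sym (K.trans (K.*-congʳ ι.1-homo) (K.trans (K.*-identityˡ _)
        (K.trans (K.^-congʳ X toℕ-one) (K.*-identityʳ X))))))
      (trans (extension-monomial k.1# one) (trans (*-congʳ h.1-homo) (trans (*-identityˡ _)
        (trans (^-congʳ γ toℕ-one) (*-identityʳ γ)))))

  toRootExtension : RootExtension (suc q) k g
  toRootExtension = record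
    { K = K
    ; ι = ι.⟦_⟧
    ; isRingHomomorphism = record
      { isSemiringHomomorphism = record
        { isNearSemiringHomomorphism = record
          { +-isMonoidHomomorphism = record
            { isMagmaHomomorphism = record
              { isRelHomomorphism = record { cong = ι.⟦⟧-cong } ; homo = ι.+-homo }
            ; ε-homo = ι.0-homo
            }
          ; *-homo = ι.*-homo
          }
        ; 1#-homo = ι.1-homo
        }
      ; -‿homo = ι.-‿homo
      }
    ; β = X
    ; β^p≈b = X^p≈g
    ; generates = λ x → resp (evaluate-coords x)
        (generated-∑ λ i → mul (base (coords x i)) (generated-^ (toℕ i)))
    }
    where
    Gen = InGenerated k K ι.⟦_⟧ X
    generated-∑ : ∀ {n} {f : Fin n → K.Carrier} → (∀ i → Gen (f i)) → Gen (K.∑ f)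
    generated-∑ {zero}  gf = resp (K.trans ι.0-homo (K.sym (K.∑-empty _))) (base k.0#)
    generated-∑ {suc n} gf = resp (K.sym (K.∑-suc _)) (add (gf zero) (generated-∑ (gf ∘ suc)))
    generated-^ : ∀ n → Gen (X K.^ n)
    generated-^ zero  = resp ι.1-homo (base k.1#)
    generated-^ (suc n) = mul gen (generated-^ n)

-- Evaluation at β maps the constructed field into the given one. It is injective as a homomorphism
-- of fields, and surjective because its image is a subfield containing the generators. Coordinates
-- are transported along its inverse, so an arbitrary choice of k(ᵖ√g) becomes usable.
module FromRootExtension {c ℓ} (em : ExcludedMiddle (c ⊔ ℓ)) (q : ℕ) (pr : Prime (suc q))
  {k : Field c ℓ} {g : Field.Carrier k}
  (g≉0 : ¬ Field._≈_ k g (Field.0# k)) (g∉kᵖ : ¬ IsNonzeroPower k (suc q) g)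
  (R : RootExtension (suc q) k g) where
  private
    module R = RootExtension R
    module k = FieldKit em k
    module L = FieldKit em R.K
    module h = RingMorphisms.IsRingHomomorphism R.isRingHomomorphism
    A = adjoin em q pr k g g≉0 g∉kᵖ
    module A = KummerKit em q pr A
    module AK = FieldKit em A.K

  inclusion : FieldHom k R.K
  inclusion = record
    { ⟦_⟧ = R.ι ; ⟦⟧-cong = h.⟦⟧-cong ; +-homo = h.+-homo ; *-homo = h.*-homo ; 1-homo = h.1#-homo }

  private
    module Ev = A.Extend inclusion R.β R.β^p≈b
    module ev = HomKit em Ev.extension

    preimage′ : ∀ {x} → InGenerated k R.K R.ι R.β x → ∃ λ a → ev.⟦ a ⟧ L.≈ x
    preimage′ (base x) = A.ι.⟦ x ⟧ , Ev.extension-ι x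
    preimage′ gen = A.X , Ev.extension-X
    preimage′ (add x y) = let a , ea = preimage′ x ; b , eb = preimage′ y in
      a AK.+ b , L.trans (ev.+-homo a b) (L.+-cong ea eb)
    preimage′ (neg x) = let a , ea = preimage′ x in
      AK.- a , L.trans (ev.-‿homo a) (L.-‿cong ea)
    preimage′ (mul x y) = let a , ea = preimage′ x ; b , eb = preimage′ y in
      a AK.* b , L.trans (ev.*-homo a b) (L.*-cong ea eb)
    preimage′ (inv {x} {y} gx xy≈1) = let a , ea = preimage′ gx
                                          x≉0 = L.factor-nonzeroˡ (L.nonzero-resp (L.sym xy≈1) L.1≉0)
                                          a≉0 = ev.reflect-nonzero (L.nonzero-resp (L.sym ea) x≉0)
      in a AK.⁻¹ , L.*-cancel x≉0 (L.trans (L.*-congʳ (L.sym ea)) (L.trans (L.sym (ev.*-homo _ _))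
           (L.trans (ev.⟦⟧-cong (AK.⁻¹-inverseʳ a≉0)) (L.trans ev.1-homo (L.sym xy≈1)))))
    preimage′ (resp x≈y gx) = let a , ea = preimage′ gx in a , L.trans ea x≈y

    preimage : L.Carrier → AK.Carrier
    preimage x = proj₁ (preimage′ (R.generates x))

    ev-preimage : ∀ x → ev.⟦ preimage x ⟧ L.≈ x
    ev-preimage x = proj₂ (preimage′ (R.generates x))

    preimage-unique : ∀ {a x} → ev.⟦ a ⟧ L.≈ x → preimage x AK.≈ a
    preimage-unique e = ev.injective (L.trans (ev-preimage _) (L.sym e))

    transfer-act : ∀ {a b : AK.Carrier} M Y → a AK.≈ b → let open Action em k M Y in
      ∀ x → comb (A.coords a) x ≈ᴹ comb (A.coords b) x
    transfer-act M Y e x = comb-cong (A.coords-cong e) ≈ᴹ-refl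
      where open Action em k M Y

  kummer : Kummer em q k g
  kummer = record
    { K = R.K
    ; ι = inclusion
    ; X = R.β
    ; X^p≈g = R.β^p≈b
    ; coords = λ x → A.coords (preimage x)
    ; evaluate-coords = ev-preimage
    ; coords-evaluate = λ v i → k.trans
        (A.coords-cong (preimage-unique (Scalars.evaluate-cong em inclusion R.β (A.coords-evaluate v))) i) (A.coords-evaluate v i)
    ; coords-cong = λ x≈y → A.coords-cong (preimage-unique (L.trans (ev-preimage _) (L.sym x≈y)))
    ; act-1 = λ M Y x → LeftSemimodule.≈ᴹ-trans M (transfer-act M Y (preimage-unique ev.1-homo) x) (A.act-1 M Y x)
    ; act-* = λ M Y Y-p a b x → LeftSemimodule.≈ᴹ-trans M
        (transfer-act M Y (preimage-unique (L.trans (ev.*-homo _ _) (L.*-cong (ev-preimage a) (ev-preimage b)))) x)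
        (A.act-* M Y Y-p (preimage a) (preimage b) x)
    }

-- Forward differences and residues modulo p.

module Newton {c ℓ} (M : CommutativeMonoid c ℓ) where
  open CommutativeMonoid M
  open BigOp M
  open MonoidMult M renaming (_×_ to _·_)
  open SetoidReasoning setoid

  ×-⨁ : ∀ {n} m (f : Fin n → Carrier) → m · ⨁ f ≈ ⨁ λ i → m · f i
  ×-⨁ m = ⨁-hom (m ·_) (×-congʳ m) (ε-· m) (λ x y → ×-distrib-+ x y m)
    where
    open BigOpHom M M
    ε-· : ∀ m → m · ε ≈ ε
    ε-· zero  = refl
    ε-· (suc m) = trans (identityˡ _) (ε-· m)

  -- Newton's forward difference formula.
  module _ (t : ℕ → ℕ → Carrier) (difference : ∀ j n → t j (suc n) ≈ t j n ∙ t (suc j) n) where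
    forward : ∀ m i → t i m ≈ ⨁ {suc m} λ j → (m choose toℕ j) · t (toℕ j ℕ.+ i) 0
    forward zero  i = sym (trans (⨁-suc {0} _) (trans (∙-congˡ (⨁-empty _)) (trans (identityʳ _) (identityʳ _))))
    forward (suc m) i = begin
      t i (suc m)
        ≈⟨ difference i m ⟩
      t i m ∙ t (suc i) m
        ≈⟨ ∙-cong (forward m i) (forward m (suc i)) ⟩
      ⨁ {suc m} (λ j → (m choose toℕ j) · t (toℕ j ℕ.+ i) 0) ∙ ⨁ {suc m} (λ j → (m choose toℕ j) · t (toℕ j ℕ.+ suc i) 0)
        ≈⟨ ∙-cong widen (⨁-cong λ j → ×-congʳ (m choose toℕ j) (reflexive (≡.cong (λ l → t l 0) (ℕ.+-suc (toℕ j) i)))) ⟩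
      (t i 0 ∙ ⨁ {suc m} (λ j → (m choose suc (toℕ j)) · u j)) ∙ ⨁ {suc m} (λ j → (m choose toℕ j) · u j)
        ≈⟨ trans (assoc _ _ _) (∙-congˡ (trans (comm _ _) (sym (⨁-∙ _ _)))) ⟩
      t i 0 ∙ ⨁ {suc m} (λ j → (m choose toℕ j) · u j ∙ (m choose suc (toℕ j)) · u j)
        ≈⟨ ∙-cong (sym (identityʳ _)) (⨁-cong λ j → trans (sym (×-homo-+ (u j) (m choose toℕ j) (m choose suc (toℕ j))))
             (×-congˡ {u j} (nCk+nC[k+1]≡[n+1]C[k+1] m (toℕ j)))) ⟩
      (suc m choose 0) · t i 0 ∙ ⨁ {suc m} (λ j → (suc m choose suc (toℕ j)) · u j)
        ≈⟨ ⨁-suc {suc m} (λ j → (suc m choose toℕ j) · t (toℕ j ℕ.+ i) 0) ⟨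
      ⨁ {suc (suc m)} (λ j → (suc m choose toℕ j) · t (toℕ j ℕ.+ i) 0) ∎
      where
      u : Fin (suc m) → Carrier
      u j = t (suc (toℕ j) ℕ.+ i) 0
      entry : ℕ → Carrier
      entry j = (m choose j) · t (j ℕ.+ i) 0
      -- The added term with index m + 1 is trivial since its binomial coefficient is 0; it aligns
      -- the range of summation with Pascal's rule.
      widen : ⨁ {suc m} (entry ∘ toℕ) ≈ t i 0 ∙ ⨁ {suc m} (λ j → (m choose suc (toℕ j)) · u j)
      widen = trans (sym (identityʳ _)) (trans (∙-congˡ (sym (×-congˡ {t (suc m ℕ.+ i) 0} (k>n⇒nCk≡0 {m} {suc m} ℕ.≤-refl))))
        (trans (⨁-shift (suc m) entry) (∙-congʳ (identityʳ _))))

    module _ (q : ℕ) (pr : Prime (suc q)) where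
      p∤k! : ∀ k → k ℕ.< suc q → ¬ (suc q ∣ k ℕ.!)
      p∤k! zero  _   p∣1 = ℕ.<⇒≱ (ℕ.nonTrivial⇒n>1 (suc q) {{prime⇒nonTrivial pr}}) (∣⇒≤ p∣1)
      p∤k! (suc k) k<p p∣k! with euclidsLemma (suc k) (k ℕ.!) pr p∣k!
      ... | inj₁ p∣k = ℕ.<⇒≱ k<p (∣⇒≤ p∣k)
      ... | inj₂ p∣k!′ = p∤k! k (ℕ.<-trans (ℕ.n<1+n k) k<p) p∣k!′

      p∣pCk : ∀ k → k ℕ.< q → suc q ∣ suc q choose suc k
      p∣pCk k k<q with euclidsLemma (suc q choose suc k) (suc k ℕ.! ℕ.* (q ℕ.∸ k) ℕ.!) pr p∣product
        where
        instance
          fact≢0 = (suc k) ℕ.!* (q ℕ.∸ k) !≢0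
        1+k≤p : suc k ℕ.≤ suc q
        1+k≤p = ℕ.s≤s (ℕ.<⇒≤ k<q)
        p∣product : suc q ∣ (suc q choose suc k) ℕ.* (suc k ℕ.! ℕ.* (q ℕ.∸ k) ℕ.!)
        p∣product = ≡.subst (suc q ∣_)
          (≡.sym (≡.trans (≡.cong (ℕ._* (suc k ℕ.! ℕ.* (q ℕ.∸ k) ℕ.!)) (nCk≡n!/k![n-k]! 1+k≤p)) (m/n*n≡m (k![n∸k]!∣n! 1+k≤p))))
          (m∣m*n (q ℕ.!))
      ... | inj₁ p∣C = p∣C
      ... | inj₂ p∣!! with euclidsLemma (suc k ℕ.!) ((q ℕ.∸ k) ℕ.!) pr p∣!!
      ...   | inj₁ p∣k! = ⊥-elim (p∤k! (suc k) (ℕ.s≤s k<q) p∣k!)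
      ...   | inj₂ p∣! = ⊥-elim (p∤k! (q ℕ.∸ k) (ℕ.s≤s (ℕ.m∸n≤m q k)) p∣!)

      -- All binomial coefficients between the two ends are divisible by p and are collected in `w`.
      -- Used additively to show p ≠ 0 in a field with a primitive p-th root of unity, and
      -- multiplicatively to show that (τ - 1)ᵖ produces p-th powers.
      p-th-step : ∃ λ w → t 0 (suc q) ≈ t 0 0 ∙ (suc q · w ∙ t (suc q) 0)
      p-th-step = ⨁ {q} w , (begin
        t 0 (suc q)  ≈⟨ forward (suc q) 0 ⟩
        ⨁ {suc (suc q)} (entry ∘ toℕ)  ≈⟨ ⨁-suc {suc q} (entry ∘ toℕ) ⟩
        entry 0 ∙ ⨁ {suc q} (entry ∘ suc ∘ toℕ)
          ≈⟨ ∙-cong (identityʳ _) (⨁-last {q} (entry ∘ suc ∘ toℕ)) ⟩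
        t 0 0 ∙ (⨁ {q} (entry ∘ suc ∘ toℕ ∘ inject₁) ∙ entry (suc (toℕ (fromℕ q))))
          ≈⟨ ∙-congˡ (∙-cong (trans (⨁-cong middle) (sym (×-⨁ (suc q) w))) top) ⟩
        t 0 0 ∙ (suc q · ⨁ {q} w ∙ t (suc q) 0) ∎)
        where
        entry : ℕ → Carrier
        entry j = (suc q choose j) · t (j ℕ.+ 0) 0
        w : Fin q → Carrier
        w j with p∣pCk (toℕ j) (toℕ<n j)
        ... | divides m _ = m · t (suc (toℕ j) ℕ.+ 0) 0
        middle : ∀ j → entry (suc (toℕ (inject₁ j))) ≈ suc q · w j
        middle j with p∣pCk (toℕ j) (toℕ<n j)
        ... | divides m eq = trans (reflexive (≡.cong (entry ∘ suc) (toℕ-inject₁ j)))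
          (trans (×-congˡ {t (suc (toℕ j) ℕ.+ 0) 0} (≡.trans eq (ℕ.*-comm m (suc q)))) (sym (×-assocˡ _ (suc q) m)))
        top : entry (suc (toℕ (fromℕ q))) ≈ t (suc q) 0
        top = trans (reflexive (≡.cong (entry ∘ suc) (toℕ-fromℕ q)))
          (trans (×-congˡ {t (suc q ℕ.+ 0) 0} (nCn≡1 (suc q))) (trans (identityʳ _)
            (reflexive (≡.cong (λ l → t (suc l) 0) (ℕ.+-identityʳ q)))))

module Residues (q : ℕ) (pr : Prime (suc q)) where
  private p = suc q

  %-*ˡ : ∀ m n → ((m % p) ℕ.* n) % p ≡ (m ℕ.* n) % p
  %-*ˡ m n = ≡.trans (%-distribˡ-* (m % p) n p)
    (≡.trans (≡.cong (λ x → (x ℕ.* (n % p)) % p) (m%n%n≡m%n m p)) (≡.sym (%-distribˡ-* m n p)))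

  inverse : ∀ u → 0 ℕ.< u → u ℕ.< p → ∃ λ v → ∃ λ m → u ℕ.* v ≡ 1 ℕ.+ m ℕ.* p
  inverse u 0<u u<p with coprime-Bézout (prime⇒coprime pr {{ℕ.>-nonZero 0<u}} u<p)
  ... | Bézout.-+ s t eq = t , s , ≡.trans (ℕ.*-comm u t) (≡.sym eq)
  ... | Bézout.+- zero  t ()
  -- Here 1 + t u is a multiple of p, so -t inverts u; as q ≡ -1 modulo p, the natural number q t
  -- serves as -t.
  ... | Bézout.+- (suc s) t eq = inverse-neg q eq (ℕ.s≤s⁻¹ (ℕ.nonTrivial⇒n>1 p {{prime⇒nonTrivial pr}}))
    where
    distribute : ∀ q u t → q ℕ.+ u ℕ.* (q ℕ.* t) ≡ q ℕ.* (1 ℕ.+ t ℕ.* u)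
    distribute = solve-∀
    collect : ∀ q s → (1 ℕ.+ q) ℕ.* ((1 ℕ.+ s) ℕ.* (2 ℕ.+ q)) ≡
      (1 ℕ.+ q) ℕ.+ (1 ℕ.+ ((1 ℕ.+ q) ℕ.* s ℕ.+ q) ℕ.* (2 ℕ.+ q))
    collect = solve-∀
    inverse-neg : ∀ q → 1 ℕ.+ t ℕ.* u ≡ suc s ℕ.* suc q → 0 ℕ.< q →
      ∃ λ v → ∃ λ m → u ℕ.* v ≡ 1 ℕ.+ m ℕ.* suc q
    inverse-neg (suc q) eq _ = suc q ℕ.* t , suc q ℕ.* s ℕ.+ q , ℕ.+-cancelˡ-≡ (suc q) _ _
      (≡.trans (distribute (suc q) u t) (≡.trans (≡.cong (suc q ℕ.*_) eq) (collect q s)))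

  mod-multiple : ∀ u v m → u ℕ.* v ≡ 1 ℕ.+ m ℕ.* p → ∀ (i : Fin p) →
    (toℕ ((toℕ i ℕ.* u) mod p) ℕ.* v) mod p ≡ i
  mod-multiple u v m eq i = toℕ-injective (≡.trans (toℕ-fromℕ< (m%n<n (toℕ ((toℕ i ℕ.* u) mod p) ℕ.* v) p)) (≡.trans
    (≡.cong (λ x → (x ℕ.* v) % p) (toℕ-fromℕ< (m%n<n (toℕ i ℕ.* u) p)))
    (≡.trans (%-*ˡ (toℕ i ℕ.* u) v) (≡.trans (≡.cong (_% p) regroup)
    (≡.trans ([m+kn]%n≡m%n (toℕ i) (toℕ i ℕ.* m) p) (m<n⇒m%n≡m (toℕ<n i)))))))
    where
    regroup : toℕ i ℕ.* u ℕ.* v ≡ toℕ i ℕ.+ toℕ i ℕ.* m ℕ.* p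
    regroup = ≡.trans (ℕ.*-assoc (toℕ i) u v) (≡.trans (≡.cong (toℕ i ℕ.*_) eq)
      (≡.trans (ℕ.*-distribˡ-+ (toℕ i) 1 (m ℕ.* p))
        (≡.cong₂ ℕ._+_ (ℕ.*-identityʳ (toℕ i)) (≡.sym (ℕ.*-assoc (toℕ i) m p)))))

  multiplication : ∀ u → 0 ℕ.< u → u ℕ.< p → Permutation p p
  multiplication u 0<u u<p with inverse u 0<u u<p
  ... | v , m , eq = permutation (λ i → (toℕ i ℕ.* u) mod p) (λ i → (toℕ i ℕ.* v) mod p)
    (mod-multiple v u m (≡.trans (ℕ.*-comm v u) eq)) (mod-multiple u v m eq)

  multiplication-to : ∀ u 0<u u<p i → multiplication u 0<u u<p ⟨$⟩ʳ i ≡ (toℕ i ℕ.* u) mod p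
  multiplication-to u 0<u u<p i with inverse u 0<u u<p
  ... | v , m , eq = ≡.refl

  module _ {c ℓ} (M : CommutativeMonoid c ℓ) where
    open CommutativeMonoid M
    open BigOp M

    periodic-% : (h : ℕ → Carrier) → (∀ n → h (p ℕ.+ n) ≈ h n) → ∀ n → h (n % p) ≈ h n
    periodic-% h h-p n = sym (trans (reflexive (≡.cong h (≡.trans (m≡m%n+[m/n]*n n p) (ℕ.+-comm (n % p) _)))) (multiple (n / p)))
      where
      multiple : ∀ m → h (m ℕ.* p ℕ.+ n % p) ≈ h (n % p)
      multiple zero  = refl
      multiple (suc m) = trans (reflexive (≡.cong h (ℕ.+-assoc p (m ℕ.* p) _))) (trans (h-p _) (multiple m))

    -- Multiplication by u permutes the residues. It is used with u = 2 for the product of the roots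
    -- of unity, with u = q ≡ -1 to reverse the order of conjugates, and with general u in
    -- `product-of-norms`.
    ⨁-multiples : (h : ℕ → Carrier) → (∀ n → h (p ℕ.+ n) ≈ h n) → ∀ u → 0 ℕ.< u → u ℕ.< p →
      ⨁ {p} (λ i → h (toℕ i ℕ.* u)) ≈ ⨁ {p} (h ∘ toℕ)
    ⨁-multiples h h-p u 0<u u<p = sym (trans (⨁-permute (h ∘ toℕ) (multiplication u 0<u u<p))
      (⨁-cong λ i → trans (reflexive (≡.cong h (≡.trans (≡.cong toℕ (multiplication-to u 0<u u<p i)) (toℕ-fromℕ< (m%n<n (toℕ i ℕ.* u) p)))))
        (periodic-% h h-p (toℕ i ℕ.* u))))

-- Roots of unity and orthogonality.

module Unity {c ℓ} (em : ExcludedMiddle (c ⊔ ℓ)) (q : ℕ) (pr : Prime (suc q))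
  (L : Field c ℓ) (ζ : Field.Carrier L) (prim : IsPrimitiveRoot L (suc q) ζ) where
  open Powers em (suc q) pr L
  private p = suc q

  1<p : 1 ℕ.< p
  1<p = ℕ.nonTrivial⇒n>1 p {{prime⇒nonTrivial pr}}

  ζ^p≈1 : ζ ^ p ≈ 1#
  ζ^p≈1 = proj₁ prim

  ζ≉0 : ζ ≉ 0#
  ζ≉0 = base-nonzero (nonzero-resp (sym ζ^p≈1) 1≉0)

  -- The image of p in L.
  p̂ : Carrier
  p̂ = ∑ {p} λ _ → 1#

  -- If p = 0 in L then (ζ − 1)ᵖ = ζᵖ − 1 = 0.
  p̂≉0 : p̂ ≉ 0#
  p̂≉0 p̂≈0 = ^-nonzero p ζ-1≉0 (+-cancelˡ 1# _ _ (begin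
    1# + (ζ - 1#) ^ p  ≈⟨ +-cong (*-identityˡ _) (trans (+-congʳ p·w≈0) (trans (+-identityˡ _) (*-identityʳ _))) ⟨
    t 0 0 + (p · w + t p 0)  ≈⟨ proj₂ step ⟨
    t 0 p  ≈⟨ *-identityˡ _ ⟩
    ζ ^ p  ≈⟨ ζ^p≈1 ⟩
    1#  ≈⟨ +-identityʳ _ ⟨
    1# + 0#  ∎))
    where
    open MonoidMult +-commutativeMonoid using () renaming (_×_ to _·_)
    ζ-1≉0 : ζ - 1# ≉ 0#
    ζ-1≉0 e = proj₂ prim 1 (ℕ.s≤s ℕ.z≤n) 1<p (trans (*-identityʳ ζ) (+-cancelʳ (- 1#) ζ 1# (trans e (sym (-‿inverseʳ 1#)))))
    t : ℕ → ℕ → Carrier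
    t j n = (ζ - 1#) ^ j * ζ ^ n
    difference : ∀ j n → t j (suc n) ≈ t j n + t (suc j) n
    difference j n = begin
      d * (ζ * z)  ≈⟨ x∙yz≈y∙xz _ _ _ ⟩
      ζ * (d * z)  ≈⟨ *-congʳ split ⟩
      (1# + (ζ - 1#)) * (d * z)   ≈⟨ distribʳ _ _ _ ⟩
      1# * (d * z) + (ζ - 1#) * (d * z) ≈⟨ +-cong (*-identityˡ _) (sym (*-assoc _ _ _)) ⟩
      d * z + (ζ - 1#) * d * z  ∎
      where
      d = (ζ - 1#) ^ j
      z = ζ ^ n
      split : ζ ≈ 1# + (ζ - 1#)
      split = sym (trans (+-comm _ _) (trans (+-assoc _ _ _) (trans (+-congˡ (-‿inverseˡ 1#)) (+-identityʳ ζ))))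
    step = Newton.p-th-step +-commutativeMonoid t difference q pr
    w = proj₁ step
    ·-∑ : ∀ n x → n · x ≈ ∑ {n} (λ _ → 1#) * x
    ·-∑ zero  x = sym (trans (*-congʳ (∑-empty _)) (zeroˡ x))
    ·-∑ (suc n) x = trans (+-cong (sym (*-identityˡ x)) (·-∑ n x)) (trans (sym (distribʳ x _ _)) (*-congʳ (sym (∑-suc _))))
    p·w≈0 : p · w ≈ 0#
    p·w≈0 = trans (·-∑ p w) (trans (*-congʳ p̂≈0) (zeroˡ w))

  ζ^-periodic : ∀ n → ζ ^ (p ℕ.+ n) ≈ ζ ^ n
  ζ^-periodic n = trans (^-homo-* ζ p n) (trans (*-congʳ ζ^p≈1) (*-identityˡ _))

  ζ^n≉1 : ∀ n → ¬ (p ∣ n) → ζ ^ n ≉ 1#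
  ζ^n≉1 n p∤n e = proj₂ prim (n % p) (ℕ.n≢0⇒n>0 λ n%p≡0 → p∤n (m%n≡0⇒n∣m n p n%p≡0)) (m%n<n n p)
    (trans (Residues.periodic-% q pr *-commutativeMonoid (ζ ^_) ζ^-periodic n) e)

  ζ^i-^p : ∀ n → (ζ ^ n) ^ p ≈ 1#
  ζ^i-^p n = trans (^-^-comm ζ n p) (trans (^-congˡ n ζ^p≈1) (1^n n))

  geometric : ∀ {η} → η ^ p ≈ 1# → η ≉ 1# → ∑ {p} (λ i → η ^ toℕ i) ≈ 0#
  geometric {η} η^p≈1 η≉1 = *-cancel (λ e → η≉1 (+-cancelʳ (- 1#) η 1# (trans e (sym (-‿inverseʳ 1#))))) (begin
    (η - 1#) * s  ≈⟨ distribʳ s η (- 1#) ⟩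
    η * s + - 1# * s  ≈⟨ +-cong shift (-1*x≈-x s) ⟩
    s + - s  ≈⟨ -‿inverseʳ s ⟩
    0#  ≈⟨ zeroʳ _ ⟨
    (η - 1#) * 0#  ∎)
    where
    s = ∑ {p} λ i → η ^ toℕ i
    shift : η * s ≈ s
    shift = +-cancelˡ 1# _ _ (begin
      1# + η * s  ≈⟨ +-congˡ (∑-*ˡ η _) ⟩
      1# + ∑ {p} (λ i → η ^ suc (toℕ i))  ≈⟨ ∑-shift p (η ^_) ⟨
      s + η ^ p  ≈⟨ +-comm _ _ ⟩
      η ^ p + s  ≈⟨ +-congʳ η^p≈1 ⟩
      1# + s  ∎)

  fin-∤ : ∀ (j : Fin p) → j ≢ zero → ¬ (p ∣ toℕ j)
  fin-∤ zero  j≢0 _   = j≢0 ≡.refl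
  fin-∤ (suc j) _   p∣j = ℕ.<⇒≱ (toℕ<n (suc j)) (∣⇒≤ p∣j)

  -- After interchanging the sums, the geometric sums in ζʲ vanish unless j = 0. This shows in
  -- `exponent` and `hilbert90` that some inner sum is nonzero, and in `fixed⇒image` it recovers an
  -- element from its resolvents.
  ∑-orthogonal : ∀ (y : Fin p → Carrier) →
    ∑ (λ (t : Fin p) → ∑ λ j → (ζ ^ toℕ j) ^ toℕ t * y j) ≈ p̂ * y zero
  ∑-orthogonal y = begin
    ∑ (λ (t : Fin p) → ∑ λ j → (ζ ^ toℕ j) ^ toℕ t * y j)   ≈⟨ ∑-comm _ ⟩
    ∑ (λ j → ∑ λ (t : Fin p) → (ζ ^ toℕ j) ^ toℕ t * y j)   ≈⟨ ∑-cong (λ j → ∑-*ʳ (y j) _) ⟨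
    ∑ (λ j → ∑ {p} (λ t → (ζ ^ toℕ j) ^ toℕ t) * y j)  ≈⟨ ∑-single _ zero off ⟩
    ∑ {p} (λ t → 1# ^ toℕ t) * y zero  ≈⟨ *-congʳ (∑-cong λ t → 1^n (toℕ t)) ⟩
    p̂ * y zero  ∎
    where
    off : ∀ j → j ≢ zero → ∑ {p} (λ t → (ζ ^ toℕ j) ^ toℕ t) * y j ≈ 0#
    off j j≢0 = trans (*-congʳ (geometric (ζ^i-^p (toℕ j)) (ζ^n≉1 (toℕ j) (fin-∤ j j≢0)))) (zeroˡ _)

  -- If no ζᵗ y were 1, the geometric sums Σⱼ (ζᵗ y)ʲ would vanish for all t, whereas they add up to
  -- p.
  exponent : ∀ {y} → y ^ p ≈ 1# → ∃ λ s → y ≈ ζ ^ s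
  exponent {y} y^p≈1 with em {∃ λ (t : Fin p) → Lift c (ζ ^ toℕ t * y ≈ 1#)}
  -- From ζᵗ y = 1 follows y = ζ⁻ᵗ, and the exponent t q represents -t because q = p - 1.
  ... | yes (t , lift e) = toℕ t ℕ.* q , (begin
    y  ≈⟨ *-identityʳ y ⟨
    y * 1#  ≈⟨ *-congˡ (ζ^i-^p (toℕ t)) ⟨
    y * (z * z ^ q)  ≈⟨ solve 3 (λ y z w → y ⊕ (z ⊕ w) ⊜ (z ⊕ y) ⊕ w) refl y z (z ^ q) ⟩
    (z * y) * z ^ q  ≈⟨ *-congʳ e ⟩
    1# * z ^ q  ≈⟨ *-identityˡ _ ⟩
    z ^ q  ≈⟨ ^-assocʳ ζ (toℕ t) q ⟩
    ζ ^ (toℕ t ℕ.* q)  ∎)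
    where
    open *-Solver
    z = ζ ^ toℕ t
  ... | no none = ⊥-elim (*-nonzero p̂≉0 1≉0 (begin
    p̂ * 1#  ≈⟨ ∑-orthogonal (λ j → y ^ toℕ j) ⟨
    ∑ (λ (t : Fin p) → ∑ λ (j : Fin p) → (ζ ^ toℕ j) ^ toℕ t * y ^ toℕ j) ≈⟨ ∑-all-0 vanish ⟩
    0#  ∎))
    where
    vanish : ∀ (t : Fin p) → ∑ (λ (j : Fin p) → (ζ ^ toℕ j) ^ toℕ t * y ^ toℕ j) ≈ 0#
    vanish t = trans
      (∑-cong λ j → trans (*-congʳ (^-^-comm ζ (toℕ j) (toℕ t))) (sym (^-distrib-* _ y (toℕ j))))
      (geometric (trans (^-distrib-* _ y p) (trans (*-cong (ζ^i-^p (toℕ t)) y^p≈1) (*-identityˡ 1#)))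
        (λ e → none (t , lift e)))

prim-image : ∀ {c ℓ} (em : ExcludedMiddle (c ⊔ ℓ)) {k L : Field c ℓ} (h : FieldHom k L) {n ζ} →
  IsPrimitiveRoot k n ζ → IsPrimitiveRoot L n (FieldHom.⟦_⟧ h ζ)
prim-image em {k} {L} h {n} {ζ} (ζ^n≈1 , minimal) =
  L.trans (L.sym (^-homo ζ n)) (L.trans (⟦⟧-cong ζ^n≈1) 1-homo) ,
  λ m 0<m m<n e → minimal m 0<m m<n (injective (L.trans (^-homo ζ m) (L.trans e (L.sym 1-homo))))
  where
  open HomKit em h
  module L = Field L

-- Norms as products of conjugates.

module Norm {c ℓ} (em : ExcludedMiddle (c ⊔ ℓ)) (p : ℕ) {L : Field c ℓ} (σ : FieldHom L L) where
  open FieldKit em L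
  open HomKit em σ renaming (⟦_⟧ to s)

  ↑-hom : ℕ → FieldHom L L
  ↑-hom n = record
    { ⟦_⟧ = s ↑ n ; ⟦⟧-cong = cong-↑ n ; +-homo = +-↑ n ; *-homo = *-↑ n ; 1-homo = 1-↑ n }
    where
    cong-↑ : ∀ n {x y} → x ≈ y → (s ↑ n) x ≈ (s ↑ n) y
    cong-↑ zero  e = e
    cong-↑ (suc n) e = ⟦⟧-cong (cong-↑ n e)
    +-↑ : ∀ n x y → (s ↑ n) (x + y) ≈ (s ↑ n) x + (s ↑ n) y
    +-↑ zero  x y = refl
    +-↑ (suc n) x y = trans (⟦⟧-cong (+-↑ n x y)) (+-homo _ _)
    *-↑ : ∀ n x y → (s ↑ n) (x * y) ≈ (s ↑ n) x * (s ↑ n) y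
    *-↑ zero  x y = refl
    *-↑ (suc n) x y = trans (⟦⟧-cong (*-↑ n x y)) (*-homo _ _)
    1-↑ : ∀ n → (s ↑ n) 1# ≈ 1#
    1-↑ zero  = refl
    1-↑ (suc n) = trans (⟦⟧-cong (1-↑ n)) 1-homo

  module ↑ n = HomKit em (↑-hom n)

  ↑-fixed : ∀ n {x} → s x ≈ x → (s ↑ n) x ≈ x
  ↑-fixed zero  e = refl
  ↑-fixed (suc n) e = trans (⟦⟧-cong (↑-fixed n e)) e

  N : Carrier → Carrier
  N x = ∏ {p} λ i → (s ↑ toℕ i) x

  N-cong : ∀ {x y} → x ≈ y → N x ≈ N y
  N-cong e = ∏-cong λ i → ↑.⟦⟧-cong (toℕ i) e

  N-* : ∀ x y → N (x * y) ≈ N x * N y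
  N-* x y = trans (∏-cong λ i → ↑.*-homo (toℕ i) x y) (∏-* _ _)

  N-1 : N 1# ≈ 1#
  N-1 = ∏-all-1 λ i → ↑.1-homo (toℕ i)

  N-^ : ∀ x n → N (x ^ n) ≈ N x ^ n
  N-^ x zero  = N-1
  N-^ x (suc n) = trans (N-* x (x ^ n)) (*-congˡ (N-^ x n))

  N-∏ : ∀ {n} (f : Fin n → Carrier) → N (∏ f) ≈ ∏ (N ∘ f)
  N-∏ = ⨁-hom N N-cong N-1 N-*
    where open BigOpHom *-commutativeMonoid *-commutativeMonoid

  N-nonzero : ∀ {x} → x ≉ 0# → N x ≉ 0#
  N-nonzero x≉0 = ∏-nonzero λ i → ↑.nonzero (toℕ i) x≉0

  N-fixed : ∀ {x} → s x ≈ x → N x ≈ x ^ p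
  N-fixed {x} e = trans (∏-cong λ i → ↑-fixed (toℕ i) e) (∏-const p x)

  module _ (order : ∀ x → (s ↑ p) x ≈ x) where
    -- The two products differ by the factor x on one side and σᵖ x = x on the other, and x ≠ 0 can
    -- be cancelled.
    rotation : ∀ {x} → x ≉ 0# → ∏ {p} (λ i → (s ↑ suc (toℕ i)) x) ≈ N x
    rotation {x} x≉0 = *-cancel x≉0 (trans (sym (∏-shift p λ i → (s ↑ i) x))
      (trans (*-congˡ (order x)) (*-comm _ _)))

    fixes-N : ∀ {x} → x ≉ 0# → s (N x) ≈ N x
    fixes-N x≉0 = trans (∏-homo _) (rotation x≉0)

    N-conjugate : ∀ {x} → x ≉ 0# → N (s x) ≈ N x
    N-conjugate {x} x≉0 = trans (∏-cong λ i → reflexive (↑-suc s (toℕ i) x)) (rotation x≉0)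

    N-conjugate-↑ : ∀ n {x} → x ≉ 0# → N ((s ↑ n) x) ≈ N x
    N-conjugate-↑ zero  x≉0 = refl
    N-conjugate-↑ (suc n) x≉0 = trans (N-conjugate (↑.nonzero n x≉0)) (N-conjugate-↑ n x≉0)

  ↑-intertwine : ∀ {M : Field c ℓ} (h : FieldHom M L) (σ′ : FieldHom M M) →
    (∀ x → FieldHom.⟦_⟧ h (FieldHom.⟦_⟧ σ′ x) ≈ s (FieldHom.⟦_⟧ h x)) →
    ∀ n x → FieldHom.⟦_⟧ h ((FieldHom.⟦_⟧ σ′ ↑ n) x) ≈ (s ↑ n) (FieldHom.⟦_⟧ h x)
  ↑-intertwine h σ′ e zero  x = refl
  ↑-intertwine h σ′ e (suc n) x = trans (e _) (⟦⟧-cong (↑-intertwine h σ′ e n x))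

N-image : ∀ {c ℓ} (em : ExcludedMiddle (c ⊔ ℓ)) p {M L : Field c ℓ} (h : FieldHom M L)
  (σ′ : FieldHom M M) (σ : FieldHom L L) → let open Field L in
  (∀ x → FieldHom.⟦_⟧ h (FieldHom.⟦_⟧ σ′ x) ≈ FieldHom.⟦_⟧ σ (FieldHom.⟦_⟧ h x)) →
  ∀ x → FieldHom.⟦_⟧ h (Norm.N em p σ′ x) ≈ Norm.N em p σ (FieldHom.⟦_⟧ h x)
N-image em p {L = L} h σ′ σ e x = trans (∏-homo _) (∏-cong λ i → Norm.↑-intertwine em p σ h σ′ e (toℕ i) x)
  where
  open FieldKit em L
  open HomKit em h

-- The conjugation of a Kummer extension and its determinant norm.

module Galois {c ℓ} (em : ExcludedMiddle (c ⊔ ℓ)) (q : ℕ) (pr : Prime (suc q))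
  {k : Field c ℓ} {g : Field.Carrier k} (g≉0 : ¬ Field._≈_ k g (Field.0# k))
  (ζ : Field.Carrier k) (prim : IsPrimitiveRoot k (suc q) ζ) (E : Kummer em q k g) where
  open KummerKit em q pr E public
  private
    p = suc q
    module k = FieldKit em k
    module Uk = Unity em q pr k ζ prim
  open Powers em p pr K public

  Z : Carrier
  Z = ι.⟦ ζ ⟧

  module U = Unity em q pr K Z (prim-image em ι prim)

  X≉0 : X ≉ 0#
  X≉0 = base-nonzero (nonzero-resp (sym X^p≈g) (ι.nonzero g≉0))

  private
    module Conjugation = Extend ι (Z * X) (begin
      (Z * X) ^ p  ≈⟨ ^-distrib-* Z X p ⟩
      Z ^ p * X ^ p  ≈⟨ *-cong U.ζ^p≈1 X^p≈g ⟩
      1# * ι.⟦ g ⟧  ≈⟨ *-identityˡ _ ⟩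
      ι.⟦ g ⟧  ∎)

  conjugation : FieldHom K K
  conjugation = Conjugation.extension

  module τ = HomKit em conjugation
  open Norm em p conjugation public

  τ-ι : ∀ a → τ.⟦ ι.⟦ a ⟧ ⟧ ≈ ι.⟦ a ⟧
  τ-ι = Conjugation.extension-ι

  τ-X : τ.⟦ X ⟧ ≈ Z * X
  τ-X = Conjugation.extension-X

  τ^n-X : ∀ n → (τ.⟦_⟧ ↑ n) X ≈ Z ^ n * X
  τ^n-X zero  = sym (*-identityˡ X)
  τ^n-X (suc n) = begin
    τ.⟦ (τ.⟦_⟧ ↑ n) X ⟧  ≈⟨ τ.⟦⟧-cong (τ^n-X n) ⟩
    τ.⟦ Z ^ n * X ⟧  ≈⟨ τ.*-homo _ X ⟩
    τ.⟦ Z ^ n ⟧ * τ.⟦ X ⟧  ≈⟨ *-cong (trans (τ.^-homo Z n) (^-congˡ n (τ-ι ζ))) τ-X ⟩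
    Z ^ n * (Z * X)  ≈⟨ trans (sym (*-assoc _ _ _)) (*-congʳ (*-comm _ _)) ⟩
    Z ^ suc n * X  ∎

  order : ∀ x → (τ.⟦_⟧ ↑ p) x ≈ x
  order = hom-unique (↑-hom p) (idHom K) (λ a → ↑-fixed p (τ-ι a))
    (trans (τ^n-X p) (trans (*-congʳ U.ζ^p≈1) (*-identityˡ X)))

  coords-τ : ∀ x i → coords τ.⟦ x ⟧ i k.≈ ζ k.^ toℕ i k.* coords x i
  coords-τ x i = k.trans (coords-cong (∑-cong λ i → begin
      ι.⟦ coords x i ⟧ * (Z * X) ^ toℕ i  ≈⟨ *-congˡ (^-distrib-* Z X (toℕ i)) ⟩
      ι.⟦ coords x i ⟧ * (Z ^ toℕ i * X ^ toℕ i)  ≈⟨ trans (sym (*-assoc _ _ _)) (*-congʳ (*-comm _ _)) ⟩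
      (Z ^ toℕ i * ι.⟦ coords x i ⟧) * X ^ toℕ i  ≈⟨ *-congʳ (trans (ι.*-homo _ _) (*-congʳ (ι.^-homo ζ (toℕ i)))) ⟨
      ι.⟦ ζ k.^ toℕ i k.* coords x i ⟧ * X ^ toℕ i  ∎) i)
    (coords-evaluate (λ i → ζ k.^ toℕ i k.* coords x i) i)

  -- The conjugation multiplies the i-th coordinate by ζⁱ, so every coordinate of a fixed element
  -- other than the 0-th vanishes.
  fixed⇒base : ∀ {x} → τ.⟦ x ⟧ ≈ x → ι.⟦ coords x zero ⟧ ≈ x
  fixed⇒base {x} τx≈x = sym (begin
    x  ≈⟨ evaluate-coords x ⟨
    ∑ (λ i → ι.⟦ coords x i ⟧ * X ^ toℕ i)  ≈⟨ ∑-single _ zero off ⟩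
    ι.⟦ coords x zero ⟧ * 1#  ≈⟨ *-identityʳ _ ⟩
    ι.⟦ coords x zero ⟧  ∎)
    where
    off : ∀ i → i ≢ zero → ι.⟦ coords x i ⟧ * X ^ toℕ i ≈ 0#
    off i i≢0 = trans (*-congʳ (trans (ι.⟦⟧-cong (k.stable λ cᵢ≉0 → Uk.ζ^n≉1 (toℕ i) (Uk.fin-∤ i i≢0)
      (k.*-cancel cᵢ≉0 (k.trans (k.*-comm _ _) (k.trans (k.trans (k.sym (coords-τ x i)) (coords-cong τx≈x i)) (k.sym (k.*-identityʳ _)))))))
      ι.0-homo)) (zeroˡ _)

  -- A total function: it reads off the 0-th coordinate, which represents `N x` once that product is
  -- known to lie in k; `ι-norm` shows this for x ≠ 0.
  norm : Carrier → k.Carrier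
  norm x = coords (N x) zero

  ι-norm : ∀ {x} → x ≉ 0# → ι.⟦ norm x ⟧ ≈ N x
  ι-norm x≉0 = fixed⇒base (fixes-N order x≉0)

  private
    open Kronecker em K

    det-image : ∀ {n} (M : Fin n → Fin n → k.Carrier) →
      ι.⟦ det k M ⟧ ≈ det K (λ i j → ι.⟦ M i j ⟧)
    det-image {zero}  M = ι.1-homo
    det-image {suc n} M = begin
      ι.⟦ det k M ⟧  ≡⟨ ≡.cong ι.⟦_⟧ (k.∑≡sum term) ⟨
      ι.⟦ k.∑ term ⟧  ≈⟨ ι.∑-homo term ⟩
      ∑ (λ j → ι.⟦ term j ⟧)  ≈⟨ ∑-cong image ⟩
      ∑ term′  ≡⟨ ∑≡sum term′ ⟩
      det K (λ i j → ι.⟦ M i j ⟧)  ∎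
      where
      term : Fin (suc n) → k.Carrier
      term j = (k.- k.1#) k.^ toℕ j k.* (M zero j k.* det k λ i l → M (suc i) (punchIn j l))
      term′ : Fin (suc n) → Carrier
      term′ j = (- 1#) ^ toℕ j * (ι.⟦ M zero j ⟧ * det K λ i l → ι.⟦ M (suc i) (punchIn j l) ⟧)
      image : ∀ j → ι.⟦ term j ⟧ ≈ term′ j
      image j = trans (ι.*-homo _ _) (*-cong
        (trans (ι.^-homo _ (toℕ j)) (^-congˡ (toℕ j) (trans (ι.-‿homo k.1#) (-‿cong ι.1-homo))))
        (trans (ι.*-homo _ _) (*-congˡ (det-image λ i l → M (suc i) (punchIn j l)))))

    -- `W` is the Vandermonde matrix of the conjugates τⁱ X, and `W′` is p times its inverse, the
    -- exponent l q standing for -l.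
    W W′ : Fin p → Fin p → Carrier
    W i j = (Z ^ toℕ i * X) ^ toℕ j
    W′ j l = (Z ^ (toℕ l ℕ.* q) * X ⁻¹) ^ toℕ j

    ratio-nontrivial : ∀ {i l : Fin p} → i ≢ l → Z ^ toℕ i * Z ^ (toℕ l ℕ.* q) ≉ 1#
    ratio-nontrivial {i} {l} i≢l e = i≢l (toℕ-injective (≤-antisym-powers (ℕ.≤-total (toℕ i) (toℕ l))))
      where
      same : Z ^ toℕ i ≈ Z ^ toℕ l
      same = begin
        Z ^ toℕ i  ≈⟨ *-identityʳ _ ⟨
        Z ^ toℕ i * 1#  ≈⟨ *-congˡ (U.ζ^i-^p (toℕ l)) ⟨
        Z ^ toℕ i * (Z ^ toℕ l * (Z ^ toℕ l) ^ q)  ≈⟨ *-congˡ (*-congˡ (^-assocʳ Z (toℕ l) q)) ⟩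
        Z ^ toℕ i * (Z ^ toℕ l * Z ^ (toℕ l ℕ.* q))  ≈⟨ x∙yz≈y∙xz _ _ _ ⟩
        Z ^ toℕ l * (Z ^ toℕ i * Z ^ (toℕ l ℕ.* q))  ≈⟨ *-congˡ e ⟩
        Z ^ toℕ l * 1#  ≈⟨ *-identityʳ _ ⟩
        Z ^ toℕ l  ∎
      difference : ∀ {m n} → m ℕ.≤ n → n ℕ.< p → Z ^ m ≈ Z ^ n → n ℕ.∸ m ≡ 0
      difference {m} {n} m≤n n<p e with n ℕ.∸ m in eq
      ... | zero  = ≡.refl
      ... | suc d = ⊥-elim (proj₂ (prim-image em ι prim) (suc d) (ℕ.s≤s ℕ.z≤n)
        (ℕ.≤-<-trans (ℕ.≤-trans (ℕ.≤-reflexive (≡.sym eq)) (ℕ.m∸n≤m n m)) n<p)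
        (*-cancel (^-nonzero m U.ζ≉0) (begin
          Z ^ m * Z ^ suc d  ≈⟨ ^-homo-* Z m (suc d) ⟨
          Z ^ (m ℕ.+ suc d)  ≈⟨ ^-congʳ Z (≡.trans (≡.cong (m ℕ.+_) (≡.sym eq)) (ℕ.m+[n∸m]≡n m≤n)) ⟩
          Z ^ n  ≈⟨ e ⟨
          Z ^ m  ≈⟨ *-identityʳ _ ⟨
          Z ^ m * 1#  ∎)))
      ≤-antisym-powers : toℕ i ℕ.≤ toℕ l ⊎ toℕ l ℕ.≤ toℕ i → toℕ i ≡ toℕ l
      ≤-antisym-powers (inj₁ i≤l) = ℕ.≤-antisym i≤l (ℕ.m∸n≡0⇒m≤n (difference i≤l (toℕ<n l) same))
      ≤-antisym-powers (inj₂ l≤i) = ℕ.≤-antisym (ℕ.m∸n≡0⇒m≤n (difference l≤i (toℕ<n i) (sym same))) l≤i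

    W-inverse : ∀ i l → ∑ (λ j → W i j * W′ j l) ≈ U.p̂ * δ i l
    W-inverse i l = trans (∑-cong λ (j : Fin p) → begin
        (Z ^ toℕ i * X) ^ toℕ j * (Z ^ (toℕ l ℕ.* q) * X ⁻¹) ^ toℕ j   ≈⟨ ^-distrib-* _ _ (toℕ j) ⟨
        ((Z ^ toℕ i * X) * (Z ^ (toℕ l ℕ.* q) * X ⁻¹)) ^ toℕ j  ≈⟨ ^-congˡ (toℕ j)
            (trans (interchange _ X _ (X ⁻¹))
              (trans (*-congˡ (⁻¹-inverseʳ X≉0)) (*-identityʳ _))) ⟩
        η ^ toℕ j  ∎) (by-cases (i Fin.≟ l))
      where
      η = Z ^ toℕ i * Z ^ (toℕ l ℕ.* q)
      η^p≈1 : η ^ p ≈ 1#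
      η^p≈1 = trans (^-distrib-* _ _ p) (trans (*-cong (U.ζ^i-^p (toℕ i)) (U.ζ^i-^p (toℕ l ℕ.* q))) (*-identityˡ _))
      by-cases : Dec (i ≡ l) → ∑ {p} (λ j → η ^ toℕ j) ≈ U.p̂ * δ i l
      by-cases (yes ≡.refl) = trans
        (∑-cong λ j → trans (^-congˡ (toℕ j) (trans (*-congˡ (sym (^-assocʳ Z (toℕ i) q))) (U.ζ^i-^p (toℕ i)))) (1^n (toℕ j)))
        (sym (trans (*-congˡ (δ-diag i)) (*-identityʳ _)))
      by-cases (no i≢l) = trans (U.geometric η^p≈1 (ratio-nontrivial i≢l)) (sym (trans (*-congˡ (δ-off i≢l)) (zeroʳ _)))

    det-W≉0 : det K W ≉ 0#
    det-W≉0 = factor-nonzeroˡ (nonzero-resp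
      (trans (sym (trans (Determinant.det-cong K {p} W-inverse) (trans (det-diag {p} λ _ → U.p̂) (∏-const p U.p̂)))) (det-*ᴹ W W′))
      (^-nonzero p U.p̂≉0))

  -- With W the matrix of the conjugates τⁱ(Xʲ), the relation z Xʲ = Σ Mᵢⱼ Xⁱ
  -- reads W M = diag(τⁱ z) W, and W is invertible.
  det-norm : ∀ z (M : Fin p → Fin p → k.Carrier) →
    (∀ j → z * X ^ toℕ j ≈ ∑ λ i → ι.⟦ M i j ⟧ * X ^ toℕ i) → ι.⟦ det k M ⟧ ≈ N z
  det-norm z M e = *-cancel det-W≉0 (begin
    det K W * ι.⟦ det k M ⟧  ≈⟨ *-congˡ (det-image M) ⟩
    det K W * det K (λ i j → ι.⟦ M i j ⟧)  ≈⟨ det-*ᴹ W (λ i j → ι.⟦ M i j ⟧) ⟨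
    det K (λ i j → ∑ λ l → W i l * ι.⟦ M l j ⟧) ≈⟨ Determinant.det-cong K {p} entry ⟩
    det K (λ i j → ∑ λ l → D i l * W l j)  ≈⟨ det-*ᴹ D W ⟩
    det K D * det K W  ≈⟨ *-congʳ (det-diag {p} λ i → (τ.⟦_⟧ ↑ toℕ i) z) ⟩
    N z * det K W  ≈⟨ *-comm _ _ ⟩
    det K W * N z  ∎)
    where
    D : Fin p → Fin p → Carrier
    D i j = (τ.⟦_⟧ ↑ toℕ i) z * δ i j
    τ-power : ∀ n m → (τ.⟦_⟧ ↑ n) (X ^ m) ≈ (Z ^ n * X) ^ m
    τ-power n m = trans (↑.^-homo n X m) (^-congˡ m (τ^n-X n))
    entry : ∀ i j → ∑ (λ l → W i l * ι.⟦ M l j ⟧) ≈ ∑ λ l → D i l * W l j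
    entry i j = begin
      ∑ (λ l → W i l * ι.⟦ M l j ⟧)
        ≈⟨ ∑-cong (λ l → trans (*-comm _ _) (*-cong (sym (↑-fixed (toℕ i) (τ-ι (M l j)))) (sym (τ-power (toℕ i) (toℕ l))))) ⟩
      ∑ (λ l → (τ.⟦_⟧ ↑ toℕ i) ι.⟦ M l j ⟧ * (τ.⟦_⟧ ↑ toℕ i) (X ^ toℕ l))
        ≈⟨ ∑-cong (λ l → ↑.*-homo (toℕ i) _ _) ⟨
      ∑ (λ l → (τ.⟦_⟧ ↑ toℕ i) (ι.⟦ M l j ⟧ * X ^ toℕ l))
        ≈⟨ ↑.∑-homo (toℕ i) _ ⟨
      (τ.⟦_⟧ ↑ toℕ i) (∑ λ l → ι.⟦ M l j ⟧ * X ^ toℕ l)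
        ≈⟨ ↑.⟦⟧-cong (toℕ i) (e j) ⟨
      (τ.⟦_⟧ ↑ toℕ i) (z * X ^ toℕ j)
        ≈⟨ trans (↑.*-homo (toℕ i) z _) (*-congˡ (τ-power (toℕ i) (toℕ j))) ⟩
      (τ.⟦_⟧ ↑ toℕ i) z * W i j
        ≈⟨ trans (∑-single _ i λ l l≢i → trans (*-congʳ (trans (*-congˡ (δ-off (l≢i ∘ ≡.sym))) (zeroʳ _))) (zeroˡ _))
             (*-congʳ (trans (*-congˡ (δ-diag i)) (*-identityʳ _))) ⟨
      ∑ (λ l → D i l * W l j) ∎

  multiplicationMatrix : Carrier → Fin p → Fin p → k.Carrier
  multiplicationMatrix z i j = coords (z * X ^ toℕ j) i

  det-multiplicationMatrix : ∀ z → ι.⟦ det k (multiplicationMatrix z) ⟧ ≈ N z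
  det-multiplicationMatrix z = det-norm z (multiplicationMatrix z) λ j → sym (evaluate-coords _)

-- Classes modulo p-th powers, Hilbert 90, and the structure of K̇.

module Classes {c ℓ} (em : ExcludedMiddle (c ⊔ ℓ)) (q : ℕ) (pr : Prime (suc q)) (k : Field c ℓ) where
  open Powers em (suc q) pr k
  private p = suc q

  -- Membership in ⟨g⟩ k̇ᵖ. The exponent is an unbounded natural number so that classes multiply
  -- without reduction; `reduce` brings it below p at the end.
  InClass : Carrier → Carrier → Set (c ⊔ ℓ)
  InClass g n = ∃ λ i → ∃ λ y → y ≉ 0# × n ≈ g ^ i * y ^ p

  module _ {g : Carrier} where
    class-resp : ∀ {m n} → m ≈ n → InClass g m → InClass g n
    class-resp m≈n (i , y , y≉0 , e) = i , y , y≉0 , trans (sym m≈n) e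

    class-* : ∀ {m n} → InClass g m → InClass g n → InClass g (m * n)
    class-* (i , x , x≉0 , e) (j , y , y≉0 , f) = i ℕ.+ j , x * y , *-nonzero x≉0 y≉0 ,
      trans (*-cong e f) (trans (interchange _ _ _ _) (*-cong (sym (^-homo-* g i j)) (sym (^-distrib-* x y p))))

    class-power : ∀ {y} → y ≉ 0# → InClass g (y ^ p)
    class-power y≉0 = 0 , _ , y≉0 , sym (*-identityˡ _)

    class-generator : InClass g g
    class-generator = 1 , 1# , 1≉0 , sym (trans (*-cong (*-identityʳ g) (1^n p)) (*-identityʳ g))

    class-1 : InClass g 1#
    class-1 = class-resp (1^n p) (class-power 1≉0)

    class-^ : ∀ {n} m → InClass g n → InClass g (n ^ m)
    class-^ zero  _ = class-1
    class-^ (suc m) n∈ = class-* n∈ (class-^ m n∈)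

    class-∏ : ∀ {n} {f : Fin n → Carrier} → (∀ i → InClass g (f i)) → InClass g (∏ f)
    class-∏ {zero}  f∈ = class-resp (sym (∏-empty _)) class-1
    class-∏ {suc n} f∈ = class-resp (sym (∏-suc _)) (class-* (f∈ zero) (class-∏ (f∈ ∘ suc)))

    class-cancel-power : ∀ {n y} → y ≉ 0# → InClass g (n * y ^ p) → InClass g n
    class-cancel-power {n} {y} y≉0 (i , x , x≉0 , e) = i , x * y ⁻¹ , *-nonzero x≉0 (⁻¹-nonzero y≉0) , (begin
      n  ≈⟨ *-identityʳ n ⟨
      n * 1#  ≈⟨ *-congˡ (trans (*-comm _ _) (⁻¹-^ p y≉0)) ⟨
      n * (y ^ p * y ⁻¹ ^ p)  ≈⟨ *-assoc _ _ _ ⟨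
      n * y ^ p * y ⁻¹ ^ p  ≈⟨ *-congʳ e ⟩
      g ^ i * x ^ p * y ⁻¹ ^ p  ≈⟨ *-assoc _ _ _ ⟩
      g ^ i * (x ^ p * y ⁻¹ ^ p)  ≈⟨ *-congˡ (^-distrib-* x (y ⁻¹) p) ⟨
      g ^ i * (x * y ⁻¹) ^ p  ∎)

    class-cancel : g ≉ 0# → ∀ {m n} → InClass g m → InClass g (m * n) → InClass g n
    -- The power `m ^ q` serves as the inverse of `m`, at the cost of a factor mᵖ that is cancelled
    -- afterwards.
    class-cancel g≉0 {m} {n} m∈@(i , x , x≉0 , e) mn∈ = class-cancel-power m≉0 (class-resp
      (solve 3 (λ m n r → r ⊕ (m ⊕ n) ⊜ n ⊕ (m ⊕ r)) refl m n (m ^ q))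
      (class-* (class-^ q m∈) mn∈))
      where
      open *-Solver
      m≉0 : m ≉ 0#
      m≉0 = nonzero-resp (sym e) (*-nonzero (^-nonzero i g≉0) (^-nonzero p x≉0))

  reduce : ∀ {g n} → g ≉ 0# → InClass g n →
    ∃ λ (i : Fin p) → ∃ λ y → y ≉ 0# × n ≈ g ^ toℕ i * y ^ p
  reduce {g} {n} g≉0 (i , y , y≉0 , e) = i mod p , g ^ (i / p) * y , *-nonzero (^-nonzero (i / p) g≉0) y≉0 , (begin
    n  ≈⟨ e ⟩
    g ^ i * y ^ p  ≈⟨ *-congʳ (^-congʳ g (m≡m%n+[m/n]*n i p)) ⟩
    g ^ (i % p ℕ.+ i / p ℕ.* p) * y ^ p  ≈⟨ *-congʳ (trans (^-homo-* g (i % p) _) (*-congˡ (sym (^-assocʳ g (i / p) p)))) ⟩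
    g ^ (i % p) * (g ^ (i / p)) ^ p * y ^ p  ≈⟨ trans (*-assoc _ _ _) (*-congˡ (sym (^-distrib-* _ y p))) ⟩
    g ^ (i % p) * (g ^ (i / p) * y) ^ p  ≈⟨ *-congʳ (^-congʳ g (toℕ-fromℕ< (m%n<n i p))) ⟨
    g ^ toℕ (i mod p) * (g ^ (i / p) * y) ^ p  ∎)

module Hilbert {c ℓ} (em : ExcludedMiddle (c ⊔ ℓ)) (q : ℕ) (pr : Prime (suc q)) (odd : ¬ (2 ∣ suc q))
  {k : Field c ℓ} {g : Field.Carrier k} (g≉0 : ¬ Field._≈_ k g (Field.0# k))
  (ζ : Field.Carrier k) (prim : IsPrimitiveRoot k (suc q) ζ) (E : Kummer em q k g) where
  open Galois em q pr g≉0 ζ prim E public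
  private
    p = suc q
    module k = FieldKit em k
  open Classes em q pr k

  2<p : 2 ℕ.< p
  2<p = ℕ.≤∧≢⇒< U.1<p λ 2≡p → odd (≡.subst (2 ∣_) 2≡p (divides 1 ≡.refl))

  -- As p is odd, i ↦ 2i permutes the residues modulo p, so the product s satisfies s² = s.
  ∏-Z^i : ∏ {p} (λ i → Z ^ toℕ i) ≈ 1#
  ∏-Z^i = sym (*-cancel (∏-nonzero λ (i : Fin p) → ^-nonzero (toℕ i) U.ζ≉0) (begin
    s * 1#  ≈⟨ *-identityʳ s ⟩
    s  ≈⟨ Residues.⨁-multiples q pr *-commutativeMonoid (Z ^_) U.ζ^-periodic 2 (ℕ.s≤s ℕ.z≤n) 2<p ⟨
    ∏ {p} (λ i → Z ^ (toℕ i ℕ.* 2))   ≈⟨ ∏-cong (λ i → trans (sym (^-assocʳ Z (toℕ i) 2)) (*-congˡ (*-identityʳ _))) ⟩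
    ∏ {p} (λ i → Z ^ toℕ i * Z ^ toℕ i) ≈⟨ ∏-* _ _ ⟩
    s * s  ∎))
    where s = ∏ {p} λ i → Z ^ toℕ i

  N-X : N X ≈ ι.⟦ g ⟧
  N-X = begin
    ∏ {p} (λ i → (τ.⟦_⟧ ↑ toℕ i) X)  ≈⟨ ∏-cong (λ i → τ^n-X (toℕ i)) ⟩
    ∏ {p} (λ i → Z ^ toℕ i * X)  ≈⟨ ∏-* _ _ ⟩
    ∏ {p} (λ i → Z ^ toℕ i) * ∏ {p} (λ _ → X) ≈⟨ *-cong ∏-Z^i (trans (∏-const p X) X^p≈g) ⟩
    1# * ι.⟦ g ⟧  ≈⟨ *-identityˡ _ ⟩
    ι.⟦ g ⟧  ∎

  N-ι : ∀ a → N ι.⟦ a ⟧ ≈ ι.⟦ a k.^ p ⟧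
  N-ι a = trans (N-fixed (τ-ι a)) (sym (ι.^-homo a p))

  -- The resolvents Σⱼ (x τx ⋯ τʲ⁻¹x) τʲ(Xᵗ) cannot all vanish, since summing
  -- X⁻ᵗ times them over t gives p.
  module _ {x : Carrier} (Nx≈1 : N x ≈ 1#) where
    private
      P : ℕ → Carrier
      P zero  = 1#
      P (suc j) = x * τ.⟦ P j ⟧

      P-∏ : ∀ j → P j ≈ ∏ {j} λ l → (τ.⟦_⟧ ↑ toℕ l) x
      P-∏ zero  = sym (∏-empty _)
      P-∏ (suc j) = trans (*-congˡ (trans (τ.⟦⟧-cong (P-∏ j)) (τ.∏-homo _))) (sym (∏-suc _))

      resolvent : ℕ → Carrier
      resolvent t = ∑ {p} λ j → P (toℕ j) * (τ.⟦_⟧ ↑ toℕ j) (X ^ t)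

      -- Applying τ and multiplying by x carries each term to the next one, and the last returns to
      -- the first because N x = 1 and τᵖ = 1.
      resolvent-fixed : ∀ t → τ.⟦ resolvent t ⟧ * x ≈ resolvent t
      resolvent-fixed t = begin
        τ.⟦ resolvent t ⟧ * x
          ≈⟨ trans (*-comm _ _) (trans (*-congˡ (τ.∑-homo _)) (∑-*ˡ x _)) ⟩
        ∑ {p} (λ j → x * τ.⟦ P (toℕ j) * (τ.⟦_⟧ ↑ toℕ j) (X ^ t) ⟧)
          ≈⟨ ∑-cong (λ j → trans (*-congˡ (τ.*-homo _ _)) (sym (*-assoc _ _ _))) ⟩
        ∑ {p} (λ j → h (suc (toℕ j)))
          ≈⟨ +-cancelˡ (h 0) _ _ (trans (sym (∑-shift p h)) (trans (+-congˡ last) (+-comm _ _))) ⟩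
        resolvent t ∎
        where
        h : ℕ → Carrier
        h j = P j * (τ.⟦_⟧ ↑ j) (X ^ t)
        last : h p ≈ h 0
        last = *-cong (trans (P-∏ p) Nx≈1) (order (X ^ t))

      resolvent-X : ∀ t → resolvent t ≈ X ^ t * ∑ {p} λ j → (Z ^ toℕ j) ^ t * P (toℕ j)
      resolvent-X t = trans (∑-cong λ (j : Fin p) → begin
          P (toℕ j) * (τ.⟦_⟧ ↑ toℕ j) (X ^ t)
            ≈⟨ *-congˡ (trans (↑.^-homo (toℕ j) X t) (trans (^-congˡ t (τ^n-X (toℕ j))) (^-distrib-* _ X t))) ⟩
          P (toℕ j) * ((Z ^ toℕ j) ^ t * X ^ t)
            ≈⟨ solve 3 (λ a b y → a ⊕ (b ⊕ y) ⊜ y ⊕ (b ⊕ a)) refl _ _ _ ⟩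
          X ^ t * ((Z ^ toℕ j) ^ t * P (toℕ j)) ∎) (sym (∑-*ˡ (X ^ t) _))
        where open *-Solver

    hilbert90 : ∃ λ w → w ≉ 0# × τ.⟦ w ⟧ * x ≈ w
    hilbert90 with em {∃ λ (t : Fin p) → Lift c (resolvent (toℕ t) ≉ 0#)}
    ... | yes (t , lift w≉0) = resolvent (toℕ t) , w≉0 , resolvent-fixed (toℕ t)
    ... | no none = ⊥-elim (*-nonzero U.p̂≉0 1≉0 (trans (sym (U.∑-orthogonal (P ∘ toℕ)))
      (∑-all-0 λ t → *-cancel (^-nonzero (toℕ t) X≉0)
        (trans (sym (resolvent-X (toℕ t))) (trans (stable λ ≉0 → none (t , lift ≉0)) (sym (zeroʳ _)))))))

  -- The operator τ - 1 on the multiplicative group.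
  D : Carrier → Carrier
  D y = τ.⟦ y ⟧ * y ⁻¹

  D-unique : ∀ {y z} → y ≉ 0# → τ.⟦ y ⟧ ≈ y * z → D y ≈ z
  D-unique {y} {z} y≉0 e = *-cancel y≉0 (begin
    y * (τ.⟦ y ⟧ * y ⁻¹)   ≈⟨ x∙yz≈y∙xz _ _ _ ⟩
    τ.⟦ y ⟧ * (y * y ⁻¹)   ≈⟨ trans (*-congˡ (⁻¹-inverseʳ y≉0)) (*-identityʳ _) ⟩
    τ.⟦ y ⟧  ≈⟨ e ⟩
    y * z  ∎)

  D-spec : ∀ {y} → y ≉ 0# → τ.⟦ y ⟧ ≈ y * D y
  D-spec {y} y≉0 = sym (trans (x∙yz≈y∙xz _ _ _) (trans (*-congˡ (⁻¹-inverseʳ y≉0)) (*-identityʳ _)))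

  D-nonzero : ∀ {y} → y ≉ 0# → D y ≉ 0#
  D-nonzero y≉0 = *-nonzero (τ.nonzero y≉0) (⁻¹-nonzero y≉0)

  D^-nonzero : ∀ n {y} → y ≉ 0# → (D ↑ n) y ≉ 0#
  D^-nonzero zero  y≉0 = y≉0
  D^-nonzero (suc n) y≉0 = D-nonzero (D^-nonzero n y≉0)

  D-cong : ∀ {y z} → y ≉ 0# → y ≈ z → D y ≈ D z
  D-cong y≉0 y≈z = D-unique y≉0 (trans (τ.⟦⟧-cong y≈z) (trans (D-spec (nonzero-resp y≈z y≉0)) (*-congʳ (sym y≈z))))

  D-* : ∀ {y z} → y ≉ 0# → z ≉ 0# → D (y * z) ≈ D y * D z
  D-* {y} {z} y≉0 z≉0 = D-unique (*-nonzero y≉0 z≉0) (trans (τ.*-homo y z)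
    (trans (*-cong (D-spec y≉0) (D-spec z≉0)) (interchange _ _ _ _)))

  D^-cong : ∀ n {y z} → y ≉ 0# → y ≈ z → (D ↑ n) y ≈ (D ↑ n) z
  D^-cong zero  y≉0 e = e
  D^-cong (suc n) y≉0 e = D-cong (D^-nonzero n y≉0) (D^-cong n y≉0 e)

  D^-* : ∀ n {y z} → y ≉ 0# → z ≉ 0# → (D ↑ n) (y * z) ≈ (D ↑ n) y * (D ↑ n) z
  D^-* zero  y≉0 z≉0 = refl
  D^-* (suc n) y≉0 z≉0 = trans (D-cong (D^-nonzero n (*-nonzero y≉0 z≉0)) (D^-* n y≉0 z≉0))
    (D-* (D^-nonzero n y≉0) (D^-nonzero n z≉0))

  -- Newton's formula for τ = 1 + D, written multiplicatively, reads y = τᵖ y = y · wᵖ · Dᵖ y.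
  D^p-power : ∀ {y} → y ≉ 0# → ∃ λ u → u ≉ 0# × (D ↑ p) y ≈ u ^ p
  D^p-power {y} y≉0 = w ⁻¹ , ⁻¹-nonzero w≉0 , *-cancel (^-nonzero p w≉0)
    (trans (sym cancelled) (sym (trans (*-comm _ _) (⁻¹-^ p w≉0))))
    where
    step = Newton.p-th-step *-commutativeMonoid (λ j n → (τ.⟦_⟧ ↑ n) ((D ↑ j) y))
      (λ j n → trans (reflexive (≡.sym (↑-suc τ.⟦_⟧ n _))) (trans (↑.⟦⟧-cong n (D-spec (D^-nonzero j y≉0))) (↑.*-homo n _ _))) q pr
    w = proj₁ step
    cancelled : 1# ≈ w ^ p * (D ↑ p) y
    cancelled = *-cancel y≉0 (trans (*-identityʳ y) (trans (sym (order y)) (proj₂ step)))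
    w≉0 : w ≉ 0#
    w≉0 = base-nonzero (factor-nonzeroˡ (nonzero-resp cancelled 1≉0))

  Monomial : Carrier → Set (c ⊔ ℓ)
  Monomial x = ∃ λ i → ∃ λ a → a k.≉ k.0# × x ≈ X ^ i * ι.⟦ a ⟧

  monomial-nonzero : ∀ {x} → Monomial x → x ≉ 0#
  monomial-nonzero (i , a , a≉0 , e) = nonzero-resp (sym e) (*-nonzero (^-nonzero i X≉0) (ι.nonzero a≉0))

  monomial-* : ∀ {x y} → Monomial x → Monomial y → Monomial (x * y)
  monomial-* (i , a , a≉0 , e) (j , b , b≉0 , f) = i ℕ.+ j , a k.* b , k.*-nonzero a≉0 b≉0 ,
    trans (*-cong e f) (trans (interchange _ _ _ _)
      (*-cong (sym (^-homo-* X i j)) (sym (ι.*-homo a b))))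

  -- As τ fixes a, D (Xⁱ a) is the constant ζⁱ. Hence the factors accumulated in `steps` stay
  -- monomials.
  monomial-D : ∀ {x} → Monomial x → Monomial (D x)
  monomial-D {x} x∈@(i , a , a≉0 , e) = 0 , ζ k.^ i , ι.reflect-nonzero (nonzero-resp (sym (ι.^-homo ζ i)) (^-nonzero i U.ζ≉0)) ,
    D-unique (monomial-nonzero x∈) (begin
      τ.⟦ x ⟧  ≈⟨ trans (τ.⟦⟧-cong e) (τ.*-homo _ _) ⟩
      τ.⟦ X ^ i ⟧ * τ.⟦ ι.⟦ a ⟧ ⟧  ≈⟨ *-cong (trans (τ.^-homo X i) (trans (^-congˡ i τ-X) (^-distrib-* Z X i))) (τ-ι a) ⟩
      (Z ^ i * X ^ i) * ι.⟦ a ⟧  ≈⟨ trans (*-assoc _ _ _) (*-comm _ _) ⟩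
      (X ^ i * ι.⟦ a ⟧) * Z ^ i  ≈⟨ *-cong (sym e) (trans (sym (ι.^-homo ζ i)) (sym (*-identityˡ _))) ⟩
      x * (1# * ι.⟦ ζ k.^ i ⟧)  ∎)

  monomial-D^ : ∀ n {x} → Monomial x → Monomial ((D ↑ n) x)
  monomial-D^ zero  x∈ = x∈
  monomial-D^ (suc n) x∈ = monomial-D (monomial-D^ n x∈)

  N-monomial : ∀ i a → N (X ^ i * ι.⟦ a ⟧) ≈ ι.⟦ g k.^ i k.* a k.^ p ⟧
  N-monomial i a = trans (N-* _ _) (trans
    (*-cong (trans (N-^ X i) (trans (^-congˡ i N-X) (sym (ι.^-homo g i)))) (N-ι a)) (sym (ι.*-homo _ _)))

  Rigid : Set (c ⊔ ℓ)
  Rigid = ∀ {z} → z ≉ 0# → InClass g (norm z)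

  -- The multiplication matrix of z witnesses that its product of conjugates is a norm in the sense
  -- of determinants.
  rigid : IsRigidElement p k g → Rigid
  rigid r {z} z≉0 =
    let i , _ , (y , y≉0 , e) , f = r toRootExtension z (det k (multiplicationMatrix z)) z≉0
          (multiplicationMatrix z , (λ j → trans (sym (evaluate-coords _)) (reflexive (∑≡sum _))) , k.refl)
    in toℕ i , y , y≉0 , k.trans (ι.injective (trans (ι-norm z≉0) (sym (det-multiplicationMatrix z)))) (k.trans f (k.*-congˡ e))

  module _ (rig : Rigid) where
    one-step : ∀ {x} → x ≉ 0# → ∃ λ m → ∃ λ w → Monomial m × w ≉ 0# × x ≈ m * D w
    one-step {x} x≉0 = m , w , m∈ , w≉0 , (begin
        x  ≈⟨ trans (*-congˡ (⁻¹-inverseˡ m≉0)) (*-identityʳ x) ⟨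
        x * (m ⁻¹ * m)  ≈⟨ solve 3 (λ x n m → x ⊕ (n ⊕ m) ⊜ m ⊕ (x ⊕ n)) refl x (m ⁻¹) m ⟩
        m * (x * m ⁻¹)  ≈⟨ *-congˡ (D-unique w≉0 τw≈) ⟨
        m * D w  ∎)
      where
      open *-Solver
      cls = rig x≉0
      i = proj₁ cls
      y = proj₁ (proj₂ cls)
      m = X ^ i * ι.⟦ y ⟧
      m∈ : Monomial m
      m∈ = i , y , proj₁ (proj₂ (proj₂ cls)) , refl
      m≉0 = monomial-nonzero m∈
      y′ = x * m ⁻¹
      y′≉0 : y′ ≉ 0#
      y′≉0 = *-nonzero x≉0 (⁻¹-nonzero m≉0)
      Nm≈Nx : N m ≈ N x
      Nm≈Nx = trans (N-monomial i y) (trans (ι.⟦⟧-cong (k.sym (proj₂ (proj₂ (proj₂ cls))))) (ι-norm x≉0))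
      Ny′≈1 : N (y′ ⁻¹) ≈ 1#
      Ny′≈1 = *-cancel (N-nonzero y′≉0) (trans (trans (sym (N-* _ _)) (trans (N-cong (⁻¹-inverseʳ y′≉0)) N-1))
        (sym (trans (*-identityʳ _) (*-cancel (N-nonzero m≉0) (trans (sym (N-* _ _)) (trans (N-cong
          (trans (x∙yz≈y∙xz _ _ _) (trans (*-congˡ (⁻¹-inverseʳ m≉0)) (*-identityʳ x)))) (trans (sym Nm≈Nx) (sym (*-identityʳ _)))))))))
      -- `hilbert90` returns w with argument w / τ w; the inverse of `y′` is passed so that y′ = τ w
      -- / w.
      h90 = hilbert90 Ny′≈1
      w = proj₁ h90
      w≉0 = proj₁ (proj₂ h90)
      τw≈ : τ.⟦ w ⟧ ≈ w * y′
      τw≈ = sym (trans (*-congʳ (sym (proj₂ (proj₂ h90)))) (trans (*-assoc _ _ _)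
        (trans (*-congˡ (⁻¹-inverseˡ y′≉0)) (*-identityʳ _))))

    steps : ∀ n {x} → x ≉ 0# → ∃ λ m → ∃ λ w → Monomial m × w ≉ 0# × x ≈ m * (D ↑ n) w
    steps zero  {x} x≉0 = 1# , x , (0 , k.1# , k.1≉0 , sym (trans (*-identityˡ _) ι.1-homo)) , x≉0 , sym (*-identityˡ x)
    steps (suc n) {x} x≉0 =
      let m , w , m∈ , w≉0 , e = steps n x≉0
          m′ , w′ , m′∈ , w′≉0 , e′ = one-step w≉0
      in m * (D ↑ n) m′ , w′ , monomial-* m∈ (monomial-D^ n m′∈) , w′≉0 ,
         trans e (trans (*-congˡ (trans (D^-cong n w≉0 e′) (trans (D^-* n (monomial-nonzero m′∈) (D-nonzero w′≉0))
           (*-congˡ (reflexive (↑-suc D n w′)))))) (sym (*-assoc _ _ _)))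

    structure : ∀ {x} → x ≉ 0# → ∃ λ m → ∃ λ u → Monomial m × u ≉ 0# × x ≈ m * u ^ p
    structure x≉0 =
      let m , w , m∈ , w≉0 , e = steps p x≉0
          u , u≉0 , f = D^p-power w≉0
      in m , u , m∈ , u≉0 , trans e (*-congˡ f)

-- Change of radicand and the symmetry of norms.

module NormTransfer {c ℓ} (em : ExcludedMiddle (c ⊔ ℓ)) (q : ℕ) (pr : Prime (suc q))
  {k : Field c ℓ} {b b′ : Field.Carrier k}
  (b≉0 : ¬ Field._≈_ k b (Field.0# k)) (b′≉0 : ¬ Field._≈_ k b′ (Field.0# k))
  (ζ : Field.Carrier k) (prim : IsPrimitiveRoot k (suc q) ζ)
  (E : Kummer em q k b) (E′ : Kummer em q k b′) where
  private
    module E = Galois em q pr b≉0 ζ prim E using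
      ( module Extend; module ι; module τ; 0#; N; X; Z; _*_; _≈_; _≉_; conjugation; hom-unique; τ-X
      ; τ-ι )
    module E′ = Galois em q pr b′≉0 ζ prim E′ using
      ( module ι; module τ; *-cong; 0#; N; X; X^p≈g; Z; ^-distrib-*; _*_; _∎; _≈_; _≉_; begin_
      ; conjugation; step-≈-⟨; step-≈-⟩; sym; trans; x∙yz≈y∙xz; ι; τ-X; τ-ι )
    module k = FieldKit em k
    p = suc q

  -- X ↦ e X′ embeds k(ᵖ√b) in k(ᵖ√b′). It respects the two conjugations, as each multiplies its
  -- radical by the same ζ, and therefore carries norms to norms.
  norm-transfer : ∀ {e} → b k.≈ b′ k.* e k.^ p → ∀ {z n} → z E.≉ E.0# → E.N z E.≈ E.ι.⟦ n ⟧ →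
    ∃ λ z′ → z′ E′.≉ E′.0# × E′.N z′ E′.≈ E′.ι.⟦ n ⟧
  norm-transfer {e} b≈b′e^p {z} {n} z≉0 Nz≈n = ψ.⟦ z ⟧ , ψ.nonzero z≉0 ,
    E′.trans (E′.sym (N-image em p Ext.extension E.conjugation E′.conjugation intertwine z))
      (E′.trans (ψ.⟦⟧-cong Nz≈n) (Ext.extension-ι n))
    where
    open E′ using (X; Z)
    module Ext = E.Extend E′.ι (E′.ι.⟦ e ⟧ E′.* X) (E′.trans (E′.^-distrib-* _ X p)
      (E′.trans (E′.*-cong (E′.sym (E′.ι.^-homo e p)) E′.X^p≈g)
      (E′.trans (E′.sym (E′.ι.*-homo _ _)) (E′.ι.⟦⟧-cong (k.trans (k.*-comm _ _) (k.sym b≈b′e^p))))))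
    module ψ = HomKit em Ext.extension
    intertwine : ∀ x → ψ.⟦ E.τ.⟦ x ⟧ ⟧ E′.≈ E′.τ.⟦ ψ.⟦ x ⟧ ⟧
    intertwine = E.hom-unique (Ext.extension ∘ₕ E.conjugation) (E′.conjugation ∘ₕ Ext.extension)
      (λ a → E′.trans (ψ.⟦⟧-cong (E.τ-ι a)) (E′.trans (Ext.extension-ι a)
        (E′.sym (E′.trans (E′.τ.⟦⟧-cong (Ext.extension-ι a)) (E′.τ-ι a)))))
      (begin
        ψ.⟦ E.τ.⟦ E.X ⟧ ⟧  ≈⟨ ψ.⟦⟧-cong E.τ-X ⟩
        ψ.⟦ E.Z E.* E.X ⟧  ≈⟨ ψ.*-homo _ _ ⟩
        ψ.⟦ E.Z ⟧ E′.* ψ.⟦ E.X ⟧  ≈⟨ E′.*-cong (Ext.extension-ι ζ) Ext.extension-X ⟩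
        Z E′.* (E′.ι.⟦ e ⟧ E′.* X)  ≈⟨ E′.x∙yz≈y∙xz _ _ _ ⟩
        E′.ι.⟦ e ⟧ E′.* (Z E′.* X)  ≈⟨ E′.*-cong (E′.τ-ι e) E′.τ-X ⟨
        E′.τ.⟦ E′.ι.⟦ e ⟧ ⟧ E′.* E′.τ.⟦ X ⟧ ≈⟨ E′.τ.*-homo _ _ ⟨
        E′.τ.⟦ E′.ι.⟦ e ⟧ E′.* X ⟧  ≈⟨ E′.τ.⟦⟧-cong Ext.extension-X ⟨
        E′.τ.⟦ ψ.⟦ E.X ⟧ ⟧  ∎)
      where open E′ using (begin_; _∎; step-≈-⟩; step-≈-⟨)

-- If N(z) = g in K = k(ᵖ√b), then Y = zτ satisfies Yᵖ = g, so K is a vector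
-- space over k(ᵖ√g) = k(Y), of dimension one, and multiplication by ᵖ√b is
-- semilinear.  Hence ᵖ√b = u(Y)·1 gives b = N(u).
module Symmetry {c ℓ} (em : ExcludedMiddle (c ⊔ ℓ)) (q : ℕ) (pr : Prime (suc q))
  {k : Field c ℓ} {b g : Field.Carrier k}
  (b≉0 : ¬ Field._≈_ k b (Field.0# k)) (g≉0 : ¬ Field._≈_ k g (Field.0# k))
  (g∉kᵖ : ¬ IsNonzeroPower k (suc q) g)
  (ζ : Field.Carrier k) (prim : IsPrimitiveRoot k (suc q) ζ)
  (E : Kummer em q k b) (E′ : Kummer em q k g) where
  open Galois em q pr b≉0 ζ prim E using
    ( module *-Solver; module U; module ι; module τ; *-assoc; *-cong; *-congʳ; *-congˡ
    ; *-identityʳ; *-identityˡ; +-commutativeMonoid; +-identityˡ; 0#; 1#; 1≉0; Carrier; K; N; X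
    ; X^p≈g; Z; ^-congˡ; _*_; _^_; _∎; _≈_; begin_; coords; coords-+; coords-cong
    ; coords-evaluate; coords-injective; distribˡ; evaluate-coords; order; refl; step-≈-⟨
    ; step-≈-⟩; sym; trans; x∙yz≈y∙xz; zeroˡ; ι; τ-X; τ-ι; ∏; ∏-empty; ∏-suc; ∑-*ˡ; ∑-all-0
    ; ∑-cong )
  private
    module E′ = Galois em q pr g≉0 ζ prim E′ using
      ( module ι; module τ; module ↑; *-comm; *-commutativeMonoid; *-congʳ; *-identityʳ; 0#; Carrier
      ; N; N-cong; X; _*_; _≈_; _≉_; act-*; act-1; coords; coords-cong; coords-evaluate
      ; coords-injective; coords-monomial; coords-τ; nonzero-resp; order; reflexive; sym; trans
      ; zeroˡ; ι; ∏; ∏-cong; ∏-empty; ∏-suc )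
    module k = FieldKit em k
    p = suc q

  module _ (z : Carrier) (Nz≈g : N z ≈ ι.⟦ g ⟧) where
    private
      M = Scalars.semimodule em ι

      Y : LinearMap M M
      Y = record
        { fun  = λ y → z * τ.⟦ y ⟧
        ; cong  = λ e → *-congˡ (τ.⟦⟧-cong e)
        ; +-homo  = λ x y → trans (*-congˡ (τ.+-homo x y)) (distribˡ z _ _)
        ; *ₗ-homo = λ a x → trans (*-congˡ (trans (τ.*-homo _ x) (*-congʳ (τ-ι a)))) (x∙yz≈y∙xz _ _ _)
        }

      open LinearMap Y using () renaming (fun to y)
      open Action em k M Y using (comb; comb-cong; comb-δ; comb-scale)

      y-↑ : ∀ n x → (y ↑ n) x ≈ ∏ {n} (λ l → (τ.⟦_⟧ ↑ toℕ l) z) * (τ.⟦_⟧ ↑ n) x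
      y-↑ zero  x = sym (trans (*-congʳ (∏-empty _)) (*-identityˡ x))
      y-↑ (suc n) x = trans (*-congˡ (trans (τ.⟦⟧-cong (y-↑ n x)) (trans (τ.*-homo _ _) (*-congʳ (τ.∏-homo _)))))
        (trans (sym (*-assoc _ _ _)) (*-congʳ (sym (∏-suc _))))

      Y-p : ∀ x → (y ↑ p) x ≈ ι.⟦ g ⟧ * x
      Y-p x = trans (y-↑ p x) (*-cong Nz≈g (order x))

      module Indep = Independence em p pr k g g≉0 g∉kᵖ M Y Y-p 1# 1≉0

      coords-0 : ∀ i → coords 0# i k.≈ k.0#
      coords-0 i = k.x+x≈x⇒x≈0 _ (k.trans (k.sym (coords-+ 0# 0# i)) (coords-cong (+-identityˡ 0#) i))

      coords-scale : ∀ a x i → coords (ι.⟦ a ⟧ * x) i k.≈ a k.* coords x i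
      coords-scale a x i = k.trans (coords-cong (trans (*-congˡ (sym (evaluate-coords x)))
          (trans (∑-*ˡ _ _) (∑-cong λ i → trans (sym (*-assoc _ _ _)) (*-congʳ (sym (ι.*-homo a _)))))) i)
        (coords-evaluate (λ i → a k.* coords x i) i)

      coords-comb : ∀ (a : Fin p → k.Carrier) x j →
        coords (comb a x) j k.≈ k.∑ λ i → a i k.* coords ((y ↑ toℕ i) x) j
      coords-comb a x j = k.trans
        (⨁-hom (λ x → coords x j) (λ e → coords-cong e j) (coords-0 j) (λ x x′ → coords-+ x x′ j)
          (λ (i : Fin p) → ι.⟦ a i ⟧ * (y ↑ toℕ i) x))
        (k.∑-cong λ i → coords-scale (a i) _ j)
        where open BigOpHom +-commutativeMonoid k.+-commutativeMonoid

      act : E′.Carrier → Carrier → Carrier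
      act w = comb (E′.coords w)

      -- The p elements Yⁱ 1 are independent in a space of dimension p, hence X is a combination of
      -- them.
      root : ∃ λ (a : Fin p → k.Carrier) → comb a 1# ≈ X
      root =
        let a , e = Dimension.surjective em k p (λ i → coords ((y ↑ toℕ i) 1#))
              (λ a vanish → Indep.comb-injective a (λ _ → k.0#) (trans
                (coords-injective λ j → k.trans (coords-comb a 1# j) (k.trans (vanish j) (k.sym (coords-0 j))))
                (sym (∑-all-0 λ i → trans (*-congʳ ι.0-homo) (zeroˡ _)))))
              (coords X)
        in a , coords-injective λ j → k.trans (coords-comb a 1# j) (e j)

      u : E′.Carrier
      u = Scalars.evaluate em E′.ι E′.X (proj₁ root)

      act-u : act u 1# ≈ X
      act-u = trans (comb-cong (E′.coords-evaluate (proj₁ root)) refl) (proj₂ root)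

      act-injective : ∀ {v w} → act v 1# ≈ act w 1# → v E′.≈ w
      act-injective e = E′.coords-injective (Indep.comb-injective _ _ e)

      y-X : ∀ n x → (y ↑ n) (X * x) ≈ Z ^ n * (X * (y ↑ n) x)
      y-X zero  x = sym (*-identityˡ _)
      y-X (suc n) x = begin
        z * τ.⟦ (y ↑ n) (X * x) ⟧  ≈⟨ *-congˡ (τ.⟦⟧-cong (y-X n x)) ⟩
        z * τ.⟦ Z ^ n * (X * (y ↑ n) x) ⟧  ≈⟨ *-congˡ (trans (τ.*-homo _ _) (*-cong (trans (τ.^-homo Z n) (^-congˡ n (τ-ι ζ)))
                                                      (trans (τ.*-homo _ _) (*-congʳ τ-X)))) ⟩
        z * (Z ^ n * ((Z * X) * τ.⟦ (y ↑ n) x ⟧))  ≈⟨ solve 5 (λ z a b x t → z ⊕ (a ⊕ ((b ⊕ x) ⊕ t)) ⊜ (b ⊕ a) ⊕ (x ⊕ (z ⊕ t))) refl _ _ _ _ _ ⟩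
        Z ^ suc n * (X * y ((y ↑ n) x))  ∎
        where open *-Solver

      -- By Y X = ζ X Y, moving X out of w(Y) applies the conjugation of k(ᵖ√g) to w.
      act-X : ∀ w x → act w (X * x) ≈ X * act E′.τ.⟦ w ⟧ x
      act-X w x = trans (∑-cong λ (i : Fin p) → begin
          ι.⟦ E′.coords w i ⟧ * (y ↑ toℕ i) (X * x)
            ≈⟨ *-congˡ (y-X (toℕ i) x) ⟩
          ι.⟦ E′.coords w i ⟧ * (Z ^ toℕ i * (X * (y ↑ toℕ i) x))
            ≈⟨ solve 4 (λ a z x y → a ⊕ (z ⊕ (x ⊕ y)) ⊜ x ⊕ ((z ⊕ a) ⊕ y)) refl _ _ _ _ ⟩
          X * ((Z ^ toℕ i * ι.⟦ E′.coords w i ⟧) * (y ↑ toℕ i) x)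
            ≈⟨ *-congˡ (*-congʳ (trans (*-congʳ (sym (ι.^-homo ζ (toℕ i)))) (trans (sym (ι.*-homo _ _)) (ι.⟦⟧-cong (k.sym (E′.coords-τ w i)))))) ⟩
          X * (ι.⟦ E′.coords E′.τ.⟦ w ⟧ i ⟧ * (y ↑ toℕ i) x) ∎) (sym (∑-*ˡ X _))
        where open *-Solver

      -- Each further factor X undergoes the conjugation of `act-X`, which τ^q = τ⁻¹ undoes; so
      -- `V n` takes 1 to Xⁿ. `V p` is N(u) with the conjugates in another order.
      V : ℕ → E′.Carrier
      V n = E′.∏ {n} λ i → (E′.τ.⟦_⟧ ↑ (toℕ i ℕ.* q)) u

      V-suc : ∀ n → V (suc n) E′.≈ (E′.τ.⟦_⟧ ↑ q) (V n) E′.* u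
      V-suc n = E′.trans (E′.∏-suc _) (E′.trans (E′.*-comm _ _) (E′.*-congʳ (E′.trans
        (E′.∏-cong λ i → E′.reflexive (↑-+ E′.τ.⟦_⟧ q (toℕ i ℕ.* q) u)) (E′.sym (E′.↑.∏-homo q _)))))

      act-V : ∀ n → act (V n) 1# ≈ X ^ n
      act-V zero  = trans (comb-cong (E′.coords-cong (E′.∏-empty _)) refl) (E′.act-1 M Y 1#)
      act-V (suc n) = begin
        act (V (suc n)) 1#  ≈⟨ comb-cong (E′.coords-cong (V-suc n)) refl ⟩
        act ((E′.τ.⟦_⟧ ↑ q) (V n) E′.* u) 1#  ≈⟨ E′.act-* M Y Y-p _ u 1# ⟩
        act ((E′.τ.⟦_⟧ ↑ q) (V n)) (act u 1#)  ≈⟨ comb-cong (λ _ → k.refl) (trans act-u (sym (*-identityʳ X))) ⟩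
        act ((E′.τ.⟦_⟧ ↑ q) (V n)) (X * 1#)  ≈⟨ act-X _ 1# ⟩
        X * act ((E′.τ.⟦_⟧ ↑ p) (V n)) 1#  ≈⟨ *-congˡ (trans (comb-cong (E′.coords-cong (E′.order (V n))) refl) (act-V n)) ⟩
        X ^ suc n  ∎

      act-ι : ∀ a → act E′.ι.⟦ a ⟧ 1# ≈ ι.⟦ a ⟧
      act-ι a = trans (comb-cong (λ i → k.trans (E′.coords-cong (E′.sym (E′.*-identityʳ _)) i) (E′.coords-monomial a zero i)) refl)
        (trans (comb-scale a (Kronecker.δ em k {p} zero) 1#) (trans (*-congˡ (comb-δ {p} zero 1#)) (*-identityʳ _)))

      periodic : ∀ n → (E′.τ.⟦_⟧ ↑ (p ℕ.+ n)) u E′.≈ (E′.τ.⟦_⟧ ↑ n) u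
      periodic n = E′.trans (E′.reflexive (↑-+ E′.τ.⟦_⟧ p n u)) (E′.order _)

    norm-symmetric : ∃ λ u → u E′.≉ E′.0# × E′.N u E′.≈ E′.ι.⟦ b ⟧
    norm-symmetric = u , u≉0 , Nu≈b
      where
      Nu≈b : E′.N u E′.≈ E′.ι.⟦ b ⟧
      Nu≈b = E′.trans
        (E′.sym (Residues.⨁-multiples q pr E′.*-commutativeMonoid (λ n → (E′.τ.⟦_⟧ ↑ n) u) periodic q (ℕ.s≤s⁻¹ U.1<p) ℕ.≤-refl))
        (act-injective (trans (act-V p) (trans X^p≈g (sym (act-ι b)))))
      u≉0 : u E′.≉ E′.0#
      u≉0 u≈0 = E′.nonzero-resp (E′.sym Nu≈b) (E′.ι.nonzero b≉0)
        (E′.trans (E′.N-cong u≈0) (E′.trans (E′.∏-suc _) (E′.zeroˡ _)))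

-- Subfields and norms in a bicyclic extension.

module CoprimePowers {c ℓ} (em : ExcludedMiddle (c ⊔ ℓ)) (q : ℕ) (pr : Prime (suc q)) (k : Field c ℓ) where
  open Classes em q pr k public
  open Powers em (suc q) pr k
  private p = suc q

  root-of-power : ∀ {g x y} s → ¬ (p ∣ s) → g ≉ 0# → x ≉ 0# → y ≉ 0# → g ^ s * x ^ p ≈ y ^ p → IsPower g
  root-of-power {g} {x} {y} s p∤s g≉0 x≉0 y≉0 e =
    root-of-coprime-power (s % p) (ℕ.n≢0⇒n>0 λ s%p≡0 → p∤s (m%n≡0⇒n∣m s p s%p≡0)) (m%n<n s p) g≉0
      (proj₂ (proj₂ (quotient-power (*-nonzero (^-nonzero (s / p) g≉0) x≉0) y≉0 (begin
        g ^ (s % p) * (g ^ (s / p) * x) ^ p  ≈⟨ *-congˡ (^-distrib-* _ x p) ⟩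
        g ^ (s % p) * ((g ^ (s / p)) ^ p * x ^ p)  ≈⟨ *-assoc _ _ _ ⟨
        g ^ (s % p) * (g ^ (s / p)) ^ p * x ^ p  ≈⟨ *-congʳ (trans (*-congˡ (^-assocʳ g (s / p) p)) (sym (^-homo-* g (s % p) _))) ⟩
        g ^ (s % p ℕ.+ s / p ℕ.* p) * x ^ p  ≈⟨ *-congʳ (^-congʳ g (≡.sym (m≡m%n+[m/n]*n s p))) ⟩
        g ^ s * x ^ p  ≈⟨ e ⟩
        y ^ p  ∎))))

-- Given F ⊂ L with automorphisms τ, ρ of L whose common fixed field is F and
-- γᵖ = c in F, the subfield F(γ) of L is the fixed field of ρ.
module Subfield {c ℓ} (em : ExcludedMiddle (c ⊔ ℓ)) (q : ℕ) (pr : Prime (suc q))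
  {F : Field c ℓ} {d : Field.Carrier F} (d≉0 : ¬ Field._≈_ F d (Field.0# F))
  (ζ : Field.Carrier F) (prim : IsPrimitiveRoot F (suc q) ζ) (C : Kummer em q F d)
  {L : Field c ℓ} (j : FieldHom F L) (τ ρ : FieldHom L L) where
  private
    module C = Galois em q pr d≉0 ζ prim C using
      ( module Extend; module ι; module τ; *-assoc; *-congʳ; *-identityˡ; 0#; K; X; _*_; _^_; _⁻¹
      ; _≉_; conjugation; hom-unique; norm; sym; trans; ι-norm; τ-X; τ-ι; ⁻¹-inverseʳ; ∑ )
    module j = HomKit em j
    module τ = HomKit em τ
    module ρ = HomKit em ρ
    module F = FieldKit em F
    p = suc q
    Z = j.⟦ ζ ⟧
  open Powers em p pr L
  private
    module U = Unity em q pr L Z (prim-image em j prim)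
    module N = Norm em p τ

  module Embedding (γ : Carrier) (γ^p≈d : γ ^ p ≈ j.⟦ d ⟧)
    (τ-j : ∀ a → τ.⟦ j.⟦ a ⟧ ⟧ ≈ j.⟦ a ⟧) (ρ-j : ∀ a → ρ.⟦ j.⟦ a ⟧ ⟧ ≈ j.⟦ a ⟧)
    (τ-γ : τ.⟦ γ ⟧ ≈ Z * γ) (ρ-γ : ρ.⟦ γ ⟧ ≈ γ) (commute : ∀ x → ρ.⟦ τ.⟦ x ⟧ ⟧ ≈ τ.⟦ ρ.⟦ x ⟧ ⟧)
    (order : ∀ x → (τ.⟦_⟧ ↑ p) x ≈ x)
    (fixed : ∀ {x} → τ.⟦ x ⟧ ≈ x → ρ.⟦ x ⟧ ≈ x → ∃ λ a → j.⟦ a ⟧ ≈ x) where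
    private module Ext = C.Extend j γ γ^p≈d

    embed : FieldHom C.K L
    embed = Ext.extension

    private module ev = HomKit em embed

    embed-ι : ∀ a → ev.⟦ C.ι.⟦ a ⟧ ⟧ ≈ j.⟦ a ⟧
    embed-ι = Ext.extension-ι

    embed-τ : ∀ x → ev.⟦ C.τ.⟦ x ⟧ ⟧ ≈ τ.⟦ ev.⟦ x ⟧ ⟧
    embed-τ = C.hom-unique (embed ∘ₕ C.conjugation) (τ ∘ₕ embed)
      (λ a → trans (ev.⟦⟧-cong (C.τ-ι a)) (trans (embed-ι a) (sym (trans (τ.⟦⟧-cong (embed-ι a)) (τ-j a)))))
      (trans (ev.⟦⟧-cong C.τ-X) (trans (ev.*-homo _ _) (trans (*-cong (embed-ι ζ) Ext.extension-X)
        (sym (trans (τ.⟦⟧-cong Ext.extension-X) τ-γ)))))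

    embed-N : ∀ {w} → w C.≉ C.0# → N.N ev.⟦ w ⟧ ≈ j.⟦ C.norm w ⟧
    embed-N {w} w≉0 = trans (sym (N-image em p embed C.conjugation τ embed-τ w))
      (trans (ev.⟦⟧-cong (C.sym (C.ι-norm w≉0))) (embed-ι _))

    private
      Image : Carrier → Set (c ⊔ ℓ)
      Image x = ∃ λ w → ev.⟦ w ⟧ ≈ x

      image-j : ∀ {x} → ∃ (λ a → j.⟦ a ⟧ ≈ x) → Image x
      image-j (a , e) = C.ι.⟦ a ⟧ , trans (embed-ι a) e

      image-∑ : ∀ {n} {f : Fin n → Carrier} → (∀ i → Image (f i)) → Image (∑ f)
      image-∑ f∈ = C.∑ (proj₁ ∘ f∈) , trans (ev.∑-homo _) (∑-cong (proj₂ ∘ f∈))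

      image-quotient : ∀ {x y} → y ≉ 0# → Image y → Image (y * x) → Image x
      image-quotient {x} {y} y≉0 (v , e) (w , f) = v C.⁻¹ C.* w , *-cancel y≉0 (begin
        y * ev.⟦ v C.⁻¹ C.* w ⟧  ≈⟨ *-congʳ e ⟨
        ev.⟦ v ⟧ * ev.⟦ v C.⁻¹ C.* w ⟧  ≈⟨ ev.*-homo _ _ ⟨
        ev.⟦ v C.* (v C.⁻¹ C.* w) ⟧  ≈⟨ ev.⟦⟧-cong (C.trans (C.sym (C.*-assoc _ _ _)) (C.trans (C.*-congʳ (C.⁻¹-inverseʳ v≉0)) (C.*-identityˡ w))) ⟩
        ev.⟦ w ⟧  ≈⟨ f ⟩
        y * x  ∎)
        where v≉0 = ev.reflect-nonzero (nonzero-resp (sym e) y≉0)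

    -- p x is the sum of the resolvents Rₜ = Σ ζⁱᵗ τⁱ x. Each γᵗ Rₜ is fixed by τ and ρ, hence lies
    -- in F, so Rₜ lies in F(γ).
    fixed⇒image : ∀ {x} → ρ.⟦ x ⟧ ≈ x → ∃ λ w → ev.⟦ w ⟧ ≈ x
    fixed⇒image {x} ρx≈x = image-quotient U.p̂≉0 (image-j (fixed (fixed-∑ τ τ-1) (fixed-∑ ρ ρ-1)))
      (let w , e = image-∑ (λ (t : Fin p) → image-resolvent (toℕ t)) in w , trans e (U.∑-orthogonal (λ i → (τ.⟦_⟧ ↑ toℕ i) x)))
      where
      τ-1 = τ.1-homo
      ρ-1 = ρ.1-homo
      fixed-∑ : (h : FieldHom L L) → FieldHom.⟦_⟧ h 1# ≈ 1# → FieldHom.⟦_⟧ h U.p̂ ≈ U.p̂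
      fixed-∑ h h1 = trans (HomKit.∑-homo em h _) (∑-cong λ _ → h1)
      resolvent : ℕ → Carrier
      resolvent t = ∑ {p} λ i → (Z ^ toℕ i) ^ t * (τ.⟦_⟧ ↑ toℕ i) x
      γ≉0 : γ ≉ 0#
      γ≉0 = base-nonzero (nonzero-resp (sym γ^p≈d) (j.nonzero d≉0))
      τ-resolvent : ∀ t → Z ^ t * τ.⟦ resolvent t ⟧ ≈ resolvent t
      τ-resolvent t = begin
        Z ^ t * τ.⟦ resolvent t ⟧
          ≈⟨ trans (*-congˡ (τ.∑-homo _)) (∑-*ˡ _ _) ⟩
        ∑ {p} (λ i → Z ^ t * τ.⟦ (Z ^ toℕ i) ^ t * (τ.⟦_⟧ ↑ toℕ i) x ⟧)
          ≈⟨ ∑-cong {p} (λ i → trans (*-congˡ (trans (τ.*-homo _ _) (*-congʳ (trans (τ.^-homo _ t) (^-congˡ t (trans (τ.^-homo Z (toℕ i)) (^-congˡ (toℕ i) (τ-j ζ))))))))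
               (trans (sym (*-assoc _ _ _)) (*-congʳ (sym (^-distrib-* Z _ t))))) ⟩
        ∑ {p} (λ i → h (suc (toℕ i)))
          ≈⟨ +-cancelˡ (h 0) _ _ (trans (sym (∑-shift p h)) (trans (+-congˡ last) (+-comm _ _))) ⟩
        resolvent t ∎
        where
        h : ℕ → Carrier
        h i = (Z ^ i) ^ t * (τ.⟦_⟧ ↑ i) x
        last : h p ≈ h 0
        last = *-cong (^-congˡ t U.ζ^p≈1) (order x)
      ρ-resolvent : ∀ t → ρ.⟦ resolvent t ⟧ ≈ resolvent t
      ρ-resolvent t = trans (ρ.∑-homo _) (∑-cong {p} λ i → trans (ρ.*-homo _ _)
        (*-cong (trans (ρ.^-homo _ t) (^-congˡ t (trans (ρ.^-homo Z (toℕ i)) (^-congˡ (toℕ i) (ρ-j ζ)))))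
          (trans (N.↑-intertwine ρ τ commute (toℕ i) x) (N.↑.⟦⟧-cong (toℕ i) ρx≈x))))
      image-resolvent : ∀ t → Image (resolvent t)
      image-resolvent t = image-quotient (^-nonzero t γ≉0)
        (C.X C.^ t , trans (ev.^-homo C.X t) (^-congˡ t Ext.extension-X))
        (image-j (fixed
          (trans (τ.*-homo _ _) (trans (*-congʳ (trans (τ.^-homo γ t) (trans (^-congˡ t τ-γ) (^-distrib-* Z γ t))))
            (trans (solve 3 (λ z y r → (z ⊕ y) ⊕ r ⊜ y ⊕ (z ⊕ r)) refl _ _ _) (*-congˡ (τ-resolvent t)))))
          (trans (ρ.*-homo _ _) (*-cong (trans (ρ.^-homo γ t) (^-congˡ t ρ-γ)) (ρ-resolvent t)))))
        where open *-Solver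

module Tower {c ℓ} (em : ExcludedMiddle (c ⊔ ℓ)) (q : ℕ) (pr : Prime (suc q)) (odd : ¬ (2 ∣ suc q))
  {F : Field c ℓ} (ζ : Field.Carrier F) (prim : IsPrimitiveRoot F (suc q) ζ) (rigid-F : IsRigid (suc q) F)
  {a : Field.Carrier F} (a≉0 : ¬ Field._≈_ F a (Field.0# F)) (KE : Kummer em q F a)
  {f : Field.Carrier F} (f≉0 : ¬ Field._≈_ F f (Field.0# F))
  (f∉Eᵖ : ¬ IsNonzeroPower (Kummer.K KE) (suc q) (FieldHom.⟦_⟧ (Kummer.ι KE) f))
  (KL : Kummer em q (Kummer.K KE) (FieldHom.⟦_⟧ (Kummer.ι KE) f)) where
  private
    module E = Hilbert em q pr odd a≉0 ζ prim KE using
      ( module ι; module τ; *-assoc; *-cong; *-congʳ; *-congˡ; *-nonzero; 0#; Carrier; K; N; X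
      ; X^p≈g; X≉0; Z; ^-^-comm; ^-congˡ; ^-distrib-*; ^-nonzero; _*_; _^_; _≈_; _≉_; conjugation
      ; fixed⇒base; order; quotient-power; sym; trans; ι; τ-X; τ-ι; ∏ )
    module F = CoprimePowers em q pr F
    module FK = Powers em (suc q) pr F
    module EC = CoprimePowers em q pr E.K
    p = suc q
    fᴱ = E.ι.⟦ f ⟧

  open Hilbert em q pr odd (E.ι.nonzero f≉0) E.Z (prim-image em E.ι prim) KL using
    ( module *-Solver; module Extend; module U; module ι; module τ; module ↑; *-assoc; *-cancel
    ; *-comm; *-commutativeMonoid; *-cong; *-congʳ; *-congˡ; *-identityʳ; *-identityˡ; *-nonzero; interchange
    ; 0#; 1#; Carrier; K; N; N-*; N-X; N-^; N-cong; N-conjugate-↑; N-ι; N-∏; X; X^p≈g; X≉0; Z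
    ; ^-assocʳ; ^-congʳ; ^-congˡ; ^-distrib-*; ^-homo-*; ^-nonzero; ^-∏; _*_; _+_; _^_; _⁻¹; _∎
    ; _≈_; _≉_; begin_; conjugation; fixed⇒base; hom-unique; nonzero-resp; norm; order; refl
    ; reflexive; step-≈-⟨; step-≈-⟩; sym; trans; ι; τ-X; τ-ι; τ^n-X; ⁻¹-^; ⁻¹-inverseˡ
    ; ⁻¹-nonzero; ↑-fixed; ↑-hom; ↑-intertwine; ∏; ∏-*; ∏-comm; ∏-cong; ∏-const; ∏-nonzero
    ; ∏-suc )

  j : FieldHom F K
  j = ι ∘ₕ E.ι

  private
    module j = HomKit em j
    open Kummer KL using () renaming (ι to ι-hom)

    α φ : Carrier
    α = ι.⟦ E.X ⟧
    φ = X

    module Ext = Extend (ι-hom ∘ₕ E.conjugation) φ (trans X^p≈g (ι.⟦⟧-cong (E.sym (E.τ-ι f))))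

  -- Extends the conjugation of E/F to L by fixing ᵖ√f; the elements fixed by both it and the
  -- conjugation of L/E are those of F.
  σ-hom : FieldHom K K
  σ-hom = Ext.extension

  module σ = HomKit em σ-hom
  module Nσ = Norm em p σ-hom

  σ-ι : ∀ x → σ.⟦ ι.⟦ x ⟧ ⟧ ≈ ι.⟦ E.τ.⟦ x ⟧ ⟧
  σ-ι = Ext.extension-ι

  Nσ-ι : ∀ x → Nσ.N ι.⟦ x ⟧ ≈ ι.⟦ E.N x ⟧
  Nσ-ι x = sym (N-image em p ι-hom E.conjugation σ-hom (λ x → sym (σ-ι x)) x)

  private
    σ-φ : σ.⟦ φ ⟧ ≈ φ
    σ-φ = Ext.extension-X

    σ-j : ∀ x → σ.⟦ j.⟦ x ⟧ ⟧ ≈ j.⟦ x ⟧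
    σ-j x = trans (σ-ι _) (ι.⟦⟧-cong (E.τ-ι x))

    τ-j : ∀ x → τ.⟦ j.⟦ x ⟧ ⟧ ≈ j.⟦ x ⟧
    τ-j x = τ-ι _

    σ-α : σ.⟦ α ⟧ ≈ Z * α
    σ-α = trans (σ-ι E.X) (trans (ι.⟦⟧-cong E.τ-X) (ι.*-homo _ _))

    α≉0 : α ≉ 0#
    α≉0 = ι.nonzero E.X≉0

    commute : ∀ x → σ.⟦ τ.⟦ x ⟧ ⟧ ≈ τ.⟦ σ.⟦ x ⟧ ⟧
    commute = hom-unique (σ-hom ∘ₕ conjugation) (conjugation ∘ₕ σ-hom)
      (λ x → trans (σ.⟦⟧-cong (τ-ι x)) (trans (σ-ι x) (sym (trans (τ.⟦⟧-cong (σ-ι x)) (τ-ι _)))))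
      (trans (σ.⟦⟧-cong τ-X) (trans (σ.*-homo _ _) (trans (*-cong (σ-j ζ) σ-φ)
        (sym (trans (τ.⟦⟧-cong σ-φ) τ-X)))))

    σ-order : ∀ x → (σ.⟦_⟧ ↑ p) x ≈ x
    σ-order = hom-unique (Nσ.↑-hom p) (idHom K)
      (λ x → trans (sym (Nσ.↑-intertwine ι-hom E.conjugation (λ x → sym (σ-ι x)) p x)) (ι.⟦⟧-cong (E.order x)))
      (Nσ.↑-fixed p σ-φ)

    fixed : ∀ {x} → τ.⟦ x ⟧ ≈ x → σ.⟦ x ⟧ ≈ x → ∃ λ y → j.⟦ y ⟧ ≈ x
    fixed {x} τx≈x σx≈x = _ , trans (ι.⟦⟧-cong (E.fixed⇒base (ι.injective
      (trans (sym (σ-ι _)) (trans (σ.⟦⟧-cong y≈x) (trans σx≈x (sym y≈x))))))) y≈x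
      where y≈x = fixed⇒base τx≈x

  norms-commute : ∀ z → N (Nσ.N z) ≈ Nσ.N (N z)
  norms-commute z = trans (N-∏ _) (∏-cong λ i → sym (N-image em p (Nσ.↑-hom (toℕ i)) conjugation conjugation
    (λ x → sym (↑τ (toℕ i) x)) z))
    where
    ↑τ : ∀ i x → τ.⟦ (σ.⟦_⟧ ↑ i) x ⟧ ≈ (σ.⟦_⟧ ↑ i) τ.⟦ x ⟧
    ↑τ i x = Nσ.↑-intertwine conjugation σ-hom (λ x → sym (commute x)) i x

  -- Transitivity of the norm in L/F(ᵖ√f)/F and in L/E/F.
  double-norm : ∀ {z} → z ≉ 0# → ∃ λ m → F.InClass f m × Nσ.N (N z) ≈ j.⟦ m ⟧
  double-norm {z} z≉0 = C.norm w , C.rigid (rigid-F f f≉0 f∉Fᵖ) w≉0 ,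
      trans (sym (norms-commute z)) (trans (N-cong (sym ev-w)) (S.embed-N w≉0))
    where
    f∉Fᵖ : ¬ IsNonzeroPower F p f
    f∉Fᵖ (y , y≉0 , e) = f∉Eᵖ (E.ι.⟦ y ⟧ , E.ι.nonzero y≉0 , E.trans (E.ι.⟦⟧-cong e) (E.ι.^-homo y p))
    KC = adjoin em q pr F f f≉0 f∉Fᵖ
    module C = Hilbert em q pr odd f≉0 ζ prim KC using
      ( 0#; _≉_; norm; rigid )
    module S = Subfield.Embedding em q pr f≉0 ζ prim KC j conjugation σ-hom
      φ X^p≈g τ-j σ-j τ-X σ-φ commute order fixed
    pre = S.fixed⇒image (Nσ.fixes-N σ-order z≉0)
    w = proj₁ pre
    ev-w = proj₂ pre
    w≉0 : w C.≉ C.0#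
    w≉0 = HomKit.reflect-nonzero em S.embed
      (nonzero-resp (sym ev-w) (Nσ.N-nonzero z≉0))

  module _ {z : Carrier} (z≉0 : z ≉ 0#) {h : FK.Carrier} (h≉0 : h FK.≉ FK.0#)
    (double : Nσ.N (N z) ≈ j.⟦ h ⟧ ^ p) where
    private
      ρ : ℕ → FieldHom K K
      ρ i = σ-hom ∘ₕ ↑-hom i

      module Nρ i = Norm em p (ρ i)

      σ-τ^ : ∀ i x → σ.⟦ (τ.⟦_⟧ ↑ i) x ⟧ ≈ (τ.⟦_⟧ ↑ i) σ.⟦ x ⟧
      σ-τ^ i x = ↑-intertwine σ-hom conjugation commute i x

      σ^-τ^ : ∀ m n x → (σ.⟦_⟧ ↑ m) ((τ.⟦_⟧ ↑ n) x) ≈ (τ.⟦_⟧ ↑ n) ((σ.⟦_⟧ ↑ m) x)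
      σ^-τ^ zero  n x = refl
      σ^-τ^ (suc m) n x = trans (σ.⟦⟧-cong (σ^-τ^ m n x)) (σ-τ^ n _)

      ρ-↑ : ∀ i n x → (FieldHom.⟦_⟧ (ρ i) ↑ n) x ≈ (σ.⟦_⟧ ↑ n) ((τ.⟦_⟧ ↑ (n ℕ.* i)) x)
      ρ-↑ i zero  x = refl
      ρ-↑ i (suc n) x = σ.⟦⟧-cong (trans (↑.⟦⟧-cong i (ρ-↑ i n x)) (trans (sym (σ^-τ^ n i _))
        (Nσ.↑.⟦⟧-cong n (reflexive (≡.sym (↑-+ τ.⟦_⟧ i (n ℕ.* i) x))))))

      τ^-periodic : ∀ x n → (τ.⟦_⟧ ↑ (p ℕ.+ n)) x ≈ (τ.⟦_⟧ ↑ n) x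
      τ^-periodic x n = trans (reflexive (↑-+ τ.⟦_⟧ p n x)) (order _)

      τ^-multiple : ∀ x m → (τ.⟦_⟧ ↑ (p ℕ.* m)) x ≈ x
      τ^-multiple x m = trans (reflexive (≡.cong (λ n → (τ.⟦_⟧ ↑ n) x) (ℕ.*-comm p m))) (go m)
        where
        go : ∀ m → (τ.⟦_⟧ ↑ (m ℕ.* p)) x ≈ x
        go zero  = refl
        go (suc m) = trans (τ^-periodic x (m ℕ.* p)) (go m)

      ρ-order : ∀ i x → (FieldHom.⟦_⟧ (ρ i) ↑ p) x ≈ x
      ρ-order i x = trans (ρ-↑ i p x) (trans (σ-order _) (τ^-multiple x i))

      -- Norms from L to its p + 1 intermediate fields of degree p over F.
      product-of-norms : ∏ (λ (i : Fin p) → Nρ.N (toℕ i) z) * N z ≈ z ^ p * Nσ.N (N z)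
      product-of-norms = begin
        ∏ (λ (i : Fin p) → Nρ.N (toℕ i) z) * N z
          ≈⟨ *-congʳ (∏-cong λ (i : Fin p) → ∏-cong λ (n : Fin p) → ρ-↑ (toℕ i) (toℕ n) z) ⟩
        ∏ (λ (i : Fin p) → ∏ λ (n : Fin p) → (σ.⟦_⟧ ↑ toℕ n) ((τ.⟦_⟧ ↑ (toℕ n ℕ.* toℕ i)) z)) * N z
          ≈⟨ *-congʳ (trans (∏-comm _) (∏-suc _)) ⟩
        (∏ {p} (λ i → z) * ∏ (λ (n : Fin q) → ∏ λ (i : Fin p) → (σ.⟦_⟧ ↑ suc (toℕ n)) ((τ.⟦_⟧ ↑ (suc (toℕ n) ℕ.* toℕ i)) z))) * N z
          ≈⟨ *-congʳ (*-cong (∏-const p z) (∏-cong column)) ⟩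
        (z ^ p * ∏ (λ (n : Fin q) → (σ.⟦_⟧ ↑ suc (toℕ n)) (N z))) * N z
          ≈⟨ trans (*-assoc _ _ _) (*-congˡ (*-comm _ _)) ⟩
        z ^ p * (N z * ∏ (λ (n : Fin q) → (σ.⟦_⟧ ↑ suc (toℕ n)) (N z)))
          ≈⟨ *-congˡ (∏-suc _) ⟨
        z ^ p * Nσ.N (N z) ∎
        where
        -- The factor n = 0 has been split off as zᵖ. For the others, multiplication by n + 1
        -- permutes the exponents of τ, so the product over i is a conjugate of N z.
        column : ∀ n → ∏ (λ (i : Fin p) → (σ.⟦_⟧ ↑ suc (toℕ n)) ((τ.⟦_⟧ ↑ (suc (toℕ n) ℕ.* toℕ i)) z)) ≈ (σ.⟦_⟧ ↑ suc (toℕ n)) (N z)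
        column n = trans (sym (Nσ.↑.∏-homo (suc (toℕ n)) _)) (Nσ.↑.⟦⟧-cong (suc (toℕ n)) (trans
          (∏-cong λ i → reflexive (≡.cong (λ m → (τ.⟦_⟧ ↑ m) z) (ℕ.*-comm (suc (toℕ n)) (toℕ i))))
          (Residues.⨁-multiples q pr *-commutativeMonoid (λ n → (τ.⟦_⟧ ↑ n) z) (τ^-periodic z) (suc (toℕ n)) (ℕ.s≤s ℕ.z≤n) (ℕ.s≤s (toℕ<n n)))))

      -- The field fixed by ρ i is F(φᵢ) with φᵢ = φ α^(q i).
      module Intermediate (i : ℕ) where
        d : FK.Carrier
        d = f FK.* a FK.^ (q ℕ.* i)

        -- The exponent q i stands for -i: σ τⁱ multiplies φ by ζⁱ and α by ζ, so φ α⁻ⁱ is fixed.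
        γ : Carrier
        γ = φ * α ^ (q ℕ.* i)

        d≉0 : d FK.≉ FK.0#
        d≉0 = FK.*-nonzero f≉0 (FK.^-nonzero (q ℕ.* i) a≉0)

        E-d : E.ι.⟦ d ⟧ E.≈ fᴱ E.* (E.X E.^ (q ℕ.* i)) E.^ p
        E-d = E.trans (E.ι.*-homo _ _) (E.*-congˡ (E.trans (E.ι.^-homo a (q ℕ.* i))
          (E.trans (E.^-congˡ (q ℕ.* i) (E.sym E.X^p≈g)) (E.^-^-comm E.X p (q ℕ.* i)))))

        X^qi≉0 : E.X E.^ (q ℕ.* i) E.≉ E.0#
        X^qi≉0 = E.^-nonzero (q ℕ.* i) E.X≉0

        d∉Fᵖ : ¬ IsNonzeroPower F p d
        d∉Fᵖ (y , y≉0 , e) = f∉Eᵖ (E.quotient-power X^qi≉0 (E.ι.nonzero y≉0)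
          (E.trans (E.sym E-d) (E.trans (E.ι.⟦⟧-cong e) (E.ι.^-homo y p))))

        γ^p≈d : γ ^ p ≈ j.⟦ d ⟧
        γ^p≈d = trans (^-distrib-* _ _ p) (trans (*-cong X^p≈g (sym (trans (ι.^-homo _ p) (^-congˡ p (ι.^-homo E.X (q ℕ.* i))))))
          (trans (sym (ι.*-homo _ _)) (ι.⟦⟧-cong (E.sym E-d))))

        τ-γ : τ.⟦ γ ⟧ ≈ Z * γ
        τ-γ = trans (τ.*-homo _ _) (trans (*-cong τ-X (trans (τ.^-homo α (q ℕ.* i)) (^-congˡ (q ℕ.* i) (τ-ι E.X)))) (*-assoc _ _ _))

        ρ-j : ∀ x → FieldHom.⟦_⟧ (ρ i) j.⟦ x ⟧ ≈ j.⟦ x ⟧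
        ρ-j x = trans (σ.⟦⟧-cong (↑-fixed i (τ-j x))) (σ-j x)

        ρ-γ : FieldHom.⟦_⟧ (ρ i) γ ≈ γ
        ρ-γ = begin
          σ.⟦ (τ.⟦_⟧ ↑ i) γ ⟧
            ≈⟨ σ.⟦⟧-cong (trans (↑.*-homo i _ _) (*-cong (τ^n-X i) (trans (↑.^-homo i α (q ℕ.* i)) (^-congˡ (q ℕ.* i) (↑-fixed i (τ-ι E.X)))))) ⟩
          σ.⟦ (Z ^ i * φ) * α ^ (q ℕ.* i) ⟧
            ≈⟨ trans (σ.*-homo _ _) (*-cong (trans (σ.*-homo _ _) (*-cong (trans (σ.^-homo Z i) (^-congˡ i (σ-j ζ))) σ-φ))
                 (trans (σ.^-homo α (q ℕ.* i)) (trans (^-congˡ (q ℕ.* i) σ-α) (^-distrib-* Z α (q ℕ.* i))))) ⟩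
          (Z ^ i * φ) * (Z ^ (q ℕ.* i) * α ^ (q ℕ.* i))
            ≈⟨ interchange _ _ _ _ ⟩
          (Z ^ i * Z ^ (q ℕ.* i)) * γ
            ≈⟨ *-congʳ (trans (sym (^-homo-* Z i (q ℕ.* i))) (trans (^-congʳ Z (ℕ.*-comm p i)) (trans (sym (^-assocʳ Z i p)) (U.ζ^i-^p i)))) ⟩
          1# * γ ≈⟨ *-identityˡ γ ⟩
          γ ∎

        ρ-commute : ∀ x → FieldHom.⟦_⟧ (ρ i) τ.⟦ x ⟧ ≈ τ.⟦ FieldHom.⟦_⟧ (ρ i) x ⟧
        ρ-commute x = trans (σ.⟦⟧-cong (reflexive (↑-suc τ.⟦_⟧ i x))) (commute _)

        ρ-fixed : ∀ {x} → τ.⟦ x ⟧ ≈ x → FieldHom.⟦_⟧ (ρ i) x ≈ x → ∃ λ y → j.⟦ y ⟧ ≈ x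
        ρ-fixed τx≈x ρx≈x = fixed τx≈x (trans (σ.⟦⟧-cong (sym (↑-fixed i τx≈x))) ρx≈x)

        KC = adjoin em q pr F d d≉0 d∉Fᵖ
        module C = Hilbert em q pr odd d≉0 ζ prim KC using
          ( module ι; *-assoc; *-comm; *-cong; *-congʳ; *-congˡ; *-nonzero; 0#; Carrier; K; N; N-*; N-^
          ; N-cong; N-monomial; N-nonzero; Rigid; X; X≉0; ^-assocʳ; ^-congˡ; ^-distrib-*; ^-nonzero
          ; _*_; _^_; _≈_; _≉_; nonzero-resp; norm; rigid; structure; sym; trans; ι-norm )
        module S = Subfield.Embedding em q pr d≉0 ζ prim KC j conjugation (ρ i)
          γ γ^p≈d τ-j ρ-j τ-γ ρ-γ ρ-commute order ρ-fixed

        module ev = HomKit em S.embed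

        -- The conjugates of z under powers of σ τⁱ and of σ differ by powers of τ, which do not
        -- change N.
        N-ρ : N (Nρ.N i z) ≈ Nσ.N (N z)
        N-ρ = begin
          N (Nρ.N i z)
            ≈⟨ N-∏ _ ⟩
          ∏ {p} (λ n → N ((FieldHom.⟦_⟧ (ρ i) ↑ toℕ n) z))
            ≈⟨ ∏-cong {p} (λ n → trans (N-cong (trans (ρ-↑ i (toℕ n) z) (σ^-τ^ (toℕ n) (toℕ n ℕ.* i) z)))
                 (N-conjugate-↑ order (toℕ n ℕ.* i) (Nσ.↑.nonzero (toℕ n) z≉0))) ⟩
          ∏ {p} (λ n → N ((σ.⟦_⟧ ↑ toℕ n) z))
            ≈⟨ N-∏ _ ⟨
          N (Nσ.N z)
            ≈⟨ norms-commute z ⟩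
          Nσ.N (N z) ∎

        pre = S.fixed⇒image (Nρ.fixes-N i (ρ-order i) z≉0)
        w = proj₁ pre
        w≉0 : w C.≉ C.0#
        w≉0 = ev.reflect-nonzero (nonzero-resp (sym (proj₂ pre)) (Nρ.N-nonzero i z≉0))

        rigid-C : C.Rigid
        rigid-C = C.rigid (rigid-F d d≉0 d∉Fᵖ)

        -- In N_{ρᵢ}(z) = φᵢˢ g uᵖ the exponent s is divisible by p, since the
        -- norm of the left-hand side to F is a p-th power.
        decompose : ∀ {m u s g} → g FK.≉ FK.0# → m C.≈ C.X C.^ s C.* C.ι.⟦ g ⟧ → u C.≉ C.0# → w C.≈ m C.* u C.^ p →
          ∃ λ g → ∃ λ v → g FK.≉ FK.0# × v C.≉ C.0# × w C.≈ C.ι.⟦ g ⟧ C.* v C.^ p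
        decompose {m} {u} {s} {g} g≉0 m≈ u≉0 w≈ = by-divisibility em
          where
          g-norm-eq : d FK.^ s FK.* (g FK.* C.norm u) FK.^ p FK.≈ h FK.^ p
          g-norm-eq = j.injective (begin
            j.⟦ d FK.^ s FK.* (g FK.* C.norm u) FK.^ p ⟧  ≈⟨ S.embed-ι _ ⟨
            ev.⟦ C.ι.⟦ d FK.^ s FK.* (g FK.* C.norm u) FK.^ p ⟧ ⟧ ≈⟨ ev.⟦⟧-cong Nw ⟨
            ev.⟦ C.N w ⟧  ≈⟨ ev.⟦⟧-cong (C.ι-norm w≉0) ⟨
            ev.⟦ C.ι.⟦ C.norm w ⟧ ⟧  ≈⟨ S.embed-ι _ ⟩
            j.⟦ C.norm w ⟧  ≈⟨ S.embed-N w≉0 ⟨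
            N ev.⟦ w ⟧  ≈⟨ trans (N-cong (proj₂ pre)) (trans N-ρ double) ⟩
            j.⟦ h ⟧ ^ p  ≈⟨ j.^-homo h p ⟨
            j.⟦ h FK.^ p ⟧  ∎)
            where
            Nw : C.N w C.≈ C.ι.⟦ d FK.^ s FK.* (g FK.* C.norm u) FK.^ p ⟧
            Nw = C.trans (C.N-cong w≈) (C.trans (C.N-* _ _) (C.trans
              (C.*-cong (C.trans (C.N-cong m≈) (C.N-monomial s g)) (C.trans (C.N-^ u p) (C.^-congˡ p (C.sym (C.ι-norm u≉0)))))
              (C.trans (C.*-congˡ (C.sym (C.ι.^-homo _ p))) (C.trans (C.sym (C.ι.*-homo _ _)) (C.ι.⟦⟧-cong
                (FK.trans (FK.*-assoc _ _ _) (FK.*-congˡ (FK.sym (FK.^-distrib-* _ _ p)))))))))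
          norm-u≉0 : C.norm u FK.≉ FK.0#
          norm-u≉0 = C.ι.reflect-nonzero (C.nonzero-resp (C.sym (C.ι-norm u≉0)) (C.N-nonzero u≉0))
          by-divisibility : Dec (Lift (c ⊔ ℓ) (p ∣ s)) → ∃ λ g → ∃ λ v → g FK.≉ FK.0# × v C.≉ C.0# × w C.≈ C.ι.⟦ g ⟧ C.* v C.^ p
          by-divisibility (no p∤s) = ⊥-elim (d∉Fᵖ (F.root-of-power s (p∤s ∘ lift) d≉0 (FK.*-nonzero g≉0 norm-u≉0) h≉0 g-norm-eq))
          by-divisibility (yes (lift (divides r ≡.refl))) = g , C.X C.^ r C.* u , g≉0 , C.*-nonzero (C.^-nonzero r C.X≉0) u≉0 ,
            C.trans w≈ (C.trans (C.*-congʳ (C.trans m≈ (C.*-comm _ _))) (C.trans (C.*-assoc _ _ _)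
              (C.*-congˡ (C.trans (C.*-congʳ (C.sym (C.^-assocʳ C.X r p))) (C.sym (C.^-distrib-* _ u p))))))

        decomposition : ∃ λ g → ∃ λ v → g FK.≉ FK.0# × v C.≉ C.0# × w C.≈ C.ι.⟦ g ⟧ C.* v C.^ p
        decomposition =
          let m , u , (s , g , g≉0 , m≈) , u≉0 , w≈ = C.structure rigid-C w≉0
          in decompose {m} {u} {s} {g} g≉0 m≈ u≉0 w≈

        g : FK.Carrier
        g = proj₁ decomposition

        v : C.Carrier
        v = proj₁ (proj₂ decomposition)

        v≉0 : v C.≉ C.0#
        v≉0 = proj₁ (proj₂ (proj₂ (proj₂ decomposition)))

        κ : Carrier
        κ = ev.⟦ v ⟧

        κ≉0 : κ ≉ 0#
        κ≉0 = ev.nonzero v≉0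

        norm-ρ : Nρ.N i z ≈ j.⟦ g ⟧ * κ ^ p
        norm-ρ = trans (sym (proj₂ pre)) (trans (ev.⟦⟧-cong (proj₂ (proj₂ (proj₂ (proj₂ decomposition)))))
          (trans (ev.*-homo _ _) (*-cong (S.embed-ι g) (ev.^-homo v p))))

        μ : E.Carrier
        μ = E.ι.⟦ C.norm v ⟧

        N-κ : N κ ≈ ι.⟦ μ ⟧
        N-κ = S.embed-N v≉0

        -- Rigidity of F puts the norm of v in ⟨d⟩ Ḟᵖ, and over E the radicand d differs from f by a
        -- p-th power.
        μ∈ : EC.InClass fᴱ μ
        μ∈ = let s , y , y≉0 , e = rigid-C v≉0 in
          s , (E.X E.^ (q ℕ.* i)) E.^ s E.* E.ι.⟦ y ⟧ , E.*-nonzero (E.^-nonzero s X^qi≉0) (E.ι.nonzero y≉0) ,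
          E.trans (E.ι.⟦⟧-cong e) (E.trans (E.ι.*-homo _ _) (E.trans
            (E.*-cong (E.trans (E.ι.^-homo d s) (E.trans (E.^-congˡ s E-d) (E.^-distrib-* _ _ s))) (E.ι.^-homo y p))
            (E.trans (E.*-assoc _ _ _) (E.*-congˡ (E.trans (E.*-congʳ (E.^-^-comm _ p s)) (E.sym (E.^-distrib-* _ _ p)))))))

    -- w = z h / (e Πκᵢ) has its p-th power in F, so w = u φᵗ αˢ with u ∈ F; the
    -- norms of φ, α, u, e, h and of the κᵢ are known.
    norm-class : ∀ {n g e} → g FK.≉ FK.0# → e E.≉ E.0# →
      N z ≈ ι.⟦ n ⟧ → n E.≈ E.ι.⟦ g ⟧ E.* e E.^ p → EC.InClass fᴱ n
    norm-class {n} {g} {e} g≉0 e≉0 Nz≈n n≈ = EC.class-cancel (E.ι.nonzero f≉0) M∈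
      (EC.class-resp (E.sym (ι.injective norm-identity)) (EC.class-* (EC.class-* (EC.class-∏ λ i → I.μ∈ (toℕ i)) (EC.class-power e≉0))
        (EC.class-power u₀≉0)))
      where
      module I = Intermediate
      G : FK.Carrier
      G = FK.∏ (λ (i : Fin p) → I.g (toℕ i)) FK.* g
      B C w : Carrier
      B = ∏ (λ (i : Fin p) → I.κ (toℕ i)) * ι.⟦ e ⟧
      C = z * j.⟦ h ⟧
      w = C * B ⁻¹
      B≉0 : B ≉ 0#
      B≉0 = *-nonzero (∏-nonzero λ i → I.κ≉0 (toℕ i)) (ι.nonzero e≉0)
      w≉0 : w ≉ 0#
      w≉0 = *-nonzero (*-nonzero z≉0 (j.nonzero h≉0)) (⁻¹-nonzero B≉0)
      wB≈C : w * B ≈ C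
      wB≈C = trans (*-assoc _ _ _) (trans (*-congˡ (⁻¹-inverseˡ B≉0)) (*-identityʳ C))
      C^p : C ^ p ≈ j.⟦ G ⟧ * B ^ p
      C^p = begin
        C ^ p
          ≈⟨ ^-distrib-* z _ p ⟩
        z ^ p * j.⟦ h ⟧ ^ p
          ≈⟨ *-congˡ double ⟨
        z ^ p * Nσ.N (N z)
          ≈⟨ product-of-norms ⟨
        ∏ (λ (i : Fin p) → Nρ.N (toℕ i) z) * N z
          ≈⟨ *-cong (∏-cong λ (i : Fin p) → I.norm-ρ (toℕ i)) (trans Nz≈n (trans (ι.⟦⟧-cong n≈) (trans (ι.*-homo _ _) (*-congˡ (ι.^-homo e p))))) ⟩
        ∏ (λ (i : Fin p) → j.⟦ I.g (toℕ i) ⟧ * I.κ (toℕ i) ^ p) * (j.⟦ g ⟧ * ι.⟦ e ⟧ ^ p)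
          ≈⟨ *-congʳ (trans (∏-* _ _) (*-cong (sym (j.∏-homo _)) (sym (^-∏ _ p)))) ⟩
        (j.⟦ FK.∏ (λ (i : Fin p) → I.g (toℕ i)) ⟧ * ∏ (λ (i : Fin p) → I.κ (toℕ i)) ^ p) * (j.⟦ g ⟧ * ι.⟦ e ⟧ ^ p)
          ≈⟨ interchange _ _ _ _ ⟩
        (j.⟦ FK.∏ (λ (i : Fin p) → I.g (toℕ i)) ⟧ * j.⟦ g ⟧) * (∏ (λ (i : Fin p) → I.κ (toℕ i)) ^ p * ι.⟦ e ⟧ ^ p)
          ≈⟨ *-cong (sym (j.*-homo _ _)) (sym (^-distrib-* _ _ p)) ⟩
        j.⟦ G ⟧ * B ^ p ∎
      w^p : w ^ p ≈ j.⟦ G ⟧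
      w^p = *-cancel (^-nonzero p B≉0) (trans (*-comm _ _) (trans (sym (^-distrib-* w B p))
        (trans (^-congˡ p wB≈C) (trans C^p (*-comm _ _)))))
      -- Since wᵖ lies in F, the quotient θ(w)/w is a p-th root of unity.
      eigenvalue : (θ : FieldHom K K) → (∀ x → FieldHom.⟦_⟧ θ j.⟦ x ⟧ ≈ j.⟦ x ⟧) → ∃ λ s → FieldHom.⟦_⟧ θ w ≈ Z ^ s * w
      eigenvalue θ θ-j = let s , eq = U.exponent root-of-unity in s , trans (sym cancel) (*-congʳ eq)
        where
        module θ = HomKit em θ
        cancel : (θ.⟦ w ⟧ * w ⁻¹) * w ≈ θ.⟦ w ⟧
        cancel = trans (*-assoc _ _ _) (trans (*-congˡ (⁻¹-inverseˡ w≉0)) (*-identityʳ _))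
        root-of-unity : (θ.⟦ w ⟧ * w ⁻¹) ^ p ≈ 1#
        root-of-unity = trans (^-distrib-* _ _ p) (trans (*-congʳ (trans (sym (θ.^-homo w p)) (trans (θ.⟦⟧-cong w^p)
          (trans (θ-j G) (sym w^p))))) (trans (*-comm _ _) (⁻¹-^ p w≉0)))
      t s : ℕ
      t = proj₁ (eigenvalue conjugation τ-j)
      s = proj₁ (eigenvalue σ-hom σ-j)
      -- The exponents t q and s q stand for -t and -s; they offset the eigenvalues of w under τ and
      -- σ, so that w times this monomial lies in F.
      monomial : Carrier
      monomial = φ ^ (t ℕ.* q) * α ^ (s ℕ.* q)
      Z-cancel : ∀ m y → Z ^ m * y * Z ^ (m ℕ.* q) ≈ y
      Z-cancel m y = trans (solve 3 (λ a y b → (a ⊕ y) ⊕ b ⊜ (a ⊕ b) ⊕ y) refl _ y _)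
        (trans (*-congʳ (trans (*-congˡ (sym (^-assocʳ Z m q))) (U.ζ^i-^p m))) (*-identityˡ y))
        where open *-Solver
      u₀-spec : ∃ λ u₀ → j.⟦ u₀ ⟧ ≈ w * monomial
      u₀-spec = fixed
        (begin
          τ.⟦ w * monomial ⟧
            ≈⟨ trans (τ.*-homo _ _) (*-cong (proj₂ (eigenvalue conjugation τ-j)) (trans (τ.*-homo _ _) (*-cong
                 (trans (τ.^-homo φ (t ℕ.* q)) (trans (^-congˡ (t ℕ.* q) τ-X) (^-distrib-* Z φ (t ℕ.* q))))
                 (trans (τ.^-homo α (s ℕ.* q)) (^-congˡ (s ℕ.* q) (τ-ι E.X)))))) ⟩
          Z ^ t * w * ((Z ^ (t ℕ.* q) * φ ^ (t ℕ.* q)) * α ^ (s ℕ.* q))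
            ≈⟨ solve 4 (λ x y z w → x ⊕ ((y ⊕ z) ⊕ w) ⊜ (x ⊕ y) ⊕ (z ⊕ w)) refl _ _ _ _ ⟩
          Z ^ t * w * Z ^ (t ℕ.* q) * monomial
            ≈⟨ *-congʳ (Z-cancel t w) ⟩
          w * monomial ∎)
        (begin
          σ.⟦ w * monomial ⟧
            ≈⟨ trans (σ.*-homo _ _) (*-cong (proj₂ (eigenvalue σ-hom σ-j)) (trans (σ.*-homo _ _) (*-cong
                 (trans (σ.^-homo φ (t ℕ.* q)) (^-congˡ (t ℕ.* q) σ-φ))
                 (trans (σ.^-homo α (s ℕ.* q)) (trans (^-congˡ (s ℕ.* q) σ-α) (^-distrib-* Z α (s ℕ.* q))))))) ⟩
          Z ^ s * w * (φ ^ (t ℕ.* q) * (Z ^ (s ℕ.* q) * α ^ (s ℕ.* q)))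
            ≈⟨ solve 4 (λ x y z w → x ⊕ (y ⊕ (z ⊕ w)) ⊜ (x ⊕ z) ⊕ (y ⊕ w)) refl _ _ _ _ ⟩
          Z ^ s * w * Z ^ (s ℕ.* q) * monomial
            ≈⟨ *-congʳ (Z-cancel s w) ⟩
          w * monomial ∎)
        where open *-Solver
      u₀ = proj₁ u₀-spec
      u₀≉0 : E.ι.⟦ u₀ ⟧ E.≉ E.0#
      u₀≉0 = ι.reflect-nonzero (nonzero-resp (sym (proj₂ u₀-spec))
        (*-nonzero w≉0 (*-nonzero (^-nonzero (t ℕ.* q) X≉0) (^-nonzero (s ℕ.* q) α≉0))))
      C-identity : C * monomial ≈ B * j.⟦ u₀ ⟧
      C-identity = trans (*-congʳ (sym wB≈C)) (trans (trans (*-congʳ (*-comm _ _)) (*-assoc _ _ _)) (*-congˡ (sym (proj₂ u₀-spec))))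
      -- The norm to E of h times the monomial, so that M n is the norm of `C * monomial`.
      M : E.Carrier
      M = E.ι.⟦ h ⟧ E.^ p E.* (fᴱ E.^ (t ℕ.* q) E.* (E.X E.^ (s ℕ.* q)) E.^ p)
      M∈ : EC.InClass fᴱ M
      M∈ = EC.class-* (EC.class-power (E.ι.nonzero h≉0)) (EC.class-* (EC.class-^ (t ℕ.* q) EC.class-generator)
        (EC.class-power (E.^-nonzero (s ℕ.* q) E.X≉0)))
      norm-identity : ι.⟦ M E.* n ⟧ ≈ ι.⟦ E.∏ (λ (i : Fin p) → I.μ (toℕ i)) E.* e E.^ p E.* E.ι.⟦ u₀ ⟧ E.^ p ⟧
      norm-identity = begin
        ι.⟦ M E.* n ⟧
          ≈⟨ trans (ι.*-homo _ _) (*-cong (trans (ι.*-homo _ _) (*-cong (sym (N-ι _)) (trans (ι.*-homo _ _) (*-cong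
               (sym (trans (N-^ φ (t ℕ.* q)) (trans (^-congˡ (t ℕ.* q) N-X) (sym (ι.^-homo fᴱ (t ℕ.* q))))))
               (sym (trans (N-cong (sym (ι.^-homo E.X (s ℕ.* q)))) (N-ι _))))))) (sym Nz≈n)) ⟩
        (N j.⟦ h ⟧ * (N (φ ^ (t ℕ.* q)) * N (α ^ (s ℕ.* q)))) * N z
          ≈⟨ solve 3 (λ h m z → (h ⊕ m) ⊕ z ⊜ (z ⊕ h) ⊕ m) refl _ _ _ ⟩
        (N z * N j.⟦ h ⟧) * (N (φ ^ (t ℕ.* q)) * N (α ^ (s ℕ.* q)))
          ≈⟨ trans (*-cong (sym (N-* _ _)) (sym (N-* _ _))) (sym (N-* _ _)) ⟩
        N (C * monomial)
          ≈⟨ N-cong C-identity ⟩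
        N (B * j.⟦ u₀ ⟧)
          ≈⟨ trans (N-* _ _) (*-cong (trans (N-* _ _) (*-cong (trans (N-∏ _) (trans (∏-cong λ (i : Fin p) → I.N-κ (toℕ i)) (sym (ι.∏-homo _)))) (N-ι e))) (N-ι _)) ⟩
        (ι.⟦ E.∏ (λ (i : Fin p) → I.μ (toℕ i)) ⟧ * ι.⟦ e E.^ p ⟧) * ι.⟦ E.ι.⟦ u₀ ⟧ E.^ p ⟧
          ≈⟨ trans (*-congʳ (sym (ι.*-homo _ _))) (sym (ι.*-homo _ _)) ⟩
        ι.⟦ E.∏ (λ (i : Fin p) → I.μ (toℕ i)) E.* e E.^ p E.* E.ι.⟦ u₀ ⟧ E.^ p ⟧ ∎
        where open *-Solver

-- Norms from E(ᵖ√b).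

module RigidityTransfer {c ℓ} (em : ExcludedMiddle (c ⊔ ℓ)) (q : ℕ) (pr : Prime (suc q)) (odd : ¬ (2 ∣ suc q))
  {F : Field c ℓ} (ζ : Field.Carrier F) (prim : IsPrimitiveRoot F (suc q) ζ) (rigid-F : IsRigid (suc q) F)
  {a : Field.Carrier F} (a≉0 : ¬ Field._≈_ F a (Field.0# F)) (a∉Fᵖ : ¬ IsNonzeroPower F (suc q) a)
  (KE : Kummer em q F a) where
  open Hilbert em q pr odd a≉0 ζ prim KE using
    ( module *-Solver; module ι; *-assoc; *-comm; *-cong; *-congʳ; *-congˡ; *-identityʳ
    ; *-identityˡ; *-nonzero; interchange; 0#; 1#; 1^n; 1≉0; Carrier; IsPower; K; N; N-*; N-^; N-cong
    ; N-monomial; N-nonzero; X; X^p≈g; X≉0; Z; ^-^-comm; ^-assocʳ; ^-congˡ; ^-distrib-*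
    ; ^-homo-*; ^-nonzero; _*_; _^_; _⁻¹; _∎; _≈_; _≉_; begin_; nonzero-resp; norm; refl; rigid
    ; step-≈-⟨; step-≈-⟩; structure; sym; trans; ι; ι-norm; ⁻¹-^ )
  private
    module F = FieldKit em F
    module FC = CoprimePowers em q pr F
    module EC = CoprimePowers em q pr K
    p = suc q
    primᴱ = prim-image em ι prim

  -- The normal form given by `structure`, with `X` = ᵖ√a. The exponent is an unreduced index, so
  -- that it can be computed for products; a multiple of p is moved into the p-th power by `absorb`.
  record Shape (j : ℕ) (g : F.Carrier) (e x : Carrier) : Set ℓ where
    constructor shaped
    field
      scalar≉0 : g F.≉ F.0#
      root≉0   : e ≉ 0#
      factored : x ≈ X ^ j * ι.⟦ g ⟧ * e ^ p

  open Shape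

  shape : ∀ {x} → x ≉ 0# → ∃ λ j → ∃ λ g → ∃ λ e → Shape j g e x
  shape x≉0 =
    let m , e , (j , g , g≉0 , m≈) , e≉0 , x≈ = structure (rigid (rigid-F a a≉0 a∉Fᵖ)) x≉0
    in j , g , e , shaped g≉0 e≉0 (trans x≈ (*-congʳ m≈))

  shape-* : ∀ {i j f g d e x y} → Shape i f d x → Shape j g e y → Shape (i ℕ.+ j) (f F.* g) (d * e) (x * y)
  shape-* {i} {j} (shaped f≉0 d≉0 x≈) (shaped g≉0 e≉0 y≈) = shaped (F.*-nonzero f≉0 g≉0) (*-nonzero d≉0 e≉0)
    (trans (*-cong x≈ y≈) (trans (interchange _ _ _ _) (*-cong
      (trans (interchange _ _ _ _) (*-cong (sym (^-homo-* X i j)) (sym (ι.*-homo _ _)))) (sym (^-distrib-* _ _ p)))))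

  shape-^ : ∀ {i f d x} m → Shape i f d x → Shape (m ℕ.* i) (f F.^ m) (d ^ m) (x ^ m)
  shape-^ zero  _ = shaped F.1≉0 1≉0 (sym (trans (*-cong (trans (*-identityˡ _) ι.1-homo) (1^n p)) (*-identityˡ 1#)))
  shape-^ (suc m) s = shape-* s (shape-^ m s)

  absorb : ∀ {r g e x} → Shape (r ℕ.* p) g e x → x ≈ ι.⟦ g ⟧ * (X ^ r * e) ^ p
  absorb {r} (shaped _ _ x≈) = trans x≈ (trans (*-congʳ (trans (*-comm _ _) (*-congˡ (sym (^-assocʳ X r p)))))
    (trans (*-assoc _ _ _) (*-congˡ (sym (^-distrib-* _ _ p)))))

  norm-shape : ∀ {j g e x} → Shape j g e x → N x ≈ ι.⟦ a F.^ j F.* (g F.* norm e) F.^ p ⟧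
  norm-shape {j} {g} {e} (shaped _ e≉0 x≈) = trans (N-cong x≈) (trans (N-* _ _) (trans
    (*-cong (N-monomial j g) (trans (N-^ e p) (trans (^-congˡ p (sym (ι-norm e≉0))) (sym (ι.^-homo _ p)))))
    (trans (sym (ι.*-homo _ _)) (ι.⟦⟧-cong (F.trans (F.*-assoc _ _ _) (F.*-congˡ (F.sym (F.^-distrib-* _ _ p))))))))

  norm≉0 : ∀ {e} → e ≉ 0# → norm e F.≉ F.0#
  norm≉0 e≉0 = ι.reflect-nonzero (nonzero-resp (sym (ι-norm e≉0)) (N-nonzero e≉0))

  module _ {f : F.Carrier} (f≉0 : f F.≉ F.0#) (f∉Eᵖ : ¬ IsPower ι.⟦ f ⟧) where

    -- In aˢ yᵖ = fʳ xᵖ, a multiple r of p would make a a p-th power in F, and any other r would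
    -- make f one in E, where a = (ᵖ√a)ᵖ.
    independent-of-a : ∀ {s y} → y F.≉ F.0# → ¬ (p ∣ s) → ¬ FC.InClass f (a F.^ s F.* y F.^ p)
    independent-of-a {s} {y} y≉0 p∤s (r , x , x≉0 , e) = by-divisibility r e em
      where
      by-divisibility : ∀ r → a F.^ s F.* y F.^ p F.≈ f F.^ r F.* x F.^ p → Dec (Lift (c ⊔ ℓ) (p ∣ r)) → ⊥
      by-divisibility r e (yes (lift (divides r′ ≡.refl))) = a∉Fᵖ (FC.root-of-power s p∤s a≉0 y≉0
        (F.*-nonzero (F.^-nonzero r′ f≉0) x≉0)
        (F.trans e (F.trans (F.*-congʳ (F.sym (F.^-assocʳ f r′ p))) (F.sym (F.^-distrib-* _ _ p)))))
      by-divisibility r e (no p∤r) = f∉Eᵖ (EC.root-of-power r (p∤r ∘ lift) (ι.nonzero f≉0) (ι.nonzero x≉0)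
        (*-nonzero (^-nonzero s X≉0) (ι.nonzero y≉0)) (begin
          ι.⟦ f ⟧ ^ r * ι.⟦ x ⟧ ^ p  ≈⟨ *-cong (ι.^-homo f r) (ι.^-homo x p) ⟨
          ι.⟦ f F.^ r ⟧ * ι.⟦ x F.^ p ⟧  ≈⟨ trans (ι.⟦⟧-cong e) (ι.*-homo _ _) ⟨
          ι.⟦ a F.^ s F.* y F.^ p ⟧  ≈⟨ trans (ι.*-homo _ _) (*-cong (ι.^-homo a s) (ι.^-homo y p)) ⟩
          ι.⟦ a ⟧ ^ s * ι.⟦ y ⟧ ^ p  ≈⟨ *-congʳ (trans (^-congˡ s (sym X^p≈g)) (^-^-comm X p s)) ⟩
          (X ^ s) ^ p * ι.⟦ y ⟧ ^ p  ≈⟨ ^-distrib-* _ _ p ⟨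
          (X ^ s * ι.⟦ y ⟧) ^ p  ∎))

    KL : Kummer em q K ι.⟦ f ⟧
    KL = adjoin em q pr K ι.⟦ f ⟧ (ι.nonzero f≉0) f∉Eᵖ

    private
      module L = Galois em q pr (ι.nonzero f≉0) Z primᴱ KL using
        ( module ι; 0#; N; _^_; _≈_; _≉_; sym; trans )
      module T = Tower em q pr odd ζ prim rigid-F a≉0 KE f≉0 f∉Eᵖ KL

    double-norm-shape : ∀ {j g e x z} → Shape j g e x → L.N z L.≈ L.ι.⟦ x ⟧ →
      T.Nσ.N (L.N z) L.≈ L.ι.⟦ ι.⟦ a F.^ j F.* (g F.* norm e) F.^ p ⟧ ⟧
    double-norm-shape {x = x} s Nz≈x = L.trans (T.Nσ.N-cong Nz≈x) (L.trans (T.Nσ-ι x) (L.ι.⟦⟧-cong (norm-shape s)))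

    -- By transitivity N_{E/F}(x) = aʲ (g N(e))ᵖ lies in ⟨f⟩ Ḟᵖ, which `independent-of-a` excludes
    -- when p does not divide j.
    norm-exponent : ∀ {j g e x z} → Shape j g e x → z L.≉ L.0# → L.N z L.≈ L.ι.⟦ x ⟧ → p ∣ j
    norm-exponent {j} s@(shaped g≉0 e≉0 _) z≉0 Nz≈x = by-divisibility em
      where
      by-divisibility : Dec (Lift (c ⊔ ℓ) (p ∣ j)) → p ∣ j
      by-divisibility (yes (lift p∣j)) = p∣j
      by-divisibility (no p∤j) =
        let m , m∈ , eq = T.double-norm z≉0
        in ⊥-elim (independent-of-a (F.*-nonzero g≉0 (norm≉0 e≉0)) (p∤j ∘ lift)
          (FC.class-resp (HomKit.injective em T.j (L.trans (L.sym eq) (double-norm-shape s Nz≈x))) m∈))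

    -- For j = r p the double norm aʲ (g N(e))ᵖ is the p-th power of h = aʳ g N(e), as the bicyclic
    -- argument requires.
    of-shape : ∀ {j g e n z} → Shape j g e n → p ∣ j → z L.≉ L.0# → L.N z L.≈ L.ι.⟦ n ⟧ → EC.InClass ι.⟦ f ⟧ n
    of-shape {_} {g} {e} s (divides r ≡.refl) z≉0 Nz≈n =
      T.norm-class z≉0 h≉0 double (scalar≉0 s) (*-nonzero (^-nonzero r X≉0) (root≉0 s)) Nz≈n (absorb {r} s)
      where
      h : F.Carrier
      h = a F.^ r F.* (g F.* norm e)
      h≉0 : h F.≉ F.0#
      h≉0 = F.*-nonzero (F.^-nonzero r a≉0) (F.*-nonzero (scalar≉0 s) (norm≉0 (root≉0 s)))
      double : T.Nσ.N (L.N _) L.≈ FieldHom.⟦_⟧ T.j h L.^ p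
      double = L.trans (double-norm-shape s Nz≈n) (L.trans
        (L.ι.⟦⟧-cong (ι.⟦⟧-cong (F.trans (F.*-congʳ (F.sym (F.^-assocʳ a r p))) (F.sym (F.^-distrib-* _ _ p)))))
        (HomKit.^-homo em T.j h p))

    norm-in-class : ∀ {n z} → n ≉ 0# → z L.≉ L.0# → L.N z L.≈ L.ι.⟦ n ⟧ → EC.InClass ι.⟦ f ⟧ n
    norm-in-class n≉0 z≉0 Nz≈n =
      let j , g , e , s = shape n≉0
      in of-shape s (norm-exponent s z≉0 Nz≈n) z≉0 Nz≈n

  module _ {b : Carrier} (b≉0 : b ≉ 0#) (b∉Eᵖ : ¬ IsPower b) (KB : Kummer em q K b) where
    private
      module B = Hilbert em q pr odd b≉0 Z primᴱ KB using
        ( module ι; *-cong; *-congʳ; 0#; Carrier; N; N-*; N-X; N-^; N-ι; X; ^-congˡ; _*_; _^_; _≈_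
        ; _≉_; sym; trans )

    module _ {n z} (n≉0 : n ≉ 0#) (z≉0 : z B.≉ B.0#) (Nz≈n : B.N z B.≈ B.ι.⟦ n ⟧) where

      -- Here b = f eᵖ with f in F, so z can be moved to E(ᵖ√f) and the bicyclic case applies.
      class-if-divides : ∀ {i f d} → Shape i f d b → p ∣ i → EC.InClass b n
      class-if-divides {_} {f} {d} b-shape (divides r ≡.refl) =
        let z′ , z′≉0 , Nz′≈n = NormTransfer.norm-transfer em q pr b≉0 (ι.nonzero f≉0) Z primᴱ KB (KL f≉0 f∉Eᵖ) b≈ z≉0 Nz≈n
            s , y , y≉0 , n≈ = norm-in-class f≉0 f∉Eᵖ n≉0 z′≉0 Nz′≈n
        in EC.class-cancel-power (^-nonzero s e≉0) (s , y , y≉0 , (begin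
          n * (e ^ s) ^ p  ≈⟨ *-cong n≈ (^-^-comm e s p) ⟩
          ι.⟦ f ⟧ ^ s * y ^ p * (e ^ p) ^ s   ≈⟨ solve 3 (λ u v w → (u ⊕ v) ⊕ w ⊜ (u ⊕ w) ⊕ v) refl _ _ _ ⟩
          ι.⟦ f ⟧ ^ s * (e ^ p) ^ s * y ^ p   ≈⟨ *-congʳ (trans (^-congˡ s b≈) (^-distrib-* _ _ s)) ⟨
          b ^ s * y ^ p  ∎))
        where
        open *-Solver
        e = X ^ r * d
        e≉0 : e ≉ 0#
        e≉0 = *-nonzero (^-nonzero r X≉0) (root≉0 b-shape)
        f≉0 = scalar≉0 b-shape
        b≈ : b ≈ ι.⟦ f ⟧ * e ^ p
        b≈ = absorb {r} b-shape
        f∉Eᵖ : ¬ IsPower ι.⟦ f ⟧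
        f∉Eᵖ (y , y≉0 , eq) = b∉Eᵖ (y * e , *-nonzero y≉0 e≉0 , trans b≈ (trans (*-congʳ eq) (sym (^-distrib-* _ _ p))))

      -- Some n bᵐ = g eᵖ has g in F.  If g is not a p-th power in E, then b is
      -- a norm from E(ᵖ√g), against norm-exponent.
      class-of-shape : ∀ {i f d j g e} → Shape i f d b → Shape j g e n → ¬ (p ∣ i) → EC.InClass b n
      class-of-shape {i} {f} {d} {j} {g} {e} b-shape n-shape p∤i = by-power em
        where
        0<i%p : 0 ℕ.< i % p
        0<i%p = ℕ.n≢0⇒n>0 λ i%p≡0 → p∤i (m%n≡0⇒n∣m i p i%p≡0)
        inverse = Residues.inverse q pr (i % p) 0<i%p (m%n<n i p)
        v = proj₁ inverse
        t = proj₁ (proj₂ inverse)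
        -- As v inverts i modulo p and q ≡ -1, the exponent j + m i of ᵖ√a in n bᵐ is a multiple r p
        -- of p.
        m = q ℕ.* v ℕ.* j
        exponent-eq : j ℕ.+ m ℕ.* i ≡ (j ℕ.+ q ℕ.* t ℕ.* j ℕ.+ q ℕ.* v ℕ.* j ℕ.* (i / p)) ℕ.* p
        exponent-eq = ≡.trans (≡.cong (λ x → j ℕ.+ m ℕ.* x) (m≡m%n+[m/n]*n i p))
          (≡.trans (expand j q v (i % p) (i / p)) (≡.trans
            (≡.cong (λ x → j ℕ.+ q ℕ.* j ℕ.* x ℕ.+ q ℕ.* v ℕ.* j ℕ.* (i / p) ℕ.* p) (proj₂ (proj₂ inverse)))
            (collect j q t (q ℕ.* v ℕ.* j ℕ.* (i / p)))))
          where
          expand : ∀ j q v r s → j ℕ.+ q ℕ.* v ℕ.* j ℕ.* (r ℕ.+ s ℕ.* (1 ℕ.+ q)) ≡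
            j ℕ.+ q ℕ.* j ℕ.* (r ℕ.* v) ℕ.+ q ℕ.* v ℕ.* j ℕ.* s ℕ.* (1 ℕ.+ q)
          expand = solve-∀
          collect : ∀ j q t s → j ℕ.+ q ℕ.* j ℕ.* (1 ℕ.+ t ℕ.* (1 ℕ.+ q)) ℕ.+ s ℕ.* (1 ℕ.+ q) ≡
            (j ℕ.+ q ℕ.* t ℕ.* j ℕ.+ s) ℕ.* (1 ℕ.+ q)
          collect = solve-∀
        r = j ℕ.+ q ℕ.* t ℕ.* j ℕ.+ q ℕ.* v ℕ.* j ℕ.* (i / p)
        n′ = n * b ^ m
        g′ = g F.* f F.^ m
        e′ = X ^ r * (e * d ^ m)
        n′-shape : Shape (r ℕ.* p) g′ (e * d ^ m) n′
        n′-shape = ≡.subst (λ s → Shape s g′ (e * d ^ m) n′) exponent-eq (shape-* n-shape (shape-^ m b-shape))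
        n′≈ : n′ ≈ ι.⟦ g′ ⟧ * e′ ^ p
        n′≈ = absorb {r} n′-shape
        g′≉0 = scalar≉0 n′-shape
        e′≉0 : e′ ≉ 0#
        e′≉0 = *-nonzero (^-nonzero r X≉0) (root≉0 n′-shape)
        from-n′ : EC.InClass b n′ → EC.InClass b n
        from-n′ n′∈ = EC.class-cancel b≉0 (EC.class-^ m EC.class-generator) (EC.class-resp (*-comm n (b ^ m)) n′∈)
        z′ : B.Carrier
        -- N(ᵖ√b) = b and e′ lies in E, so this element has norm n bᵐ / e′ᵖ = g′.
        z′ = (z B.* B.X B.^ m) B.* B.ι.⟦ e′ ⁻¹ ⟧
        Nz′ : B.N z′ B.≈ B.ι.⟦ ι.⟦ g′ ⟧ ⟧
        Nz′ = B.trans (B.N-* _ _) (B.trans (B.*-cong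
            (B.trans (B.N-* _ _) (B.*-cong Nz≈n (B.trans (B.N-^ B.X m) (B.trans (B.^-congˡ m B.N-X) (B.sym (B.ι.^-homo b m))))))
            (B.N-ι _))
          (B.trans (B.*-congʳ (B.sym (B.ι.*-homo _ _))) (B.trans (B.sym (B.ι.*-homo _ _)) (B.ι.⟦⟧-cong
            (trans (*-congʳ n′≈) (trans (*-assoc _ _ _) (trans (*-congˡ (trans (*-comm _ _) (⁻¹-^ p e′≉0))) (*-identityʳ _))))))))
        by-power : Dec (IsPower ι.⟦ g′ ⟧) → EC.InClass b n
        by-power (yes (y , y≉0 , eq)) = from-n′ (EC.class-resp (sym (trans n′≈ (trans (*-congʳ eq) (sym (^-distrib-* _ _ p)))))
          (EC.class-power (*-nonzero y≉0 e′≉0)))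
        by-power (no g′∉Eᵖ) =
          let u , u≉0 , Nu≈b = Symmetry.norm-symmetric em q pr b≉0 (ι.nonzero g′≉0) g′∉Eᵖ Z primᴱ KB (KL g′≉0 g′∉Eᵖ) z′ Nz′
          in ⊥-elim (p∤i (norm-exponent g′≉0 g′∉Eᵖ b-shape u≉0 Nu≈b))

    norm-class : ∀ {n z} → n ≉ 0# → z B.≉ B.0# → B.N z B.≈ B.ι.⟦ n ⟧ → EC.InClass b n
    norm-class {n} n≉0 z≉0 Nz≈n =
      let i , f , d , b-shape = shape b≉0
          j , g , e , n-shape = shape n≉0
      in by-divisibility b-shape n-shape em
      where
      by-divisibility : ∀ {i f d j g e} → Shape i f d b → Shape j g e n → Dec (Lift (c ⊔ ℓ) (p ∣ i)) → EC.InClass b n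
      by-divisibility b-shape n-shape (yes (lift p∣i)) = class-if-divides n≉0 z≉0 Nz≈n b-shape p∣i
      by-divisibility b-shape n-shape (no p∤i) = class-of-shape n≉0 z≉0 Nz≈n b-shape n-shape (p∤i ∘ lift)

-- Both given extensions acquire coordinates and thereby a conjugation; `det-norm` turns the given
-- determinant into a product of conjugates, and the resulting exponent of b is reduced modulo p.
theorem3p16 : ∀ {c ℓ} → ExcludedMiddle (c ⊔ ℓ) →
    (p : ℕ) → Prime p → ¬ (2 ∣ p) →
    (F : Field c ℓ) → ∃ (IsPrimitiveRoot F p) →
    (a : Field.Carrier F) → ¬ (Field._≈_ F a (Field.0# F)) → ¬ IsNonzeroPower F p a →
    (E : RootExtension p F a) →
    IsRigid p F → IsRigid p (RootExtension.K E)
theorem3p16 em zero  pr = ⊥-elim (¬prime[0] pr)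
theorem3p16 em (suc q) pr odd F (ζ , prim) a a≉0 a∉Fᵖ E rigid-F b b≉0 b∉Eᵖ R z n z≉0 (M , columns , n≈det) =
  let i , y , y≉0 , n≈ = Classes.reduce em q pr (RootExtension.K E) b≉0
        (RigidityTransfer.norm-class em q pr odd ζ prim rigid-F a≉0 a∉Fᵖ KE b≉0 b∉Eᵖ KB n≉0 z≉0 Nz≈n)
  in i , y ^ᴱ suc q , (y , y≉0 , Field.refl (RootExtension.K E)) , n≈
  where
  open Field (RootExtension.K E) using () renaming (_^_ to _^ᴱ_)
  KE = FromRootExtension.kummer em q pr a≉0 a∉Fᵖ E
  KB = FromRootExtension.kummer em q pr b≉0 b∉Eᵖ R
  module K = KummerKit em q pr KE
  module B = Galois em q pr b≉0 K.ι.⟦ ζ ⟧ (prim-image em (Kummer.ι KE) prim) KB using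
    ( module ι; N; N-nonzero; X; _*_; _^_; _≈_; det-norm; nonzero-resp; reflexive; sym; trans
    ; ∑≡sum )
  Nz≈n : B.N z B.≈ B.ι.⟦ n ⟧
  Nz≈n = B.sym (B.trans (B.ι.⟦⟧-cong n≈det) (B.det-norm z M λ j →
    B.trans (columns j) (B.reflexive (≡.sym (B.∑≡sum λ i → B.ι.⟦ M i j ⟧ B.* B.X B.^ toℕ i)))))
  n≉0 : ¬ Field._≈_ (RootExtension.K E) n (Field.0# (RootExtension.K E))
  n≉0 = B.ι.reflect-nonzero (B.nonzero-resp Nz≈n (B.N-nonzero z≉0))
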